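{- Let $X$ be a smooth projective geometrically irreducible curve over $\mathbb{F}_q$. The map $$\mathrm{Cl}\,X\longrightarrow\mathbb{P}\mathrm{Bun}_2^{\rm dec}X,\qquad[D]\longmapsto c_D$$ is surjective with fibres of the form $\{[D],[-D]\}$.
   Context: $\mathrm{Cl}\,X$ is the divisor class group of $X$. $\mathbb{P}\mathrm{Bun}_2X$ is the set of isomorphism classes of rank $2$ vector bundles on $X$ modulo tensoring with line bundles, and $\mathbb{P}\mathrm{Bun}_2^{\rm dec}X$ is the subset of classes of bundles that are isomorphic to a direct sum of two line bundles. $c_D$ denotes the class of $\mathcal{L}_D\oplus\mathcal{O}_X$, where $\mathcal{L}_D$ is the line bundle associated to the divisor $D$. -}

module Defs where

open import Algebra.Bundles using (CommutativeRing)
import Algebra.Definitions.RawMonoid as RawMonoidDefs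
open import Algebra.Module.Bundles using (Module)
import Algebra.Module.Construct.DirectProduct as DirectProduct
open import Algebra.Module.Morphism.Structures using (module ModuleMorphisms)
open import Algebra.Module.Structures.Biased using (IsModuleFromLeft)
open import Algebra.Morphism.Structures using (IsRingHomomorphism)
import Algebra.Properties.Ring as RingProperties
import Algebra.Properties.Semiring.Exp as Exp
import Algebra.Solver.Ring.NaturalCoefficients.Default as SemiringSolver
open import Data.Fin.Base using (Fin; toℕ)
open import Data.Integer.Base as ℤ using (ℤ; +_; -[1+_]; 0ℤ; 1ℤ)
open import Data.List.Base using (List)
open import Data.List.Relation.Unary.Any using (Any)
open import Data.Nat.Base as ℕ using (ℕ; zero; suc)
import Data.Nat.Properties as ℕₚ
open import Data.Product.Base using (Σ-syntax; ∃-syntax; _×_; _,_; proj₁; proj₂)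
open import Data.Sum.Base using (_⊎_; inj₁; inj₂; [_,_]′)
open import Function.Base using (flip)
open import Function.Bundles using (Inverse)
open import Level using (Level; 0ℓ; Lift; lift; lower) renaming (suc to lsuc)
open import Relation.Binary.Structures using (IsEquivalence)
open import Relation.Binary.PropositionalEquality as ≡ using (_≡_; _≢_)
open import Relation.Nullary using (¬_)
open import Relation.Unary using (Pred)

1ℓ : Level
1ℓ = lsuc 0ℓ

Ring₀ : Set₁
Ring₀ = CommutativeRing 0ℓ 0ℓ

record IsField (R : Ring₀) : Set where
  open CommutativeRing R
  field
    1≉0     : ¬ 1# ≈ 0#
    inverse : ∀ x → ¬ x ≈ 0# → ∃[ y ] x * y ≈ 1#

record IsDomain (R : Ring₀) : Set where
  open CommutativeRing R
  field
    1≉0            : ¬ 1# ≈ 0#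
    noZeroDivisors : ∀ x y → x * y ≈ 0# → x ≈ 0# ⊎ y ≈ 0#

record FiniteField (q : ℕ) : Set₁ where
  field
    ring    : Ring₀
    isField : IsField ring
    finite  : Inverse (CommutativeRing.setoid ring) (≡.setoid (Fin q))

record FieldExtension (k : Ring₀) : Set₁ where
  field
    ring                : Ring₀
    isField             : IsField ring
    embed               : CommutativeRing.Carrier k → CommutativeRing.Carrier ring
    isRingHomomorphism  : IsRingHomomorphism (CommutativeRing.rawRing k)
                                             (CommutativeRing.rawRing ring) embed

------------------------------------------------------------------------
-- Proj of a graded ring

-- The homogeneous parts of a graded ring.  That the ring is the direct
-- sum of its parts is kept apart, in IsDirectSum.
record Grading (R : Ring₀) : Set₁ where
  open CommutativeRing R
  field
    Part     : ℕ → Pred Carrier 0ℓ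
    resp     : ∀ {d x y} → x ≈ y → Part d x → Part d y
    0-closed : ∀ {d} → Part d 0#
    1-closed : Part 0 1#
    +-closed : ∀ {d x y} → Part d x → Part d y → Part d (x + y)
    neg-closed : ∀ {d x} → Part d x → Part d (- x)
    *-closed : ∀ {d e x y} → Part d x → Part e y → Part (d ℕ.+ e) (x * y)

record IsDirectSum {R : Ring₀} (G : Grading R) : Set where
  open CommutativeRing R
  open Grading G
  open RawMonoidDefs +-rawMonoid using (sum)
  field
    decompose   : ∀ x → ∃[ n ] Σ[ c ∈ (Fin n → Carrier) ]
                    (∀ i → Part (toℕ i) (c i)) × x ≈ sum c
    independent : ∀ n (c : Fin n → Carrier) → (∀ i → Part (toℕ i) (c i)) →
                    sum c ≈ 0# → ∀ i → c i ≈ 0#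

module Proj {R : Ring₀} (G : Grading R) where
  open CommutativeRing R
  open Grading G
  open RawMonoidDefs +-rawMonoid using (sum)

  record Point : Set₁ where
    field
      ideal       : Pred Carrier 0ℓ
      ideal-resp  : ∀ {x y} → x ≈ y → ideal x → ideal y
      ideal-0     : ideal 0#
      ideal-+     : ∀ {x y} → ideal x → ideal y → ideal (x + y)
      ideal-*     : ∀ x {y} → ideal y → ideal (x * y)
      homogeneous : ∀ {x} → ideal x → ∃[ n ] Σ[ c ∈ (Fin n → Carrier) ]
                      (∀ i → Part (toℕ i) (c i) × ideal (c i)) × x ≈ sum c
      prime       : ∀ {x y} → ideal (x * y) → ideal x ⊎ ideal y
      relevant    : ∃[ d ] ∃[ x ] Part (suc d) x × ¬ ideal x

    proper : ¬ ideal 1#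
    proper 1∈p = proj₂ (proj₂ (proj₂ relevant))
      (ideal-resp (*-identityʳ _) (ideal-* _ 1∈p))

  open Point public using (ideal)

  -- Q ≤ P means that P lies in the closure of Q.
  infix 4 _≤_ _<_ _≋_
  _≤_ _<_ _≋_ : Point → Point → Set
  Q ≤ P = ∀ {x} → ideal Q x → ideal P x
  Q < P = Q ≤ P × ¬ P ≤ Q
  Q ≋ P = Q ≤ P × P ≤ Q

  IsClosedPoint : Point → Set₁
  IsClosedPoint P = ∀ Q → P ≤ Q → Q ≤ P

  -- Chain P n : strict chains P₀ < ... < Pₙ = P of points, equivalently
  -- of irreducible closed subsets containing P, or of primes of the local
  -- ring at P.
  data Chain : Point → ℕ → Set₁ where
    stop : ∀ {P} → Chain P 0
    _▷_  : ∀ {Q P n} → Chain Q n → Q < P → Chain P (suc n)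

  HasLocalDimension : Point → ℕ → Set₁
  HasLocalDimension P n = Chain P n × ¬ Chain P (suc n)

  HasDimension : ℕ → Set₁
  HasDimension n = (∃[ P ] Chain P n) × (∀ P → ¬ Chain P (suc n))

  -- The sets D₊(f) = {P | f ∉ P}, f homogeneous, are a basis of the
  -- Zariski topology.
  record Open : Set₁ where
    field
      member : Point → Set
      basic  : ∀ {P} → member P → ∃[ d ] ∃[ f ] Part d f × ¬ ideal P f ×
                 (∀ {Q} → ¬ ideal Q f → member Q)

  infix 4 _∈_ _⊆_
  _∈_ : Point → Open → Set
  P ∈ U = Open.member U P

  record _⊆_ (V U : Open) : Set₁ where
    constructor inclusion
    field
      ⊆-elim : ∀ {P} → P ∈ V → P ∈ U

  open _⊆_ public

  infixr 7 _∩_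
  _∩_ : Open → Open → Open
  U ∩ V = record
    { member = λ P → P ∈ U × P ∈ V
    ; basic  = λ {P} (PU , PV) →
        let (d , f , f∈ , f∉P , D[f]⊆U) = Open.basic U PU
            (e , g , g∈ , g∉P , D[g]⊆V) = Open.basic V PV
        in d ℕ.+ e , f * g , *-closed f∈ g∈
           , (λ fg∈P → [ f∉P , g∉P ]′ (Point.prime P fg∈P))
           , λ {Q} fg∉Q →
               D[f]⊆U (λ f∈Q → fg∉Q (Point.ideal-resp Q (*-comm g f) (Point.ideal-* Q g f∈Q)))
             , D[g]⊆V (λ g∈Q → fg∉Q (Point.ideal-* Q f g∈Q))
    }

  IsIrreducible : Set₁
  IsIrreducible = Point × (∀ U V → (∃[ P ] P ∈ U) → (∃[ P ] P ∈ V) → ∃[ P ] P ∈ (U ∩ V))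

  -- The local ring of Proj at a point P: fractions num / den of
  -- homogeneous elements of the same degree with den ∉ P.
  module _ (P : Point) where
    private module P = Point P

    record Fraction : Set where
      constructor fraction
      field
        {degree} : ℕ
        num den  : Carrier
        num-part : Part degree num
        den-part : Part degree den
        den∉     : ¬ P.ideal den

    open Fraction

    infix 4 _≃_
    _≃_ : Fraction → Fraction → Set
    x ≃ y = ∃[ d ] ∃[ u ] Part d u × ¬ P.ideal u ×
              u * (num x * den y) ≈ u * (num y * den x)

    private
      module Solver = SemiringSolver commutativeSemiring
      open Solver using (solve; _:+_; _:*_; _:=_; con)
      open import Relation.Binary.Reasoning.Setoid setoid
      open RingProperties (CommutativeRing.ring R) using (-‿distribˡ-*; -‿distribʳ-*)

      *∉ : ∀ {x y} → ¬ P.ideal x → ¬ P.ideal y → ¬ P.ideal (x * y)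
      *∉ x∉ y∉ xy∈ = [ x∉ , y∉ ]′ (P.prime xy∈)

      cross : ∀ {x y} → num x * den y ≈ num y * den x → x ≃ y
      cross eq = 0 , 1# , 1-closed , P.proper , *-congˡ eq

    _+ᶠ_ _*ᶠ_ : Fraction → Fraction → Fraction
    x +ᶠ y = fraction (num x * den y + num y * den x) (den x * den y)
      (+-closed (*-closed (num-part x) (den-part y))
                (≡.subst (λ d → Part d (num y * den x)) (ℕₚ.+-comm (degree y) (degree x))
                         (*-closed (num-part y) (den-part x))))
      (*-closed (den-part x) (den-part y))
      (*∉ (den∉ x) (den∉ y))
    x *ᶠ y = fraction (num x * num y) (den x * den y)
      (*-closed (num-part x) (num-part y)) (*-closed (den-part x) (den-part y))
      (*∉ (den∉ x) (den∉ y))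

    -ᶠ_ : Fraction → Fraction
    -ᶠ x = fraction (- num x) (den x) (neg-closed (num-part x)) (den-part x) (den∉ x)

    0ᶠ 1ᶠ : Fraction
    0ᶠ = fraction 0# 1# 0-closed 1-closed P.proper
    1ᶠ = fraction 1# 1# 1-closed 1-closed P.proper

    private
      ≃-refl : ∀ {x} → x ≃ x
      ≃-refl {x} = cross {x} {x} refl

      ≃-sym : ∀ {x y} → x ≃ y → y ≃ x
      ≃-sym (d , u , u∈ , u∉ , eq) = d , u , u∈ , u∉ , sym eq

      ≃-trans : ∀ {x y z} → x ≃ y → y ≃ z → x ≃ z
      ≃-trans {x} {y} {z} (d , u , u∈ , u∉ , p) (e , v , v∈ , v∉ , q) =
        (d ℕ.+ e) ℕ.+ degree y , (u * v) * den y
        , *-closed (*-closed u∈ v∈) (den-part y) , *∉ (*∉ u∉ v∉) (den∉ y) , (begin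
        ((u * v) * den y) * (num x * den z)
          ≈⟨ solve 5 (λ u v b a f → ((u :* v) :* b) :* (a :* f) := (v :* f) :* (u :* (a :* b)))
               refl u v (den y) (num x) (den z) ⟩
        (v * den z) * (u * (num x * den y))
          ≈⟨ *-congˡ p ⟩
        (v * den z) * (u * (num y * den x))
          ≈⟨ solve 5 (λ u v c b f → (v :* f) :* (u :* (c :* b)) := (u :* b) :* (v :* (c :* f)))
               refl u v (num y) (den x) (den z) ⟩
        (u * den x) * (v * (num y * den z))
          ≈⟨ *-congˡ q ⟩
        (u * den x) * (v * (num z * den y))
          ≈⟨ solve 5 (λ u v e d b → (u :* b) :* (v :* (e :* d)) := ((u :* v) :* d) :* (e :* b))
               refl u v (num z) (den y) (den x) ⟩
        ((u * v) * den y) * (num z * den x) ∎)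

      +ᶠ-cong : ∀ {x x′ y y′} → x ≃ x′ → y ≃ y′ → (x +ᶠ y) ≃ (x′ +ᶠ y′)
      +ᶠ-cong {x} {x′} {y} {y′} (d , u , u∈ , u∉ , p) (e , v , v∈ , v∉ , q) =
        d ℕ.+ e , u * v , *-closed u∈ v∈ , *∉ u∉ v∉ , (begin
        (u * v) * ((num x * den y + num y * den x) * (den x′ * den y′))
          ≈⟨ solve 8 (λ u v a b c d b′ d′ →
               (u :* v) :* ((a :* d :+ c :* b) :* (b′ :* d′)) :=
               (v :* (d :* d′)) :* (u :* (a :* b′)) :+ (u :* (b :* b′)) :* (v :* (c :* d′)))
               refl u v (num x) (den x) (num y) (den y) (den x′) (den y′) ⟩
        (v * (den y * den y′)) * (u * (num x * den x′))
          + (u * (den x * den x′)) * (v * (num y * den y′))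
          ≈⟨ +-cong (*-congˡ p) (*-congˡ q) ⟩
        (v * (den y * den y′)) * (u * (num x′ * den x))
          + (u * (den x * den x′)) * (v * (num y′ * den y))
          ≈⟨ solve 8 (λ u v b d a′ b′ c′ d′ →
               (v :* (d :* d′)) :* (u :* (a′ :* b)) :+ (u :* (b :* b′)) :* (v :* (c′ :* d)) :=
               (u :* v) :* ((a′ :* d′ :+ c′ :* b′) :* (b :* d)))
               refl u v (den x) (den y) (num x′) (den x′) (num y′) (den y′) ⟩
        (u * v) * ((num x′ * den y′ + num y′ * den x′) * (den x * den y)) ∎)

      *ᶠ-cong : ∀ {x x′ y y′} → x ≃ x′ → y ≃ y′ → (x *ᶠ y) ≃ (x′ *ᶠ y′)
      *ᶠ-cong {x} {x′} {y} {y′} (d , u , u∈ , u∉ , p) (e , v , v∈ , v∉ , q) =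
        d ℕ.+ e , u * v , *-closed u∈ v∈ , *∉ u∉ v∉ , (begin
        (u * v) * ((num x * num y) * (den x′ * den y′))
          ≈⟨ shuffle u v (num x) (num y) (den x′) (den y′) ⟩
        (u * (num x * den x′)) * (v * (num y * den y′))
          ≈⟨ *-cong p q ⟩
        (u * (num x′ * den x)) * (v * (num y′ * den y))
          ≈⟨ sym (shuffle u v (num x′) (num y′) (den x) (den y)) ⟩
        (u * v) * ((num x′ * num y′) * (den x * den y)) ∎)
        where
        shuffle : ∀ u v a c b d → (u * v) * ((a * c) * (b * d)) ≈ (u * (a * b)) * (v * (c * d))
        shuffle = solve 6 (λ u v a c b d →
          (u :* v) :* ((a :* c) :* (b :* d)) := (u :* (a :* b)) :* (v :* (c :* d))) refl

      -ᶠ-cong : ∀ {x y} → x ≃ y → (-ᶠ x) ≃ (-ᶠ y)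
      -ᶠ-cong {x} {y} (d , u , u∈ , u∉ , p) = d , u , u∈ , u∉ , (begin
        u * (- num x * den y)     ≈⟨ *-congˡ (sym (-‿distribˡ-* _ _)) ⟩
        u * (- (num x * den y))   ≈⟨ sym (-‿distribʳ-* _ _) ⟩
        - (u * (num x * den y))   ≈⟨ -‿cong p ⟩
        - (u * (num y * den x))   ≈⟨ -‿distribʳ-* _ _ ⟩
        u * (- (num y * den x))   ≈⟨ *-congˡ (-‿distribˡ-* _ _) ⟩
        u * (- num y * den x)     ∎)

      +ᶠ-assoc : ∀ x y z → ((x +ᶠ y) +ᶠ z) ≃ (x +ᶠ (y +ᶠ z))
      +ᶠ-assoc x y z = cross {(x +ᶠ y) +ᶠ z} {x +ᶠ (y +ᶠ z)} (solve 6 (λ a b c d e f →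
        ((a :* d :+ c :* b) :* f :+ e :* (b :* d)) :* (b :* (d :* f)) :=
        (a :* (d :* f) :+ (c :* f :+ e :* d) :* b) :* ((b :* d) :* f))
        refl (num x) (den x) (num y) (den y) (num z) (den z))

      +ᶠ-comm : ∀ x y → (x +ᶠ y) ≃ (y +ᶠ x)
      +ᶠ-comm x y = cross {x +ᶠ y} {y +ᶠ x} (solve 4 (λ a b c d →
        (a :* d :+ c :* b) :* (d :* b) := (c :* b :+ a :* d) :* (b :* d))
        refl (num x) (den x) (num y) (den y))

      +ᶠ-identityˡ : ∀ x → (0ᶠ +ᶠ x) ≃ x
      +ᶠ-identityˡ x = cross {0ᶠ +ᶠ x} {x} (solve 2 (λ a b →
        (con 0 :* b :+ a :* con 1) :* b := a :* (con 1 :* b)) refl (num x) (den x))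

      +ᶠ-inverseˡ : ∀ x → ((-ᶠ x) +ᶠ x) ≃ 0ᶠ
      +ᶠ-inverseˡ x = cross {(-ᶠ x) +ᶠ x} {0ᶠ} (begin
        (- num x * den x + num x * den x) * 1# ≈⟨ *-congʳ (sym (distribʳ _ _ _)) ⟩
        ((- num x + num x) * den x) * 1#       ≈⟨ *-congʳ (*-congʳ (-‿inverseˡ _)) ⟩
        (0# * den x) * 1#                      ≈⟨ *-congʳ (zeroˡ _) ⟩
        0# * 1#                                ≈⟨ zeroˡ _ ⟩
        0#                                     ≈⟨ sym (zeroˡ _) ⟩
        0# * (den x * den x)                   ∎)

      *ᶠ-assoc : ∀ x y z → ((x *ᶠ y) *ᶠ z) ≃ (x *ᶠ (y *ᶠ z))
      *ᶠ-assoc x y z = cross {(x *ᶠ y) *ᶠ z} {x *ᶠ (y *ᶠ z)} (solve 6 (λ a b c d e f →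
        ((a :* c) :* e) :* (b :* (d :* f)) := (a :* (c :* e)) :* ((b :* d) :* f))
        refl (num x) (den x) (num y) (den y) (num z) (den z))

      *ᶠ-comm : ∀ x y → (x *ᶠ y) ≃ (y *ᶠ x)
      *ᶠ-comm x y = cross {x *ᶠ y} {y *ᶠ x} (solve 4 (λ a b c d →
        (a :* c) :* (d :* b) := (c :* a) :* (b :* d))
        refl (num x) (den x) (num y) (den y))

      *ᶠ-identityˡ : ∀ x → (1ᶠ *ᶠ x) ≃ x
      *ᶠ-identityˡ x = cross {1ᶠ *ᶠ x} {x} (solve 2 (λ a b →
        (con 1 :* a) :* b := a :* (con 1 :* b)) refl (num x) (den x))

      distribˡᶠ : ∀ x y z → (x *ᶠ (y +ᶠ z)) ≃ ((x *ᶠ y) +ᶠ (x *ᶠ z))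
      distribˡᶠ x y z = cross {x *ᶠ (y +ᶠ z)} {(x *ᶠ y) +ᶠ (x *ᶠ z)} (solve 6 (λ a b c d e f →
        (a :* (c :* f :+ e :* d)) :* ((b :* d) :* (b :* f)) :=
        ((a :* c) :* (b :* f) :+ (a :* e) :* (b :* d)) :* (b :* (d :* f)))
        refl (num x) (den x) (num y) (den y) (num z) (den z))

    stalk : Ring₀
    stalk = record
      { Carrier = Fraction
      ; _≈_ = _≃_ ; _+_ = _+ᶠ_ ; _*_ = _*ᶠ_ ; -_ = -ᶠ_ ; 0# = 0ᶠ ; 1# = 1ᶠ
      ; isCommutativeRing = record
        { isRing = record
          { +-isAbelianGroup = record
            { isGroup = record
              { isMonoid = record
                { isSemigroup = record
                  { isMagma = record
                    { isEquivalence = ≃-isEquivalence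
                    ; ∙-cong = λ {x} {x′} {y} {y′} → +ᶠ-cong {x} {x′} {y} {y′}
                    }
                  ; assoc = +ᶠ-assoc
                  }
                ; identity = +ᶠ-identityˡ
                           , λ x → ≃-trans {x +ᶠ 0ᶠ} {0ᶠ +ᶠ x} {x} (+ᶠ-comm x 0ᶠ) (+ᶠ-identityˡ x)
                }
              ; inverse = +ᶠ-inverseˡ
                        , λ x → ≃-trans {x +ᶠ (-ᶠ x)} {(-ᶠ x) +ᶠ x} {0ᶠ}
                                  (+ᶠ-comm x (-ᶠ x)) (+ᶠ-inverseˡ x)
              ; ⁻¹-cong = λ {x} {y} → -ᶠ-cong {x} {y}
              }
            ; comm = +ᶠ-comm
            }
          ; *-cong = λ {x} {x′} {y} {y′} → *ᶠ-cong {x} {x′} {y} {y′}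
          ; *-assoc = *ᶠ-assoc
          ; *-identity = *ᶠ-identityˡ
                       , λ x → ≃-trans {x *ᶠ 1ᶠ} {1ᶠ *ᶠ x} {x} (*ᶠ-comm x 1ᶠ) (*ᶠ-identityˡ x)
          ; distrib = distribˡᶠ
                    , λ x y z → ≃-trans {(y +ᶠ z) *ᶠ x} {x *ᶠ (y +ᶠ z)} {(y *ᶠ x) +ᶠ (z *ᶠ x)}
                        (*ᶠ-comm (y +ᶠ z) x)
                        (≃-trans {x *ᶠ (y +ᶠ z)} {(x *ᶠ y) +ᶠ (x *ᶠ z)} {(y *ᶠ x) +ᶠ (z *ᶠ x)}
                          (distribˡᶠ x y z)
                          (+ᶠ-cong {x *ᶠ y} {y *ᶠ x} {x *ᶠ z} {z *ᶠ x} (*ᶠ-comm x y) (*ᶠ-comm x z)))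
          }
        ; *-comm = *ᶠ-comm
        }
      }
      where
      ≃-isEquivalence : IsEquivalence _≃_
      ≃-isEquivalence = record
        { refl  = λ {x} → ≃-refl {x}
        ; sym   = λ {x} {y} → ≃-sym {x} {y}
        ; trans = λ {x} {y} {z} → ≃-trans {x} {y} {z}
        }

    InMaximalIdeal : Pred Fraction 0ℓ
    InMaximalIdeal x = P.ideal (num x)

    -- The local ring at P is regular: its maximal ideal is generated by
    -- as many elements as the dimension of the ring.
    IsRegularAt : Set₁
    IsRegularAt = ∃[ n ] HasLocalDimension P n × Σ[ t ∈ (Fin n → Fraction) ]
      (∀ i → InMaximalIdeal (t i)) ×
      (∀ x → InMaximalIdeal x → Σ[ c ∈ (Fin n → Fraction) ] x ≃ sumᶠ (λ i → c i *ᶠ t i))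
      where
      open RawMonoidDefs (CommutativeRing.+-rawMonoid stalk) using () renaming (sum to sumᶠ)

------------------------------------------------------------------------
-- Projective schemes over a field, and their base change

-- A graded k-algebra S with S₀ = k, generated by finitely many elements
-- x₀, ..., xₙ of degree 1, i.e. S = k[x₀, ..., xₙ] / I with I a
-- homogeneous ideal; Proj S is the closed subscheme of ℙⁿ defined by I.
record HomogeneousCoordinateRing (k : Ring₀) : Set₁ where
  field
    ring        : Ring₀
    grading     : Grading ring
    isDirectSum : IsDirectSum grading

  open CommutativeRing ring
  open Grading grading public
  open RawMonoidDefs +-rawMonoid using (sum)

  field
    ι                  : CommutativeRing.Carrier k → Carrier
    isRingHomomorphism : IsRingHomomorphism (CommutativeRing.rawRing k) rawRing ι
    ι-degree           : ∀ a → Part 0 (ι a)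
    degree-0           : ∀ {s} → Part 0 s → ∃[ a ] ι a ≈ s
    n                  : ℕ
    x                  : Fin (suc n) → Carrier
    x-degree           : ∀ i → Part 1 (x i)
    generated          : ∀ {d s} → Part (suc d) s → Σ[ c ∈ (Fin (suc n) → Carrier) ]
                           (∀ i → Part d (c i)) × s ≈ sum (λ i → c i * x i)

-- S ⊗ₖ L as the coproduct of commutative k-algebras: ring expressions in
-- the elements of S and L, modulo the congruence generated by the ring
-- axioms, the operations of S and of L, and the identification of the
-- two copies of k.
module BaseChange {k : Ring₀} (A : HomogeneousCoordinateRing k) (E : FieldExtension k) where
  private
    module k = CommutativeRing k
    module A = HomogeneousCoordinateRing A
    module S = CommutativeRing A.ring
    module E = FieldExtension E
    module L = CommutativeRing E.ring

  infixl 6 _⊞_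
  infixl 7 _⊠_
  data Term : Set where
    fromS   : S.Carrier → Term
    fromL   : L.Carrier → Term
    _⊞_ _⊠_ : Term → Term → Term
    ⊟_      : Term → Term

  infix 4 _∼_
  data _∼_ : Term → Term → Set where
    ∼-refl  : ∀ {x} → x ∼ x
    ∼-sym   : ∀ {x y} → x ∼ y → y ∼ x
    ∼-trans : ∀ {x y z} → x ∼ y → y ∼ z → x ∼ z

    ⊞-cong  : ∀ {x x′ y y′} → x ∼ x′ → y ∼ y′ → x ⊞ y ∼ x′ ⊞ y′
    ⊠-cong  : ∀ {x x′ y y′} → x ∼ x′ → y ∼ y′ → x ⊠ y ∼ x′ ⊠ y′
    ⊟-cong  : ∀ {x x′} → x ∼ x′ → ⊟ x ∼ ⊟ x′

    ⊞-assoc     : ∀ x y z → (x ⊞ y) ⊞ z ∼ x ⊞ (y ⊞ z)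
    ⊞-comm      : ∀ x y → x ⊞ y ∼ y ⊞ x
    ⊞-identityˡ : ∀ x → fromS S.0# ⊞ x ∼ x
    ⊞-inverseˡ  : ∀ x → ⊟ x ⊞ x ∼ fromS S.0#
    ⊠-assoc     : ∀ x y z → (x ⊠ y) ⊠ z ∼ x ⊠ (y ⊠ z)
    ⊠-comm      : ∀ x y → x ⊠ y ∼ y ⊠ x
    ⊠-identityˡ : ∀ x → fromS S.1# ⊠ x ∼ x
    ⊠-distribˡ  : ∀ x y z → x ⊠ (y ⊞ z) ∼ x ⊠ y ⊞ x ⊠ z

    fromS-cong : ∀ {s t} → s S.≈ t → fromS s ∼ fromS t
    fromS-+    : ∀ s t → fromS (s S.+ t) ∼ fromS s ⊞ fromS t
    fromS-*    : ∀ s t → fromS (s S.* t) ∼ fromS s ⊠ fromS t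
    fromL-cong : ∀ {a b} → a L.≈ b → fromL a ∼ fromL b
    fromL-+    : ∀ a b → fromL (a L.+ b) ∼ fromL a ⊞ fromL b
    fromL-*    : ∀ a b → fromL (a L.* b) ∼ fromL a ⊠ fromL b
    from-k     : ∀ a → fromS (A.ι a) ∼ fromL (E.embed a)

  ring : Ring₀
  ring = record
    { Carrier = Term
    ; _≈_ = _∼_ ; _+_ = _⊞_ ; _*_ = _⊠_ ; -_ = ⊟_ ; 0# = fromS S.0# ; 1# = fromS S.1#
    ; isCommutativeRing = record
      { isRing = record
        { +-isAbelianGroup = record
          { isGroup = record
            { isMonoid = record
              { isSemigroup = record
                { isMagma = record
                  { isEquivalence = record { refl = ∼-refl ; sym = ∼-sym ; trans = ∼-trans }
                  ; ∙-cong = ⊞-cong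
                  }
                ; assoc = ⊞-assoc
                }
              ; identity = ⊞-identityˡ , λ x → ∼-trans (⊞-comm _ _) (⊞-identityˡ x)
              }
            ; inverse = ⊞-inverseˡ , λ x → ∼-trans (⊞-comm _ _) (⊞-inverseˡ x)
            ; ⁻¹-cong = ⊟-cong
            }
          ; comm = ⊞-comm
          }
        ; *-cong = ⊠-cong
        ; *-assoc = ⊠-assoc
        ; *-identity = ⊠-identityˡ , λ x → ∼-trans (⊠-comm _ _) (⊠-identityˡ x)
        ; distrib = ⊠-distribˡ
                  , λ x y z → ∼-trans (⊠-comm _ _)
                      (∼-trans (⊠-distribˡ x y z) (⊞-cong (⊠-comm _ _) (⊠-comm _ _)))
        }
      ; *-comm = ⊠-comm
      }
    }

  -- (S ⊗ₖ L)_d = S_d ⊗ₖ L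
  data PartL : ℕ → Term → Set where
    part-resp : ∀ {d x y} → x ∼ y → PartL d x → PartL d y
    part-S    : ∀ {d s} → A.Part d s → PartL d (fromS s)
    part-L    : ∀ a → PartL 0 (fromL a)
    part-⊞    : ∀ {d x y} → PartL d x → PartL d y → PartL d (x ⊞ y)
    part-⊟    : ∀ {d x} → PartL d x → PartL d (⊟ x)
    part-⊠    : ∀ {d e x y} → PartL d x → PartL e y → PartL (d ℕ.+ e) (x ⊠ y)

  grading : Grading ring
  grading = record
    { Part       = PartL
    ; resp       = part-resp
    ; 0-closed   = part-S A.0-closed
    ; 1-closed   = part-S A.1-closed
    ; +-closed   = part-⊞
    ; neg-closed = part-⊟
    ; *-closed   = part-⊠
    }

-- The curve is X = Proj S, with S a domain as X is an integral closed
-- subscheme of ℙⁿ.  Smoothness over k is geometric regularity.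
record SmoothProjectiveCurve (k : Ring₀) : Set₁ where
  field
    coordinateRing : HomogeneousCoordinateRing k

  module S = HomogeneousCoordinateRing coordinateRing
  open Proj S.grading public

  field
    isDomain     : IsDomain S.ring
    dimension-1  : HasDimension 1
    smooth       : ∀ (E : FieldExtension k) P →
                     Proj.IsRegularAt (BaseChange.grading coordinateRing E) P
    geometricallyIrreducible : ∀ (E : FieldExtension k) →
                     Proj.IsIrreducible (BaseChange.grading coordinateRing E)

module Curve {k : Ring₀} (X : SmoothProjectiveCurve k) where
  open SmoothProjectiveCurve X public
  private
    module R = CommutativeRing S.ring
    open RawMonoidDefs R.+-rawMonoid using (sum)

  η : Point
  η = record
    { ideal       = R._≈ R.0#
    ; ideal-resp  = λ x≈y x≈0 → R.trans (R.sym x≈y) x≈0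
    ; ideal-0     = R.refl
    ; ideal-+     = λ x≈0 y≈0 → R.trans (R.+-cong x≈0 y≈0) (R.+-identityˡ _)
    ; ideal-*     = λ x y≈0 → R.trans (R.*-congˡ y≈0) (R.zeroʳ x)
    ; homogeneous = λ x≈0 → 0 , (λ ()) , (λ ()) , x≈0
    ; prime       = IsDomain.noZeroDivisors isDomain _ _
    ; relevant    =
        let P = proj₁ (proj₁ dimension-1)
            (d , x , x∈ , x∉P) = Point.relevant P
        in d , x , x∈ , λ x≈0 → x∉P (Point.ideal-resp P (R.sym x≈0) (Point.ideal-0 P))
    }

  -- The function field of X.
  K : Ring₀
  K = stalk η

  module K = CommutativeRing K
  open Exp K.semiring using (_^_)

  private
    module KP = RingProperties K.ring

  -- As X is integral, its local rings are subrings of K.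
  toK : ∀ P → Fraction P → K.Carrier
  toK P (fraction a b a∈ b∈ b∉P) =
    fraction a b a∈ b∈ (λ b≈0 → b∉P (Point.ideal-resp P (R.sym b≈0) (Point.ideal-0 P)))

  InLocalRing : Point → Pred K.Carrier 0ℓ
  InLocalRing P f = ∃[ g ] toK P g K.≈ f

  InLocalMaximalIdeal : Point → Pred K.Carrier 0ℓ
  InLocalMaximalIdeal P f = ∃[ g ] InMaximalIdeal P g × toK P g K.≈ f

  private
    𝒪-resp : ∀ P {f g} → f K.≈ g → InLocalRing P f → InLocalRing P g
    𝒪-resp P {f} {g} f≈g (a , a≈f) = a , K.trans {toK P a} {f} {g} a≈f f≈g

    𝒪-0 : ∀ P → InLocalRing P K.0#
    𝒪-0 P = 0ᶠ P , K.refl {toK P (0ᶠ P)}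

    𝒪-1 : ∀ P → InLocalRing P K.1#
    𝒪-1 P = 1ᶠ P , K.refl {toK P (1ᶠ P)}

    𝒪-+ : ∀ P {f g} → InLocalRing P f → InLocalRing P g → InLocalRing P (f K.+ g)
    𝒪-+ P {f} {g} (a , a≈f) (b , b≈g) =
      _+ᶠ_ P a b , K.+-cong {toK P a} {f} {toK P b} {g} a≈f b≈g

    𝒪-* : ∀ P {f g} → InLocalRing P f → InLocalRing P g → InLocalRing P (f K.* g)
    𝒪-* P {f} {g} (a , a≈f) (b , b≈g) =
      _*ᶠ_ P a b , K.*-cong {toK P a} {f} {toK P b} {g} a≈f b≈g

    𝒪-neg : ∀ P {f} → InLocalRing P f → InLocalRing P (K.- f)
    𝒪-neg P {f} (a , a≈f) = -ᶠ_ P a , K.-‿cong {toK P a} {f} a≈f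

  ----------------------------------------------------------------------
  -- Subsheaves of the sheaf of rational functions

  -- A family of 𝒪_P-submodules of K.
  record Stalks : Set₂ where
    field
      InStalk    : Point → Pred K.Carrier 1ℓ
      stalk-resp : ∀ P {f g} → f K.≈ g → InStalk P f → InStalk P g
      stalk-0    : ∀ P → InStalk P K.0#
      stalk-+    : ∀ P {f g} → InStalk P f → InStalk P g → InStalk P (f K.+ g)
      stalk-*    : ∀ P {a f} → InLocalRing P a → InStalk P f → InStalk P (a K.* f)

    stalk-neg : ∀ P {f} → InStalk P f → InStalk P (K.- f)
    stalk-neg P {f} f∈ = stalk-resp P {(K.- K.1#) K.* f} {K.- f} (KP.-1*x≈-x f)
      (stalk-* P {K.- K.1#} {f} (𝒪-neg P {K.1#} (𝒪-1 P)) f∈)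

  open Stalks

  -- The sheaf of rational functions on X is the constant sheaf K, whose
  -- sections over U are the locally constant functions U → K.  (X being
  -- irreducible, these are the constant functions if U is nonempty, and
  -- there is one such function if U is empty.)
  record Section (I : Stalks) (U : Open) : Set₁ where
    field
      value           : ∀ P → P ∈ U → K.Carrier
      locallyConstant : ∀ P (PU : P ∈ U) → Σ[ V ∈ Open ] P ∈ V ×
                          (∀ Q → Q ∈ V → ∀ (QU : Q ∈ U) → value Q QU K.≈ value P PU)
      inStalk         : ∀ P (PU : P ∈ U) → InStalk I P (value P PU)

  open Section

  _≈ˢ_ : ∀ {I : Stalks} {U} → Section I U → Section I U → Set₁
  _≈ˢ_ {U = U} s t = ∀ P (PU : P ∈ U) → value s P PU K.≈ value t P PU

  _|ˢ_ : ∀ {I : Stalks} {U V} → Section I U → V ⊆ U → Section I V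
  s |ˢ V⊆U = record
    { value           = λ P PV → value s P (⊆-elim V⊆U PV)
    ; locallyConstant = λ P PV →
        let (W , PW , c) = locallyConstant s P (⊆-elim V⊆U PV)
        in W , PW , λ Q QW QV → c Q QW (⊆-elim V⊆U QV)
    ; inStalk         = λ P PV → inStalk s P (⊆-elim V⊆U PV)
    }

  𝒪ˢ : Stalks
  𝒪ˢ = record
    { InStalk    = λ P f → Lift 1ℓ (InLocalRing P f)
    ; stalk-resp = λ P {f} {g} f≈g (lift f∈) → lift (𝒪-resp P {f} {g} f≈g f∈)
    ; stalk-0    = λ P → lift (𝒪-0 P)
    ; stalk-+    = λ P {f} {g} (lift f∈) (lift g∈) → lift (𝒪-+ P {f} {g} f∈ g∈)
    ; stalk-*    = λ P {f} {g} f∈ (lift g∈) → lift (𝒪-* P {f} {g} f∈ g∈)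
    }

  private
    module _ {I : Stalks} {U : Open} where
      zeroˢ : Section I U
      zeroˢ = record
        { value           = λ _ _ → K.0#
        ; locallyConstant = λ P PU → U , PU , λ _ _ _ → K.refl {K.0#}
        ; inStalk         = λ P _ → stalk-0 I P
        }

      _+ˢ_ : Section I U → Section I U → Section I U
      s +ˢ t = record
        { value           = λ P PU → value s P PU K.+ value t P PU
        ; locallyConstant = λ P PU →
            let (V , PV , c) = locallyConstant s P PU
                (W , PW , d) = locallyConstant t P PU
            in V ∩ W , (PV , PW) , λ Q (QV , QW) QU →
                 K.+-cong {value s Q QU} {value s P PU} {value t Q QU} {value t P PU}
                   (c Q QV QU) (d Q QW QU)
        ; inStalk         = λ P PU →
            stalk-+ I P {value s P PU} {value t P PU} (inStalk s P PU) (inStalk t P PU)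
        }

      -ˢ_ : Section I U → Section I U
      -ˢ s = record
        { value           = λ P PU → K.- value s P PU
        ; locallyConstant = λ P PU →
            let (V , PV , c) = locallyConstant s P PU
            in V , PV , λ Q QV QU → K.-‿cong {value s Q QU} {value s P PU} (c Q QV QU)
        ; inStalk         = λ P PU → stalk-neg I P {value s P PU} (inStalk s P PU)
        }

      _*ˢ_ : Section 𝒪ˢ U → Section I U → Section I U
      a *ˢ s = record
        { value           = λ P PU → value a P PU K.* value s P PU
        ; locallyConstant = λ P PU →
            let (V , PV , c) = locallyConstant a P PU
                (W , PW , d) = locallyConstant s P PU
            in V ∩ W , (PV , PW) , λ Q (QV , QW) QU →
                 K.*-cong {value a Q QU} {value a P PU} {value s Q QU} {value s P PU}
                   (c Q QV QU) (d Q QW QU)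
        ; inStalk         = λ P PU →
            stalk-* I P {value a P PU} {value s P PU} (lower (inStalk a P PU)) (inStalk s P PU)
        }

    oneˢ : ∀ {U} → Section 𝒪ˢ U
    oneˢ {U} = record
      { value           = λ _ _ → K.1#
      ; locallyConstant = λ P PU → U , PU , λ _ _ _ → K.refl {K.1#}
      ; inStalk         = λ P _ → lift (𝒪-1 P)
      }

  -- The ring 𝒪_X(U).
  Γ𝒪 : Open → CommutativeRing 1ℓ 1ℓ
  Γ𝒪 U = record
    { Carrier = Section 𝒪ˢ U
    ; _≈_ = _≈ˢ_ ; _+_ = _+ˢ_ ; _*_ = _*ˢ_ ; -_ = -ˢ_ ; 0# = zeroˢ ; 1# = oneˢ
    ; isCommutativeRing = record
      { isRing = record
        { +-isAbelianGroup = record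
          { isGroup = record
            { isMonoid = record
              { isSemigroup = record
                { isMagma = record
                  { isEquivalence = record
                    { refl  = λ {s} P u → K.refl {value s P u}
                    ; sym   = λ {s} {t} p P u → K.sym {value s P u} {value t P u} (p P u)
                    ; trans = λ {r} {s} {t} p q P u →
                        K.trans {value r P u} {value s P u} {value t P u} (p P u) (q P u)
                    }
                  ; ∙-cong = λ {r} {s} {t} {v} p q P u →
                      K.+-cong {value r P u} {value s P u} {value t P u} {value v P u} (p P u) (q P u)
                  }
                ; assoc = λ r s t P u → K.+-assoc (value r P u) (value s P u) (value t P u)
                }
              ; identity = (λ s P u → K.+-identityˡ (value s P u))
                         , (λ s P u → K.+-identityʳ (value s P u))
              }
            ; inverse = (λ s P u → K.-‿inverseˡ (value s P u))
                      , (λ s P u → K.-‿inverseʳ (value s P u))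
            ; ⁻¹-cong = λ {s} {t} p P u → K.-‿cong {value s P u} {value t P u} (p P u)
            }
          ; comm = λ s t P u → K.+-comm (value s P u) (value t P u)
          }
        ; *-cong = λ {r} {s} {t} {v} p q P u →
            K.*-cong {value r P u} {value s P u} {value t P u} {value v P u} (p P u) (q P u)
        ; *-assoc = λ r s t P u → K.*-assoc (value r P u) (value s P u) (value t P u)
        ; *-identity = (λ s P u → K.*-identityˡ (value s P u))
                     , (λ s P u → K.*-identityʳ (value s P u))
        ; distrib = (λ r s t P u → K.distribˡ (value r P u) (value s P u) (value t P u))
                  , (λ r s t P u → K.distribʳ (value r P u) (value s P u) (value t P u))
        }
      ; *-comm = λ s t P u → K.*-comm (value s P u) (value t P u)
      }
    }

  module Γ𝒪 (U : Open) = CommutativeRing (Γ𝒪 U)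

  ----------------------------------------------------------------------
  -- Sheaves of 𝒪-modules

  record 𝒪-Module : Set₂ where
    field
      Γ : ∀ U → Module (Γ𝒪 U) 1ℓ 1ℓ

    module Γ (U : Open) = Module (Γ U)

    field
      _∣_    : ∀ {U V} → Γ.Carrierᴹ U → V ⊆ U → Γ.Carrierᴹ V
      ∣-cong : ∀ {U V} (i : V ⊆ U) {s t} → Γ._≈ᴹ_ U s t → Γ._≈ᴹ_ V (s ∣ i) (t ∣ i)
      ∣-id   : ∀ {U} (i : U ⊆ U) s → Γ._≈ᴹ_ U (s ∣ i) s
      ∣-∘    : ∀ {U V W} (i : V ⊆ U) (j : W ⊆ V) (k : W ⊆ U) s →
                 Γ._≈ᴹ_ W ((s ∣ i) ∣ j) (s ∣ k)
      ∣-+    : ∀ {U V} (i : V ⊆ U) s t →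
                 Γ._≈ᴹ_ V (Γ._+ᴹ_ U s t ∣ i) (Γ._+ᴹ_ V (s ∣ i) (t ∣ i))
      ∣-*    : ∀ {U V} (i : V ⊆ U) a s →
                 Γ._≈ᴹ_ V (Γ._*ₗ_ U a s ∣ i) (Γ._*ₗ_ V (a |ˢ i) (s ∣ i))

      separated : ∀ {U} {J : Set₁} (V : J → Open) (i : ∀ j → V j ⊆ U) →
                  (∀ P → P ∈ U → ∃[ j ] P ∈ V j) →
                  ∀ s t → (∀ j → Γ._≈ᴹ_ (V j) (s ∣ i j) (t ∣ i j)) → Γ._≈ᴹ_ U s t
      glue      : ∀ {U} {J : Set₁} (V : J → Open) (i : ∀ j → V j ⊆ U) →
                  (∀ P → P ∈ U → ∃[ j ] P ∈ V j) →
                  (s : ∀ j → Γ.Carrierᴹ (V j)) →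
                  (∀ j j′ W (a : W ⊆ V j) (b : W ⊆ V j′) →
                     Γ._≈ᴹ_ W (s j ∣ a) (s j′ ∣ b)) →
                  ∃[ t ] ∀ j → Γ._≈ᴹ_ (V j) (t ∣ i j) (s j)

  IsLinear : ∀ {U} (M N : Module (Γ𝒪 U) 1ℓ 1ℓ) → (Module.Carrierᴹ M → Module.Carrierᴹ N) → Set₁
  IsLinear M N = ModuleMorphisms.IsModuleHomomorphism (Module.rawModule M) (Module.rawModule N)

  record Hom (M N : 𝒪-Module) : Set₁ where
    private
      module M = 𝒪-Module M
      module N = 𝒪-Module N
    field
      map     : ∀ U → M.Γ.Carrierᴹ U → N.Γ.Carrierᴹ U
      linear  : ∀ U → IsLinear (M.Γ U) (N.Γ U) (map U)
      natural : ∀ {U V} (i : V ⊆ U) s → N.Γ._≈ᴹ_ V (map U s N.∣ i) (map V (s M.∣ i))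

  infix 4 _≅_
  record _≅_ (M N : 𝒪-Module) : Set₁ where
    private
      module M = 𝒪-Module M
      module N = 𝒪-Module N
    field
      to       : Hom M N
      from     : Hom N M
      from-to  : ∀ U s → M.Γ._≈ᴹ_ U (Hom.map from U (Hom.map to U s)) s
      to-from  : ∀ U s → N.Γ._≈ᴹ_ U (Hom.map to U (Hom.map from U s)) s

  record Bilinear (M N P : 𝒪-Module) : Set₁ where
    private
      module M = 𝒪-Module M
      module N = 𝒪-Module N
      module P = 𝒪-Module P
    field
      map     : ∀ U → M.Γ.Carrierᴹ U → N.Γ.Carrierᴹ U → P.Γ.Carrierᴹ U
      linearˡ : ∀ U n → IsLinear (M.Γ U) (P.Γ U) (λ m → map U m n)
      linearʳ : ∀ U m → IsLinear (N.Γ U) (P.Γ U) (map U m)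
      natural : ∀ {U V} (i : V ⊆ U) m n →
                P.Γ._≈ᴹ_ V (map U m n P.∣ i) (map V (m M.∣ i) (n N.∣ i))

  -- The tensor product of 𝒪-modules, by its universal property: N ≅ M ⊗ L.
  record IsTensorProduct (M L N : 𝒪-Module) : Set₂ where
    private module N = 𝒪-Module N
    field
      tensor : Bilinear M L N

    Factors : (P : 𝒪-Module) → Bilinear M L P → Hom N P → Set₁
    Factors P β h = ∀ U m l →
      𝒪-Module.Γ._≈ᴹ_ P U (Hom.map h U (Bilinear.map tensor U m l)) (Bilinear.map β U m l)

    field
      factor : ∀ P (β : Bilinear M L P) → ∃[ h ] Factors P β h
      unique : ∀ P (β : Bilinear M L P) g h → Factors P β g → Factors P β h →
               ∀ U n → 𝒪-Module.Γ._≈ᴹ_ P U (Hom.map g U n) (Hom.map h U n)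

  infixr 6 _⊕_
  _⊕_ : 𝒪-Module → 𝒪-Module → 𝒪-Module
  M ⊕ N = record
    { Γ      = λ U → DirectProduct.⟨module⟩ (M.Γ U) (N.Γ U)
    ; _∣_    = λ (s , t) i → (s M.∣ i) , (t N.∣ i)
    ; ∣-cong = λ i (p , q) → M.∣-cong i p , N.∣-cong i q
    ; ∣-id   = λ i (s , t) → M.∣-id i s , N.∣-id i t
    ; ∣-∘    = λ i j k (s , t) → M.∣-∘ i j k s , N.∣-∘ i j k t
    ; ∣-+    = λ i (s , t) (s′ , t′) → M.∣-+ i s s′ , N.∣-+ i t t′
    ; ∣-*    = λ i a (s , t) → M.∣-* i a s , N.∣-* i a t
    ; separated = λ V i c (s , t) (s′ , t′) p →
        M.separated V i c s s′ (λ j → proj₁ (p j)) , N.separated V i c t t′ (λ j → proj₂ (p j))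
    ; glue   = λ V i c s p →
        let (t  , e ) = M.glue V i c (λ j → proj₁ (s j)) (λ j j′ W a b → proj₁ (p j j′ W a b))
            (t′ , e′) = N.glue V i c (λ j → proj₂ (s j)) (λ j j′ W a b → proj₂ (p j j′ W a b))
        in (t , t′) , λ j → e j , e′ j
    }
    where
    module M = 𝒪-Module M
    module N = 𝒪-Module N

  -- M is locally isomorphic to 𝒪ⁿ.
  IsLocallyFree : ℕ → 𝒪-Module → Set₁
  IsLocallyFree n M = ∀ P → Σ[ U ∈ Open ] P ∈ U × Σ[ e ∈ (Fin n → M.Γ.Carrierᴹ U) ]
    (∀ {V} (i : V ⊆ U) (s : M.Γ.Carrierᴹ V) →
      let open M.Γ V using (_≈ᴹ_; _*ₗ_; +ᴹ-rawMonoid)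
          open RawMonoidDefs +ᴹ-rawMonoid using () renaming (sum to sumᴹ)
          combination = λ (a : Fin n → Γ𝒪.Carrier V) → sumᴹ (λ j → a j *ₗ (e j M.∣ i))
      in ∃[ a ] s ≈ᴹ combination a ×
           (∀ b → s ≈ᴹ combination b → ∀ j → Γ𝒪._≈_ V (a j) (b j)))
    where module M = 𝒪-Module M

  IsLineBundle : 𝒪-Module → Set₁
  IsLineBundle = IsLocallyFree 1

  IsRank2Bundle : 𝒪-Module → Set₁
  IsRank2Bundle = IsLocallyFree 2

  IsDecomposable : 𝒪-Module → Set₂
  IsDecomposable M = ∃[ L ] ∃[ L′ ] IsLineBundle L × IsLineBundle L′ × M ≅ L ⊕ L′

  -- Equality of the classes of rank 2 bundles in ℙBun₂ X: N ≅ M ⊗ L for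
  -- some line bundle L (isomorphisms being the case L = 𝒪).
  infix 4 _≈ℙ_
  _≈ℙ_ : 𝒪-Module → 𝒪-Module → Set₂
  M ≈ℙ N = ∃[ L ] IsLineBundle L × IsTensorProduct M L N

  -- The sheaf U ↦ {f ∈ K(U) | f ∈ I_P for all P ∈ U}.
  sheaf : Stalks → 𝒪-Module
  sheaf I = record
    { Γ      = λ U → record
      { Carrierᴹ = Section I U
      ; _≈ᴹ_ = _≈ˢ_ ; _+ᴹ_ = _+ˢ_ ; _*ₗ_ = _*ˢ_ ; _*ᵣ_ = flip _*ˢ_ ; 0ᴹ = zeroˢ ; -ᴹ_ = -ˢ_
      ; isModule = IsModuleFromLeft.isModule {commutativeRing = Γ𝒪 U} record
        { isLeftModule = record
          { isLeftSemimodule = record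
            { +ᴹ-isCommutativeMonoid = record
              { isMonoid = record
                { isSemigroup = record
                  { isMagma = record
                    { isEquivalence = record
                      { refl  = λ {s} P u → K.refl {value s P u}
                      ; sym   = λ {s} {t} p P u → K.sym {value s P u} {value t P u} (p P u)
                      ; trans = λ {r} {s} {t} p q P u →
                          K.trans {value r P u} {value s P u} {value t P u} (p P u) (q P u)
                      }
                    ; ∙-cong = λ {r} {s} {t} {v} p q P u →
                        K.+-cong {value r P u} {value s P u} {value t P u} {value v P u}
                          (p P u) (q P u)
                    }
                  ; assoc = λ r s t P u → K.+-assoc (value r P u) (value s P u) (value t P u)
                  }
                ; identity = (λ s P u → K.+-identityˡ (value s P u))
                           , (λ s P u → K.+-identityʳ (value s P u))
                }
              ; comm = λ s t P u → K.+-comm (value s P u) (value t P u)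
              }
            ; isPreleftSemimodule = record
              { *ₗ-cong = λ {r} {s} {t} {v} p q P u →
                  K.*-cong {value r P u} {value s P u} {value t P u} {value v P u} (p P u) (q P u)
              ; *ₗ-zeroˡ = λ s P u → K.zeroˡ (value s P u)
              ; *ₗ-distribʳ = λ s a b P u → K.distribʳ (value s P u) (value a P u) (value b P u)
              ; *ₗ-identityˡ = λ s P u → K.*-identityˡ (value s P u)
              ; *ₗ-assoc = λ a b s P u → K.*-assoc (value a P u) (value b P u) (value s P u)
              ; *ₗ-zeroʳ = λ a P u → K.zeroʳ (value a P u)
              ; *ₗ-distribˡ = λ a s t P u → K.distribˡ (value a P u) (value s P u) (value t P u)
              }
            }
          ; -ᴹ‿cong = λ {s} {t} p P u → K.-‿cong {value s P u} {value t P u} (p P u)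
          ; -ᴹ‿inverse = (λ s P u → K.-‿inverseˡ (value s P u))
                       , (λ s P u → K.-‿inverseʳ (value s P u))
          }
        }
      }
    ; _∣_    = _|ˢ_
    ; ∣-cong = λ i p P PV → p P (⊆-elim i PV)
    ; ∣-id   = λ {U} i s P PU → independent s P _ _
    ; ∣-∘    = λ i j k s P PW → independent s P _ _
    ; ∣-+    = λ i s t P PV → K.refl {value s P (⊆-elim i PV) K.+ value t P (⊆-elim i PV)}
    ; ∣-*    = λ i a s P PV → K.refl {value a P (⊆-elim i PV) K.* value s P (⊆-elim i PV)}
    ; separated = λ V i cover s t p P PU →
        let (j , PV) = cover P PU
        in K.trans {value s P PU} {value s P (⊆-elim (i j) PV)} {value t P PU}
             (independent s P _ _)
             (K.trans {value s P (⊆-elim (i j) PV)} {value t P (⊆-elim (i j) PV)} {value t P PU}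
               (p j P PV) (independent t P _ _))
    ; glue   = λ V i cover s p →
        let agree : ∀ j j′ P (PV : P ∈ V j) (PV′ : P ∈ V j′) →
                      value (s j) P PV K.≈ value (s j′) P PV′
            agree j j′ P PV PV′ =
              p j j′ (V j ∩ V j′) (inclusion proj₁) (inclusion proj₂) P (PV , PV′)
        in record
             { value           = λ P PU → value (s (proj₁ (cover P PU))) P (proj₂ (cover P PU))
             ; locallyConstant = λ P PU →
                 let (j , PV) = cover P PU
                     (W , PW , c) = locallyConstant (s j) P PV
                 in V j ∩ W , (PV , PW) , λ Q (QV , QW) QU →
                      let (j′ , QV′) = cover Q QU
                      in K.trans {value (s j′) Q QV′} {value (s j) Q QV} {value (s j) P PV}
                           (agree j′ j Q QV′ QV) (c Q QW QV)
             ; inStalk         = λ P PU → inStalk (s (proj₁ (cover P PU))) P (proj₂ (cover P PU))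
             }
           , λ j P PV → agree _ j P _ PV
    }
    where
    independent : ∀ {U} (s : Section I U) P (PU PU′ : P ∈ U) → value s P PU K.≈ value s P PU′
    independent s P PU PU′ = let (V , PV , c) = locallyConstant s P PU′ in c P PV PU

  𝒪 : 𝒪-Module
  𝒪 = sheaf 𝒪ˢ

  ----------------------------------------------------------------------
  -- Divisors

  -- t generates the maximal ideal of the local ring at P.
  IsUniformizer : Point → Pred K.Carrier 0ℓ
  IsUniformizer P t = InLocalMaximalIdeal P t ×
    (∀ f → InLocalMaximalIdeal P f → ∃[ a ] InLocalRing P a × f K.≈ a K.* t)

  -- ord_P(f) ≥ n, that is f ∈ tⁿ 𝒪_P for a uniformizer t at P.  (The
  -- uniformizers differ by units; on a smooth curve they exist.)
  Ord≥ : Point → ℤ → Pred K.Carrier 0ℓ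
  Ord≥ P (+ n)      f = ∀ t → IsUniformizer P t → ∃[ a ] InLocalRing P a × f K.≈ a K.* t ^ n
  Ord≥ P (-[1+ n ]) f = ∀ t → IsUniformizer P t → InLocalRing P (f K.* t ^ suc n)

  Ord : Point → ℤ → Pred K.Carrier 0ℓ
  Ord P n f = Ord≥ P n f × ¬ Ord≥ P (1ℤ ℤ.+ n) f

  -- Weil divisors Σ n_P · P, as finitely supported functions P ↦ n_P on
  -- the closed points.
  record Divisor : Set₁ where
    field
      coeff     : ∀ P → IsClosedPoint P → ℤ
      coeff-≋   : ∀ {P Q} (p : IsClosedPoint P) (q : IsClosedPoint Q) → P ≋ Q →
                    coeff P p ≡ coeff Q q
      support   : List Point
      supported : ∀ P (p : IsClosedPoint P) → coeff P p ≢ 0ℤ → Any (P ≋_) support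

  open Divisor

  -ᵈ_ : Divisor → Divisor
  -ᵈ D = record
    { coeff     = λ P p → ℤ.- coeff D P p
    ; coeff-≋   = λ p q P≋Q → ≡.cong ℤ.-_ (coeff-≋ D p q P≋Q)
    ; support   = support D
    ; supported = λ P p -n≢0 → supported D P p (λ n≡0 → -n≢0 (≡.cong ℤ.-_ n≡0))
    }

  -- [D] = [E] in Cl X: the divisor D - E is principal.
  infix 4 _∼_
  _∼_ : Divisor → Divisor → Set₁
  D ∼ E = ∃[ f ] ¬ f K.≈ K.0# × (∀ P p → Ord P (coeff D P p ℤ.- coeff E P p) f)

  -- 𝓛_D(U) = {f ∈ K(U) | ord_P(f) ≥ - n_P for all closed points P ∈ U}
  𝓛 : Divisor → 𝒪-Module
  𝓛 D = sheaf record
    { InStalk    = λ P f → ∀ (p : IsClosedPoint P) → Ord≥ P (ℤ.- coeff D P p) f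
    ; stalk-resp = λ P {f} {g} f≈g f∈ p → ord-resp P (ℤ.- coeff D P p) {f} {g} f≈g (f∈ p)
    ; stalk-0    = λ P p → ord-0 P (ℤ.- coeff D P p)
    ; stalk-+    = λ P {f} {g} f∈ g∈ p → ord-+ P (ℤ.- coeff D P p) {f} {g} (f∈ p) (g∈ p)
    ; stalk-*    = λ P {a} {f} a∈ f∈ p → ord-* P (ℤ.- coeff D P p) {a} {f} a∈ (f∈ p)
    }
    where
    ord-resp : ∀ P n {f g} → f K.≈ g → Ord≥ P n f → Ord≥ P n g
    ord-resp P (+ n) {f} {g} f≈g f∈ t u =
      let (a , a∈ , e) = f∈ t u
      in a , a∈ , K.trans {g} {f} {a K.* t ^ n} (K.sym {f} {g} f≈g) e
    ord-resp P (-[1+ n ]) {f} {g} f≈g f∈ t u =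
      𝒪-resp P {f K.* t ^ suc n} {g K.* t ^ suc n} (K.*-congʳ {t ^ suc n} {f} {g} f≈g) (f∈ t u)

    ord-0 : ∀ P n → Ord≥ P n K.0#
    ord-0 P (+ n) t u = K.0# , 𝒪-0 P , K.sym {K.0# K.* t ^ n} {K.0#} (K.zeroˡ (t ^ n))
    ord-0 P (-[1+ n ]) t u =
      𝒪-resp P {K.0#} {K.0# K.* t ^ suc n}
        (K.sym {K.0# K.* t ^ suc n} {K.0#} (K.zeroˡ (t ^ suc n))) (𝒪-0 P)

    ord-+ : ∀ P n {f g} → Ord≥ P n f → Ord≥ P n g → Ord≥ P n (f K.+ g)
    ord-+ P (+ n) {f} {g} f∈ g∈ t u =
      let (a , a∈ , e) = f∈ t u
          (b , b∈ , e′) = g∈ t u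
      in a K.+ b , 𝒪-+ P {a} {b} a∈ b∈ ,
         K.trans {f K.+ g} {a K.* t ^ n K.+ b K.* t ^ n} {(a K.+ b) K.* t ^ n}
           (K.+-cong {f} {a K.* t ^ n} {g} {b K.* t ^ n} e e′)
           (K.sym {(a K.+ b) K.* t ^ n} {a K.* t ^ n K.+ b K.* t ^ n} (K.distribʳ (t ^ n) a b))
    ord-+ P (-[1+ n ]) {f} {g} f∈ g∈ t u =
      𝒪-resp P {f K.* t ^ suc n K.+ g K.* t ^ suc n} {(f K.+ g) K.* t ^ suc n}
        (K.sym {(f K.+ g) K.* t ^ suc n} {f K.* t ^ suc n K.+ g K.* t ^ suc n}
          (K.distribʳ (t ^ suc n) f g))
        (𝒪-+ P {f K.* t ^ suc n} {g K.* t ^ suc n} (f∈ t u) (g∈ t u))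

    ord-* : ∀ P n {a f} → InLocalRing P a → Ord≥ P n f → Ord≥ P n (a K.* f)
    ord-* P (+ n) {a} {f} a∈ f∈ t u =
      let (b , b∈ , e) = f∈ t u
      in a K.* b , 𝒪-* P {a} {b} a∈ b∈ ,
         K.trans {a K.* f} {a K.* (b K.* t ^ n)} {(a K.* b) K.* t ^ n}
           (K.*-congˡ {a} {f} {b K.* t ^ n} e)
           (K.sym {(a K.* b) K.* t ^ n} {a K.* (b K.* t ^ n)} (K.*-assoc a b (t ^ n)))
    ord-* P (-[1+ n ]) {a} {f} a∈ f∈ t u =
      𝒪-resp P {a K.* (f K.* t ^ suc n)} {(a K.* f) K.* t ^ suc n}
        (K.sym {(a K.* f) K.* t ^ suc n} {a K.* (f K.* t ^ suc n)} (K.*-assoc a f (t ^ suc n)))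
        (𝒪-* P {a} {f K.* t ^ suc n} a∈ (f∈ t u))

  c : Divisor → 𝒪-Module
  c D = 𝓛 D ⊕ 𝒪

-- At a closed point P the maximal ideal of the local ring is generated by one
-- element t, and the prime ideal ⋂ tⁿ 𝒪_P is not maximal, hence zero; so the
-- local ring is a discrete valuation ring.  As the coordinate ring is
-- noetherian, rational functions have finitely many zeros and poles.  So
-- divisors have local equations, and conversely a rational section of a line
-- bundle L has a divisor D with L ≅ 𝓛 D.  Since 𝓛 D ⊗ 𝓛 G ≅ 𝓛 (D + G), the
-- bundle 𝓛 A ⊕ 𝓛 B is c (A - B) ⊗ 𝓛 B, and c (- D) is c D ⊗ 𝓛 (- D).
--
-- Let 𝓛 E ⊕ 𝒪 ≅ 𝓛 (D + G) ⊕ 𝓛 G.  The isomorphism and its inverse are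
-- matrices of rational functions, and the products of corresponding entries
-- are global functions.  A nonzero global function x maps S_m to itself for
-- large m; S_m being finite, a power of x is 1, so x vanishes nowhere.  Hence a
-- nonzero product makes its factors isomorphisms, and either E ∼ D + G and
-- G ∼ 0, or E ∼ G and D + G ∼ 0.
module Submission where

open import Defs
open import Axiom.ExcludedMiddle using (ExcludedMiddle)
open import Data.Nat.Base using (ℕ)
open import Data.Product.Base using (_×_; ∃-syntax)
open import Data.Sum.Base using (_⊎_)
open import Function.Bundles using (_⇔_)

open import Algebra.Bundles using (CommutativeRing)
open import Algebra.Module.Bundles using (Module)
open import Algebra.Module.Morphism.Structures using (IsModuleHomomorphism)
import Algebra.Morphism.Construct.Identity as Identity
open import Algebra.Morphism.Structures using (IsRingHomomorphism)
import Algebra.Properties.CommutativeSemiring.Exp as CExp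
import Algebra.Properties.Group as GroupProperties
import Algebra.Properties.Monoid.Sum as MonoidSum
import Algebra.Properties.Ring as RingProperties
import Algebra.Properties.Semiring.Exp as Exp
import Algebra.Solver.Ring.NaturalCoefficients.Default as SemiringSolver
open import Algebra.Structures using (IsCommutativeRing)
open import Data.Empty using (⊥; ⊥-elim)
open import Data.Fin.Base as Fin using (Fin; zero; suc; toℕ; fromℕ; finToFun; funToFin)
import Data.Fin.Properties as Finₚ
open import Data.Integer.Base as ℤ using (ℤ; +_; -[1+_]; 0ℤ; 1ℤ; _⊖_)
import Data.Integer.Properties as ℤₚ
import Data.Integer.Solver as ℤSolver
open import Data.List.Base using (List; []; _∷_; _++_; map)
open import Data.List.Relation.Unary.All as All using (All; []; _∷_)
open import Data.List.Relation.Unary.Any as Any using (Any; here; there)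
import Data.List.Relation.Unary.Any.Properties as Anyₚ
open import Data.Nat.Base as ℕ using (zero; suc)
import Data.Nat.Properties as ℕₚ
open import Data.Product.Base using (Σ-syntax; ∃; _,_; proj₁; proj₂)
open import Data.Sum.Base using (inj₁; inj₂; [_,_]′)
open import Data.Unit.Base using (⊤; tt)
open import Function.Base using (_∘_; id)
open import Function.Bundles using (mk⇔; Inverse)
open import Level using (Level; 0ℓ; _⊔_; Lift; lift; lower)
open import Relation.Binary.Definitions using (tri<; tri≈; tri>)
open import Relation.Binary.PropositionalEquality as ≡ using (_≡_)
open import Relation.Nullary using (¬_; Dec; yes; no)
open import Relation.Nullary.Decidable using (decidable-stable)
open import Relation.Unary using (Pred)

-- Dimension and closedness are hypotheses about points of Proj S, while orders live in local rings.
-- The passage between them is a homogeneous prime given by its homogeneous elements alone: in this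
-- way ⋂ tⁿ 𝒪_P becomes a point, to which the bound on chains applies, and a homogeneous ideal
-- containing no S_m acquires a zero. Hilbert's basis theorem is proved for subrings of S, whose
-- coordinates may satisfy relations; it also takes the place of Zorn's lemma and of
-- quasi-compactness. Points carry predicates in `Set`, but families of points lie in `Set₁`, so the
-- ideals that become points are spanned by lists.
--
-- Tensor products are characterised by a universal property only, and multiplication of rational
-- functions is shown to satisfy it by gluing. Every nonempty open set contains the generic point,
-- so sections of subsheaves of K are constant and homomorphisms between the sheaves of divisors are
-- scalars. Scalars commute, and so the two composites of a matrix and its inverse can be compared
-- entry by entry.

-- Finite generation of ideals and Hilbert's basis theorem.

module Ideals (R : Ring₀) where
  open CommutativeRing R hiding (zero)
  open Exp semiring using (_^_)
  open RingProperties ring using (-1*x≈-x; -‿distribʳ-*)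
  open SemiringSolver commutativeSemiring using (solve; _:+_; _:*_; _:=_)
  open import Relation.Binary.Reasoning.Setoid setoid

  private variable a g h : Level

  -- Coefficients come from a predicate `A` instead of from all of R, so that one type describes the
  -- ideals of every subring met while the coordinates are adjoined.
  data Span (A : Pred Carrier a) (G : Pred Carrier g) : Pred Carrier (a ⊔ g) where
    span-gen : ∀ {x} → G x → Span A G x
    span-0   : Span A G 0#
    span-+   : ∀ {x y} → Span A G x → Span A G y → Span A G (x + y)
    span-*   : ∀ {r x} → A r → Span A G x → Span A G (r * x)
    span-≈   : ∀ {x y} → x ≈ y → Span A G x → Span A G y

  Span-bind : {A : Pred Carrier a} {G : Pred Carrier g} {H : Pred Carrier h} →
              (∀ {x} → G x → Span A H x) → ∀ {x} → Span A G x → Span A H x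
  Span-bind f (span-gen x) = f x
  Span-bind f span-0 = span-0
  Span-bind f (span-+ x y) = span-+ (Span-bind f x) (Span-bind f y)
  Span-bind f (span-* r x) = span-* r (Span-bind f x)
  Span-bind f (span-≈ e x) = span-≈ e (Span-bind f x)

  Span-widen : ∀ {A B : Pred Carrier 0ℓ} {G : Pred Carrier g} → (∀ {x} → A x → B x) →
               ∀ {x} → Span A G x → Span B G x
  Span-widen f (span-gen x)     = span-gen x
  Span-widen f span-0          = span-0
  Span-widen f (span-+ x y)   = span-+ (Span-widen f x) (Span-widen f y)
  Span-widen f (span-* r x) = span-* (f r) (Span-widen f x)
  Span-widen f (span-≈ e x)  = span-≈ e (Span-widen f x)

  _⟨_⟩ : ∀ {t} {T : Set t} → (T → Carrier) → List T → Pred Carrier t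
  (v ⟨ L ⟩) x = Any (λ t → x ≡ v t) L

  -- A finite subfamily of the given generators suffices. The families range over `Set₁` because
  -- they are indexed by points or by elements of ideals, which live there.
  IsNoetherian : Pred Carrier 0ℓ → Set₂
  IsNoetherian A = ∀ {T : Set₁} (v : T → Carrier) → (∀ t → A (v t)) →
                     ∃[ L ] ∀ t → Span A (v ⟨ L ⟩) (v t)

  Span-finite : ∀ {A : Pred Carrier 0ℓ} {T : Set₁} (v : T → Carrier) {x} →
                Span A (λ y → ∃[ t ] y ≡ v t) x → ∃[ L ] Span A (v ⟨ L ⟩) x
  Span-finite v (span-gen (t , e)) = t ∷ [] , span-gen (here e)
  Span-finite v span-0            = [] , span-0
  Span-finite v (span-+ p q)     =
    let (L , p′) = Span-finite v p
        (M , q′) = Span-finite v q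
    in L ++ M , span-+ (Span-bind (λ i → span-gen (Anyₚ.++⁺ˡ i)) p′)
                    (Span-bind (λ i → span-gen (Anyₚ.++⁺ʳ L i)) q′)
  Span-finite v (span-* r p)   = let (L , p′) = Span-finite v p in L , span-* r p′
  Span-finite v (span-≈ e p)    = let (L , p′) = Span-finite v p in L , span-≈ e p′

  record IsSubring (A : Pred Carrier 0ℓ) : Set where
    field
      ≈-resp : ∀ {x y} → x ≈ y → A x → A y
      0∈A    : A 0#
      1∈A    : A 1#
      +∈A    : ∀ {x y} → A x → A y → A (x + y)
      *∈A    : ∀ {x y} → A x → A y → A (x * y)
      -∈A    : ∀ {x} → A x → A (- x)

  -- Subtracting an element with the same leading term `p` leaves only lower terms. The difference
  -- is written with `- 1#`, which makes it a combination with coefficients in any subring.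
  difference : ∀ {s p y y′} → s ≈ p + y → ∀ t → t ≈ p + y′ → s ≈ t + (y + (- 1#) * y′)
  difference {s} {p} {y} {y′} e t e′ = begin
    s                              ≈⟨ e ⟩
    p + y                          ≈⟨ sym (+-identityʳ _) ⟩
    (p + y) + 0#                   ≈⟨ +-congˡ (sym (-‿inverseʳ y′)) ⟩
    (p + y) + (y′ + - y′)
      ≈⟨ solve 4 (λ p y y′ z → (p :+ y) :+ (y′ :+ z) := (p :+ y′) :+ (y :+ z)) refl p y y′ (- y′) ⟩
    (p + y′) + (y + - y′)          ≈⟨ +-cong (sym e′) (+-congˡ (sym (-1*x≈-x y′))) ⟩
    t + (y + (- 1#) * y′)          ∎

  module Adjoin {A : Pred Carrier 0ℓ} (subring : IsSubring A) (x : Carrier) where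
    open IsSubring subring

    -- x need not be transcendental over A, so the degree and the leading
    -- coefficient of an element are not unique.
    Degree< : ℕ → Pred Carrier 0ℓ
    Degree< zero    s = s ≈ 0#
    Degree< (suc m) s = ∃[ r ] ∃[ y ] A r × Degree< m y × s ≈ r * x ^ m + y

    A[x] : Pred Carrier 0ℓ
    A[x] s = ∃[ m ] Degree< m s

    deg-resp : ∀ m {s t} → s ≈ t → Degree< m s → Degree< m t
    deg-resp zero    e s≈0                  = trans (sym e) s≈0
    deg-resp (suc m) e (r , y , r∈ , y∈ , p) = r , y , r∈ , y∈ , trans (sym e) p

    deg-suc : ∀ m {s} → Degree< m s → Degree< (suc m) s
    deg-suc m {s} s∈ = 0# , s , 0∈A , s∈ , sym (trans (+-congʳ (zeroˡ _)) (+-identityˡ s))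

    deg-≤′ : ∀ {m n s} → m ℕ.≤′ n → Degree< m s → Degree< n s
    deg-≤′ ℕ.≤′-refl     s∈ = s∈
    deg-≤′ {n = suc n} (ℕ.≤′-step p) s∈ = deg-suc n (deg-≤′ p s∈)

    deg-0 : ∀ m → Degree< m 0#
    deg-0 m = deg-≤′ {0} {m} (ℕₚ.≤⇒≤′ ℕ.z≤n) refl

    deg-+ : ∀ m {s t} → Degree< m s → Degree< m t → Degree< m (s + t)
    deg-+ zero    p q = trans (+-cong p q) (+-identityˡ 0#)
    deg-+ (suc m) {s} {t} (r , y , r∈ , y∈ , p) (r′ , y′ , r′∈ , y′∈ , p′) =
      r + r′ , y + y′ , +∈A r∈ r′∈ , deg-+ m y∈ y′∈ , (begin
        s + t                               ≈⟨ +-cong p p′ ⟩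
        (r * x ^ m + y) + (r′ * x ^ m + y′)
          ≈⟨ solve 5 (λ r y r′ y′ z → (r :* z :+ y) :+ (r′ :* z :+ y′) := (r :+ r′) :* z :+ (y :+ y′))
            refl r y r′ y′ (x ^ m) ⟩
        (r + r′) * x ^ m + (y + y′)         ∎)

    deg-scale : ∀ m {a s} → A a → Degree< m s → Degree< m (a * s)
    deg-scale zero    a∈ p = trans (*-congˡ p) (zeroʳ _)
    deg-scale (suc m) {a} {s} a∈ (r , y , r∈ , y∈ , p) =
      a * r , a * y , *∈A a∈ r∈ , deg-scale m a∈ y∈ , (begin
        a * s                   ≈⟨ *-congˡ p ⟩
        a * (r * x ^ m + y)     ≈⟨ distribˡ a _ y ⟩
        a * (r * x ^ m) + a * y ≈⟨ +-congʳ (sym (*-assoc a r _)) ⟩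
        (a * r) * x ^ m + a * y ∎)

    deg-x^ : ∀ k m {s} → Degree< m s → Degree< (k ℕ.+ m) (x ^ k * s)
    deg-x^ k zero    p = deg-resp (k ℕ.+ zero) (sym (trans (*-congˡ p) (zeroʳ _))) (deg-0 (k ℕ.+ zero))
    deg-x^ k (suc m) {s} (r , y , r∈ , y∈ , p) =
      ≡.subst (λ n → Degree< n (x ^ k * s)) (≡.sym (ℕₚ.+-suc k m))
        (r , x ^ k * y , r∈ , deg-x^ k m y∈ , (begin
          x ^ k * s                          ≈⟨ *-congˡ p ⟩
          x ^ k * (r * x ^ m + y)
            ≈⟨ solve 4 (λ u r v y → u :* (r :* v :+ y) := r :* (u :* v) :+ u :* y) refl (x ^ k) r (x ^ m) y ⟩
          r * (x ^ k * x ^ m) + x ^ k * y    ≈⟨ +-congʳ (*-congˡ (sym (^-homo-* x k m))) ⟩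
          r * x ^ (k ℕ.+ m) + x ^ k * y      ∎))
      where open Exp semiring using (^-homo-*)

    A⊆A[x] : ∀ {s} → A s → A[x] s
    A⊆A[x] {s} s∈ = 1 , s , 0# , s∈ , refl , sym (trans (+-identityʳ _) (*-identityʳ s))

    x∈A[x] : A[x] x
    x∈A[x] = 2 , 1# , 0# , 1∈A , deg-0 1 , sym (trans (+-identityʳ _) (trans (*-identityˡ _) (*-identityʳ x)))

    +∈A[x] : ∀ {s t} → A[x] s → A[x] t → A[x] (s + t)
    +∈A[x] (m , s∈) (n , t∈) = m ℕ.⊔ n ,
      deg-+ (m ℕ.⊔ n) (deg-≤′ (ℕₚ.≤⇒≤′ (ℕₚ.m≤m⊔n m n)) s∈) (deg-≤′ (ℕₚ.≤⇒≤′ (ℕₚ.m≤n⊔m m n)) t∈)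

    *∈A[x] : ∀ m {s t} → Degree< m s → A[x] t → A[x] (s * t)
    *∈A[x] zero    s≈0 t∈ = 0 , trans (*-congʳ s≈0) (zeroˡ _)
    *∈A[x] (suc m) {s} {t} (r , y , r∈ , y∈ , p) t∈ =
      let (n , e) = +∈A[x] (m ℕ.+ proj₁ t∈ , deg-scale (m ℕ.+ proj₁ t∈) r∈ (deg-x^ m (proj₁ t∈) (proj₂ t∈)))
                           (*∈A[x] m y∈ t∈)
      in n , deg-resp n (sym (begin
        s * t                     ≈⟨ *-congʳ p ⟩
        (r * x ^ m + y) * t       ≈⟨ solve 4 (λ r u y t → (r :* u :+ y) :* t := r :* (u :* t) :+ y :* t)
          refl r (x ^ m) y t ⟩
        r * (x ^ m * t) + y * t   ∎)) e

    isSubring : IsSubring A[x]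
    isSubring = record
      { ≈-resp = λ e (m , s∈) → m , deg-resp m e s∈
      ; 0∈A = 0 , refl
      ; 1∈A = A⊆A[x] 1∈A
      ; +∈A = +∈A[x]
      ; *∈A = λ (m , s∈) t∈ → *∈A[x] m s∈ t∈
      ; -∈A = λ (m , s∈) → m , deg-resp m (-1*x≈-x _) (deg-scale m (-∈A 1∈A) s∈)
      }

    -- Hilbert's basis theorem: finitely many leading coefficients generate
    -- all of them, and with their degrees bounded by N it remains to treat
    -- the degrees below N one at a time.
    module _ (noetherian : IsNoetherian A) {T : Set₁} (v : T → Carrier) where
      I : Pred Carrier 1ℓ
      I = Span A[x] (λ y → ∃[ t ] y ≡ v t)

      Element : Set₁
      Element = ∃[ s ] I s

      record Leading (d : ℕ) : Set₁ where
        constructor leading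
        field
          element   : Element
          lead rest : Carrier
          lead∈     : A lead
          rest∈     : Degree< d rest
          expansion : proj₁ element ≈ lead * x ^ d + rest

      open Leading

      _generates_ : List Element → Pred Carrier 1ℓ
      M generates s = Span A[x] (proj₁ ⟨ M ⟩) s

      -- A combination of leading coefficients is the leading coefficient of the same combination of
      -- the elements, once each is multiplied by the power of `x` that raises its degree to `d`.
      -- The index type is left open because it is applied both to elements of all degrees and to
      -- those of one degree.
      realise : ∀ {T′ : Set₁} (w : T′ → ∃ Leading) (M : List Element) (L : List T′) d →
                All (λ t → proj₁ (w t) ℕ.≤ d × M generates proj₁ (element (proj₂ (w t)))) L →
                ∀ {a} → Span A ((λ t → lead (proj₂ (w t))) ⟨ L ⟩) a →
                ∃[ s ] ∃[ y ] M generates s × Degree< d y × s ≈ a * x ^ d + y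
      realise w M (t ∷ L) d ((e≤d , m) ∷ _) (span-gen (here ≡.refl)) =
        let (e , leading (s , _) a y a∈ y∈ p) = w t
            k = d ℕ.∸ e
            k+e≡d = ℕₚ.m∸n+n≡m e≤d
        in x ^ k * s , x ^ k * y , span-* (x^∈ k) m
         , ≡.subst (λ n → Degree< n (x ^ k * y)) k+e≡d (deg-x^ k e y∈) , (begin
           x ^ k * s                          ≈⟨ *-congˡ p ⟩
           x ^ k * (a * x ^ e + y)
             ≈⟨ solve 4 (λ u r v y → u :* (r :* v :+ y) := r :* (u :* v) :+ u :* y) refl (x ^ k) a (x ^ e) y ⟩
           a * (x ^ k * x ^ e) + x ^ k * y    ≈⟨ +-congʳ (*-congˡ (sym (^-homo-* x k e))) ⟩
           a * x ^ (k ℕ.+ e) + x ^ k * y      ≡⟨ ≡.cong (λ n → a * x ^ n + x ^ k * y) k+e≡d ⟩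
           a * x ^ d + x ^ k * y              ∎)
        where
        open Exp semiring using (^-homo-*)
        x^∈ : ∀ k → A[x] (x ^ k)
        x^∈ zero    = A⊆A[x] 1∈A
        x^∈ (suc k) = IsSubring.*∈A isSubring x∈A[x] (x^∈ k)
      realise w M (t ∷ L) d (_ ∷ ps) (span-gen (there i)) = realise w M L d ps (span-gen i)
      realise w M L d ps span-0 = 0# , 0# , span-0 , deg-0 d , sym (trans (+-identityʳ _) (zeroˡ _))
      realise w M L d ps (span-+ {a} {b} p q) =
        let (s , y , s∈ , y∈ , e) = realise w M L d ps p
            (t , z , t∈ , z∈ , f) = realise w M L d ps q
        in s + t , y + z , span-+ s∈ t∈ , deg-+ d y∈ z∈ , (begin
          s + t                             ≈⟨ +-cong e f ⟩
          (a * x ^ d + y) + (b * x ^ d + z)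
            ≈⟨ solve 5 (λ r y r′ y′ z → (r :* z :+ y) :+ (r′ :* z :+ y′) := (r :+ r′) :* z :+ (y :+ y′))
              refl a y b z (x ^ d) ⟩
          (a + b) * x ^ d + (y + z)         ∎)
      realise w M L d ps (span-* {r} {a} r∈ p) =
        let (s , y , s∈ , y∈ , e) = realise w M L d ps p
        in r * s , r * y , span-* (A⊆A[x] r∈) s∈ , deg-scale d r∈ y∈ , (begin
          r * s                   ≈⟨ *-congˡ e ⟩
          r * (a * x ^ d + y)     ≈⟨ distribˡ r _ y ⟩
          r * (a * x ^ d) + r * y ≈⟨ +-congʳ (sym (*-assoc r a _)) ⟩
          (r * a) * x ^ d + r * y ∎)
      realise w M L d ps (span-≈ a≈b p) =
        let (s , y , s∈ , y∈ , e) = realise w M L d ps p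
        in s , y , s∈ , y∈ , trans e (+-congʳ (*-congʳ a≈b))

      all-leads : ∃[ L ] ∀ (t : ∃ Leading) → Span A ((λ t → lead (proj₂ t)) ⟨ L ⟩) (lead (proj₂ t))
      all-leads = noetherian {T = ∃ Leading} (λ t → lead (proj₂ t)) (λ t → lead∈ (proj₂ t))

      leads : ∀ d → ∃[ L ] ∀ (t : Leading d) → Span A (lead {d} ⟨ L ⟩) (lead {d} t)
      leads d = noetherian {T = Leading d} (lead {d}) (lead∈ {d})

      bound : List (∃ Leading) → ℕ
      bound []            = 0
      bound ((d , _) ∷ L) = d ℕ.⊔ bound L

      bounded : ∀ L {N} → bound L ℕ.≤ N → All (λ t → proj₁ t ℕ.≤ N) L
      bounded []            _ = []
      bounded ((d , _) ∷ L) p =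
        ℕₚ.≤-trans (ℕₚ.m≤m⊔n d (bound L)) p ∷ bounded L (ℕₚ.≤-trans (ℕₚ.m≤n⊔m d (bound L)) p)

      below : ℕ → List Element
      below zero    = []
      below (suc d) = map (element {d}) (proj₁ (leads d)) ++ below d

      N : ℕ
      N = bound (proj₁ all-leads)

      G : List Element
      G = map (λ t → element (proj₂ t)) (proj₁ all-leads) ++ below N

      below⊆ : ∀ {ℓ} {P : Pred Element ℓ} n d → d ℕ.< n → Any P (map (element {d}) (proj₁ (leads d))) →
        Any P (below n)
      below⊆ (suc n) d (ℕ.s≤s d≤n) i with ℕₚ.m≤n⇒m<n∨m≡n d≤n
      ... | inj₁ d<n     = Anyₚ.++⁺ʳ (map (element {n}) (proj₁ (leads n))) (below⊆ n d d<n i)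
      ... | inj₂ ≡.refl = Anyₚ.++⁺ˡ i

      generates-map : ∀ {T′ : Set₁} (w : T′ → Element) (L : List T′) (M : List Element) →
                      (∀ {s} → (proj₁ ⟨ map w L ⟩) s → (proj₁ ⟨ M ⟩) s) →
                      All (λ t → M generates proj₁ (w t)) L
      generates-map w []      M f = []
      generates-map w (t ∷ L) M f = span-gen (f (here ≡.refl)) ∷ generates-map w L M (λ i → f (there i))

      G-generates : ∀ m s → I s → Degree< m s → G generates s
      G-generates zero    s s∈ s≈0 = span-≈ (sym s≈0) span-0
      G-generates (suc d) s s∈ (a , y , a∈ , y∈ , e) =
        let (s′ , y′ , s′∈ , y′∈ , e′) = approximant
        in span-≈ (sym (difference e s′ e′)) (span-+ s′∈
             (G-generates d _ (difference∈ s′ y′ s′∈ e′) (deg-+ d y∈ (deg-scale d (-∈A 1∈A) y′∈))))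
        where
        t : Leading d
        t = leading (s , s∈) a y a∈ y∈ e

        approximant : ∃[ s ] ∃[ y ] G generates s × Degree< d y × s ≈ a * x ^ d + y
        approximant with N ℕₚ.≤? d
        ... | yes N≤d = realise (λ u → u) G (proj₁ all-leads) d
                (All.zip (bounded (proj₁ all-leads) N≤d ,
                  generates-map (λ (t : ∃ Leading) → element (proj₂ t)) (proj₁ all-leads) G Anyₚ.++⁺ˡ))
                (proj₂ all-leads (d , t))
        ... | no N≰d  = realise (λ u → d , u) G (proj₁ (leads d)) d
                (All.map (ℕₚ.≤-refl ,_) (generates-map (element {d}) (proj₁ (leads d)) G
                  (λ i → Anyₚ.++⁺ʳ (map (λ t → element (proj₂ t)) (proj₁ all-leads))
                           (below⊆ N d (ℕₚ.≰⇒> N≰d) i))))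
                (proj₂ (leads d) t)

        member : ∀ M {s} → (proj₁ ⟨ M ⟩) s → I s
        member ((_ , s∈) ∷ _) (here ≡.refl) = s∈
        member (_ ∷ M)        (there i)     = member M i

        I-G : ∀ {s} → G generates s → I s
        I-G = Span-bind (member G)

        difference∈ : ∀ s′ y′ → G generates s′ → s′ ≈ a * x ^ d + y′ → I (y + (- 1#) * y′)
        difference∈ s′ y′ s′∈ e′ = span-≈
          (begin
            (- 1#) * s′ + s                            ≈⟨ +-cong (-1*x≈-x s′) (difference e s′ e′) ⟩
            - s′ + (s′ + (y + (- 1#) * y′))            ≈⟨ sym (+-assoc _ _ _) ⟩
            (- s′ + s′) + (y + (- 1#) * y′)            ≈⟨ trans (+-congʳ (-‿inverseˡ s′)) (+-identityˡ _) ⟩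
            y + (- 1#) * y′                            ∎)
          (span-+ (span-* (A⊆A[x] (-∈A 1∈A)) (I-G s′∈)) s∈)

      -- Elements of `I` need not be values of `v`; each is a combination of finitely many values,
      -- and these are collected.
      flatten : ∀ (M : List Element) → ∃[ L ] ∀ {s} → M generates s → Span A[x] (v ⟨ L ⟩) s
      flatten []            = [] , Span-bind λ ()
      flatten ((s , s∈) ∷ M) =
        let (L , p) = Span-finite v s∈
            (L′ , q) = flatten M
        in L ++ L′ , Span-bind λ
          { (here ≡.refl) → Span-bind (λ i → span-gen (Anyₚ.++⁺ˡ i)) p
          ; (there i)     → Span-bind (λ j → span-gen (Anyₚ.++⁺ʳ L j)) (q (span-gen i)) }

    isNoetherian : IsNoetherian A → IsNoetherian A[x]
    isNoetherian noetherian v v∈ =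
      let (L , p) = flatten noetherian v (G noetherian v)
      in L , λ t → p (G-generates noetherian v (proj₁ (v∈ t)) (v t) (span-gen (t , ≡.refl)) (proj₂ (v∈ t)))

  module _ (em : ∀ {ℓ} → ExcludedMiddle ℓ) where

    -- Any nonzero value divides all the others. This is the base of the induction over the
    -- coordinates, with `A` the image of k.
    field-noetherian : ∀ (A : Pred Carrier 0ℓ) → A 1# → (∀ {x y} → A x → A y → A (x * y)) →
                       (∀ {x} → A x → ¬ x ≈ 0# → ∃[ y ] A y × x * y ≈ 1#) → IsNoetherian A
    field-noetherian A 1∈ *∈ inverse v v∈ with em {P = ∃[ t ] ¬ v t ≈ 0#}
    ... | no ∄ = [] , λ t → span-≈ (sym (all0 t)) span-0
      where
      all0 : ∀ t → v t ≈ 0#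
      all0 t with em {P = v t ≈ 0#}
      ... | yes p = p
      ... | no ¬p = ⊥-elim (∄ (t , ¬p))
    ... | yes (t , t≉0) = t ∷ [] , λ u →
      let (y , y∈ , e) = inverse (v∈ t) t≉0
      in span-≈ (begin
           (v u * y) * v t   ≈⟨ *-assoc _ _ _ ⟩
           v u * (y * v t)   ≈⟨ *-congˡ (trans (*-comm y (v t)) e) ⟩
           v u * 1#          ≈⟨ *-identityʳ (v u) ⟩
           v u               ∎)
         (span-* (*∈ (v∈ u) y∈) (span-gen (here ≡.refl)))

-- Homogeneous components and homogeneous primes.

module HomogeneousPrimes {R : Ring₀} (G : Grading R) (directSum : IsDirectSum G) where
  open CommutativeRing R hiding (zero)
  open Grading G
  open IsDirectSum directSum
  open RingProperties ring using (-‿+-comm; -0#≈0#)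
  open SemiringSolver commutativeSemiring using (solve; _:+_; _:*_; _:=_)
  open MonoidSum +-monoid using (sum; sum-init-last; sum-cong-≋)
  open import Relation.Binary.Reasoning.Setoid setoid

  Family : Set₁
  Family = ℕ → Pred Carrier 0ℓ

  -- The recursion strips the component of top degree, on which the later inductions turn; `sum`
  -- strips the lowest one, and `snoc` mediates.
  Low : Family → ℕ → Pred Carrier 0ℓ
  Low F zero    x = x ≈ 0#
  Low F (suc n) x = ∃[ a ] ∃[ y ] F n a × Low F n y × x ≈ a + y

  private
    snoc : ∀ {n} → (Fin n → Carrier) → Carrier → Fin (suc n) → Carrier
    snoc {zero}  c a _           = a
    snoc {suc n} c a Fin.zero    = c Fin.zero
    snoc {suc n} c a (Fin.suc i) = snoc (c ∘ Fin.suc) a i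

    sum-snoc : ∀ {n} (c : Fin n → Carrier) a → sum (snoc c a) ≈ a + sum c
    sum-snoc {zero}  c a = refl
    sum-snoc {suc n} c a = begin
      c Fin.zero + sum (snoc (c ∘ Fin.suc) a)    ≈⟨ +-congˡ (sum-snoc (c ∘ Fin.suc) a) ⟩
      c Fin.zero + (a + sum (c ∘ Fin.suc))
        ≈⟨ solve 3 (λ x y z → x :+ (y :+ z) := y :+ (x :+ z)) refl _ _ _ ⟩
      a + (c Fin.zero + sum (c ∘ Fin.suc))       ∎

    snoc-all : ∀ {n} (F : Family) (c : Fin n → Carrier) a →
               (∀ i → F (toℕ i) (c i)) → F n a → ∀ i → F (toℕ i) (snoc c a i)
    snoc-all {zero}  F c a c∈ a∈ Fin.zero    = a∈
    snoc-all {suc n} F c a c∈ a∈ Fin.zero    = c∈ Fin.zero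
    snoc-all {suc n} F c a c∈ a∈ (Fin.suc i) = snoc-all (F ∘ suc) (c ∘ Fin.suc) a (c∈ ∘ Fin.suc) a∈ i

    snoc-last : ∀ n (c : Fin n → Carrier) a → snoc c a (fromℕ n) ≡ a
    snoc-last zero    c a = ≡.refl
    snoc-last (suc n) c a = snoc-last n (c ∘ Fin.suc) a

  Low⇒sum : ∀ {F} n {x} → Low F n x → Σ[ c ∈ (Fin n → Carrier) ] (∀ i → F (toℕ i) (c i)) × x ≈ sum c
  Low⇒sum zero    x≈0 = (λ ()) , (λ ()) , x≈0
  Low⇒sum {F} (suc n) (a , y , a∈ , y∈ , e) =
    let (c , c∈ , p) = Low⇒sum n y∈
    in snoc c a , snoc-all F c a c∈ a∈ , trans e (trans (+-congˡ p) (sym (sum-snoc c a)))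

  sum⇒Low : ∀ {F} n {x} (c : Fin n → Carrier) → (∀ i → F (toℕ i) (c i)) → x ≈ sum c → Low F n x
  sum⇒Low zero    c c∈ e = e
  sum⇒Low {F} (suc n) c c∈ e =
    c (fromℕ n) , sum (c ∘ Fin.inject₁) , ≡.subst (λ m → F m (c (fromℕ n))) (Finₚ.toℕ-fromℕ n) (c∈ (fromℕ n))
    , sum⇒Low n (c ∘ Fin.inject₁)
        (λ i → ≡.subst (λ m → F m (c (Fin.inject₁ i))) (Finₚ.toℕ-inject₁ i) (c∈ (Fin.inject₁ i))) refl
    , trans e (trans (sum-init-last c) (+-comm _ _))

  low-resp : ∀ {F} n {x y} → x ≈ y → Low F n x → Low F n y
  low-resp zero    e x≈0                  = trans (sym e) x≈0
  low-resp (suc n) e (a , z , a∈ , z∈ , p) = a , z , a∈ , z∈ , trans (sym e) p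

  low-map : ∀ {F F′ : Family} → (∀ {d x} → F d x → F′ d x) → ∀ n {x} → Low F n x → Low F′ n x
  low-map f zero    p                    = p
  low-map f (suc n) (a , y , a∈ , y∈ , e) = a , y , f a∈ , low-map f n y∈ , e

  low-+ : ∀ {F : Family} → (∀ {d x y} → F d x → F d y → F d (x + y)) →
          ∀ n {x y} → Low F n x → Low F n y → Low F n (x + y)
  low-+ f zero    p q = trans (+-cong p q) (+-identityˡ 0#)
  low-+ f (suc n) (a , y , a∈ , y∈ , e) (a′ , y′ , a′∈ , y′∈ , e′) =
    a + a′ , y + y′ , f a∈ a′∈ , low-+ f n y∈ y′∈ ,
    trans (+-cong e e′) (solve 4 (λ a y a′ y′ → (a :+ y) :+ (a′ :+ y′) := (a :+ a′) :+ (y :+ y′))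
      refl a y a′ y′)

  module _ {F : Family} (F-0 : ∀ {d} → F d 0#) where

    low-suc : ∀ n {x} → Low F n x → Low F (suc n) x
    low-suc n {x} p = 0# , x , F-0 , p , sym (+-identityˡ x)

    low-≤ : ∀ {m n x} → m ℕ.≤′ n → Low F m x → Low F n x
    low-≤ ℕ.≤′-refl             p = p
    low-≤ {n = suc n} (ℕ.≤′-step m≤n) p = low-suc n (low-≤ m≤n p)

    low-0 : ∀ n → Low F n 0#
    low-0 n = low-≤ {0} {n} (ℕₚ.≤⇒≤′ ℕ.z≤n) refl

    low-single : ∀ d {x} → F d x → Low F (suc d) x
    low-single d {x} x∈ = x , 0# , x∈ , low-0 d , sym (+-identityʳ x)

  module _ {F F′ F″ : Family} (F″-0 : ∀ {d} → F″ d 0#)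
           (F″-+ : ∀ {d x y} → F″ d x → F″ d y → F″ d (x + y))
           (mul : ∀ {d e x y} → F d x → F′ e y → F″ (d ℕ.+ e) (x * y)) where

    low-*-single : ∀ n {m x y} → Low F n x → F′ m y → Low F″ (n ℕ.+ m) (x * y)
    low-*-single zero    {m} x≈0 y∈ = low-resp m (sym (trans (*-congʳ x≈0) (zeroˡ _))) (low-0 F″-0 m)
    low-*-single (suc n) {y = y} (a , z , a∈ , z∈ , e) y∈ =
      a * y , z * y , mul a∈ y∈ , low-*-single n z∈ y∈ , trans (*-congʳ e) (distribʳ y a z)

    low-* : ∀ n m {x y} → Low F n x → Low F′ m y → Low F″ (n ℕ.+ m) (x * y)
    low-* n zero    x∈ y≈0 = low-resp (n ℕ.+ 0) (sym (trans (*-congˡ y≈0) (zeroʳ _))) (low-0 F″-0 (n ℕ.+ 0))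
    low-* n (suc m) {x} {y} x∈ (b , z , b∈ , z∈ , e) =
      ≡.subst (λ k → Low F″ k (x * y)) (≡.sym (ℕₚ.+-suc n m))
        (low-suc F″-0 (n ℕ.+ m) (low-resp (n ℕ.+ m) (sym (trans (*-congˡ e) (distribˡ x b z)))
          (low-+ F″-+ (n ℕ.+ m) (low-*-single n x∈ b∈) (low-* n m x∈ z∈))))

  low-neg : ∀ n {x} → Low Part n x → Low Part n (- x)
  low-neg zero    x≈0 = trans (-‿cong x≈0) -0#≈0#
  low-neg (suc n) (a , y , a∈ , y∈ , e) =
    - a , - y , neg-closed a∈ , low-neg n y∈ , trans (-‿cong e) (sym (-‿+-comm a y))

  low-all : ∀ x → ∃[ n ] Low Part n x
  low-all x = let (n , c , c∈ , e) = decompose x in n , sum⇒Low n c c∈ e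

  top≈0 : ∀ n {a z} → Part n a → Low Part n z → a + z ≈ 0# → a ≈ 0#
  top≈0 n {a} {z} a∈ z∈ e =
    let (c , c∈ , p) = Low⇒sum n z∈
    in trans (reflexive (≡.sym (snoc-last n c a)))
         (independent (suc n) (snoc c a) (snoc-all Part c a c∈ a∈)
           (trans (sum-snoc c a) (trans (+-congˡ (sym p)) e)) (fromℕ n))

  private
    exchange : ∀ {a z b w} → a + z ≈ b + w → (a + - b) + (z + - w) ≈ 0#
    exchange {a} {z} {b} {w} e = begin
      (a + - b) + (z + - w)   ≈⟨ solve 4 (λ a b z w → (a :+ b) :+ (z :+ w) := (a :+ z) :+ (b :+ w))
        refl a (- b) z (- w) ⟩
      (a + z) + (- b + - w)   ≈⟨ +-cong e (-‿+-comm b w) ⟩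
      (b + w) + - (b + w)     ≈⟨ -‿inverseʳ _ ⟩
      0#                      ∎

    minus : ∀ {a b} → a + - b ≈ 0# → a ≈ b
    minus {a} {b} e = begin
      a               ≈⟨ sym (+-identityʳ a) ⟩
      a + 0#          ≈⟨ +-congˡ (sym (-‿inverseˡ b)) ⟩
      a + (- b + b)   ≈⟨ sym (+-assoc _ _ _) ⟩
      (a + - b) + b   ≈⟨ trans (+-congʳ e) (+-identityˡ b) ⟩
      b               ∎

  top-unique : ∀ n {a z b w} → Part n a → Low Part n z → Part n b → Low Part n w →
               a + z ≈ b + w → a ≈ b
  top-unique n a∈ z∈ b∈ w∈ e =
    minus (top≈0 n (+-closed a∈ (neg-closed b∈)) (low-+ +-closed n z∈ (low-neg n w∈)) (exchange e))

  -- Primality is asked of homogeneous elements only. The primes of this development arise in that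
  -- form, and `point` recovers the full prime ideal.
  record HomogeneousPrime : Set₁ where
    field
      H          : Family
      H⊆Part     : ∀ {d x} → H d x → Part d x
      H-resp     : ∀ {d x y} → x ≈ y → H d x → H d y
      H-0        : ∀ {d} → H d 0#
      H-+        : ∀ {d x y} → H d x → H d y → H d (x + y)
      H-*        : ∀ {d e x y} → H d x → Part e y → H (d ℕ.+ e) (x * y)
      H-prime    : ∀ {d e x y} → Part d x → Part e y → H (d ℕ.+ e) (x * y) → H d x ⊎ H e y
      H-relevant : ∃[ d ] ∃[ x ] Part (suc d) x × ¬ H (suc d) x

    -- Components are unique, so the top degrees of the two expansions are compared: if the one in
    -- `H` is lower, `u` vanishes; if they are equal, `u` is its top component; if it is higher,
    -- that component vanishes and is dropped.
    top∈H : ∀ N {w k u z} → Low H N w → Part k u → Low Part k z → w ≈ u + z → H k u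
    top∈H zero    {w} {k} {u} {z} w≈0 u∈ z∈ e =
      H-resp (sym (top≈0 k u∈ z∈ (trans (sym e) w≈0))) H-0
    top∈H (suc N) {w} {k} {u} {z} (h , w′ , h∈ , w′∈ , p) u∈ z∈ e with ℕₚ.<-cmp N k
    ... | tri< N<k _ _ =
      H-resp (sym (top-unique k u∈ z∈ 0-closed
        (low-≤ 0-closed (ℕₚ.≤⇒≤′ N<k) (low-map H⊆Part (suc N) (h , w′ , h∈ , w′∈ , p)))
        (trans (sym e) (sym (+-identityˡ w))))) H-0
    ... | tri≈ _ ≡.refl _ =
      H-resp (top-unique N (H⊆Part h∈) (low-map H⊆Part N w′∈) u∈ z∈ (trans (sym p) e)) h∈
    ... | tri> _ _ k<N = top∈H N w′∈ u∈ z∈ (begin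
        w′       ≈⟨ sym (+-identityˡ w′) ⟩
        0# + w′  ≈⟨ +-congʳ (sym h≈0) ⟩
        h + w′   ≈⟨ sym p ⟩
        w        ≈⟨ e ⟩
        u + z    ∎)
      where
      h≈0 : h ≈ 0#
      h≈0 = top-unique N (H⊆Part h∈) (low-map H⊆Part N w′∈) 0-closed
              (low-≤ 0-closed (ℕₚ.≤⇒≤′ k<N) (u , z , u∈ , z∈ , refl))
              (trans (sym p) (trans e (sym (+-identityˡ _))))

    I : Pred Carrier 0ℓ
    I x = ∃[ n ] Low H n x

    I-resp : ∀ {x y} → x ≈ y → I x → I y
    I-resp e (n , p) = n , low-resp n e p

    I-+ : ∀ {x y} → I x → I y → I (x + y)
    I-+ (n , p) (m , q) = n ℕ.⊔ m ,
      low-+ H-+ (n ℕ.⊔ m) (low-≤ H-0 (ℕₚ.≤⇒≤′ (ℕₚ.m≤m⊔n n m)) p)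
                          (low-≤ H-0 (ℕₚ.≤⇒≤′ (ℕₚ.m≤n⊔m n m)) q)

    I-* : ∀ x {y} → I y → I (x * y)
    I-* x {y} (n , p) = let (m , q) = low-all x in
      I-resp (*-comm y x) (n ℕ.+ m , low-* H-0 H-+ H-* n m p q)

    H⇒I : ∀ {d x} → H d x → I x
    H⇒I {d} x∈ = suc d , low-single H-0 d x∈

    I⇒H : ∀ {d x} → Part d x → I x → H d x
    I⇒H {d} {x} x∈ (n , p) = top∈H n p x∈ (low-0 0-closed d) (sym (+-identityʳ x))

    -- If the product of the top components lies in H, so does one of them,
    -- and it can be removed.
    I-prime : ∀ n m {x y} → Low Part n x → Low Part m y → I (x * y) → I x ⊎ I y
    I-prime zero    m       x≈0 y∈ _ = inj₁ (0 , x≈0)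
    I-prime (suc n) zero    x∈ y≈0 _ = inj₂ (0 , y≈0)
    I-prime (suc n) (suc m) {x} {y} (a , x′ , a∈ , x′∈ , p) (b , y′ , b∈ , y′∈ , q) xy∈ =
      [ removeˡ , removeʳ ]′ (H-prime a∈ b∈
        (top∈H (proj₁ xy∈) (proj₂ xy∈) (*-closed a∈ b∈) rest∈ (begin
          x * y                                    ≈⟨ *-cong p q ⟩
          (a + x′) * (b + y′)
            ≈⟨ solve 4 (λ a x b y → (a :+ x) :* (b :+ y) := a :* b :+ (y :* a :+ (x :* b :+ x :* y)))
              refl a x′ b y′ ⟩
          a * b + (y′ * a + (x′ * b + x′ * y′))    ∎)))
      where
      rest∈ : Low Part (n ℕ.+ m) (y′ * a + (x′ * b + x′ * y′))
      rest∈ = low-+ +-closed (n ℕ.+ m)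
        (≡.subst (λ k → Low Part k (y′ * a)) (ℕₚ.+-comm m n) (low-*-single 0-closed +-closed *-closed m y′∈ a∈))
        (low-+ +-closed (n ℕ.+ m) (low-*-single 0-closed +-closed *-closed n x′∈ b∈)
                                  (low-* 0-closed +-closed *-closed n m x′∈ y′∈))

      I-remove : ∀ {u v w} → u ≈ v + w → I u → I v → I w
      I-remove {u} {v} {w} e u∈ v∈ = I-resp (begin
        u + (- 1#) * v          ≈⟨ +-cong e (RingProperties.-1*x≈-x ring v) ⟩
        (v + w) + - v           ≈⟨ +-congʳ (+-comm v w) ⟩
        (w + v) + - v           ≈⟨ trans (+-assoc _ _ _) (+-congˡ (-‿inverseʳ v)) ⟩
        w + 0#                  ≈⟨ +-identityʳ w ⟩
        w                       ∎) (I-+ u∈ (I-* (- 1#) v∈))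

      removeˡ : H n a → I x ⊎ I y
      removeˡ a∈H with I-prime n (suc m) x′∈ (b , y′ , b∈ , y′∈ , q)
        (I-remove (trans (*-congʳ p) (trans (distribʳ y a x′) (+-congʳ (*-comm a y)))) xy∈ (I-* y (H⇒I a∈H)))
      ... | inj₁ x′∈I = inj₁ (I-resp (sym p) (I-+ (H⇒I a∈H) x′∈I))
      ... | inj₂ y∈I  = inj₂ y∈I

      removeʳ : H m b → I x ⊎ I y
      removeʳ b∈H with I-prime (suc n) m (a , x′ , a∈ , x′∈ , p) y′∈
        (I-remove (trans (*-congˡ q) (distribˡ x b y′)) xy∈ (I-* x (H⇒I b∈H)))
      ... | inj₁ x∈I  = inj₁ x∈I
      ... | inj₂ y′∈I = inj₂ (I-resp (sym q) (I-+ (H⇒I b∈H) y′∈I))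

    point : Proj.Point G
    point = record
      { ideal       = I
      ; ideal-resp  = I-resp
      ; ideal-0     = 0 , refl
      ; ideal-+     = I-+
      ; ideal-*     = I-*
      ; homogeneous = λ (n , p) → let (c , c∈ , e) = Low⇒sum n p in
          n , c , (λ i → H⊆Part (c∈ i) , H⇒I (c∈ i)) , e
      ; prime       = λ {x} {y} → let (n , p) = low-all x ; (m , q) = low-all y in I-prime n m p q
      ; relevant    = let (d , x , x∈ , x∉) = H-relevant in d , x , x∈ , λ x∈I → x∉ (I⇒H x∈ x∈I)
      }

-- Homogeneous coordinate rings: noetherianity, existence of zeros, finiteness of the parts.

module CoordinateRings (em : ∀ {ℓ} → ExcludedMiddle ℓ) {k : Ring₀} (isField : IsField k)
                       (A : HomogeneousCoordinateRing k) where
  private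
    module A = HomogeneousCoordinateRing A
    module k = CommutativeRing k
    module ι = IsRingHomomorphism A.isRingHomomorphism
  open CommutativeRing A.ring hiding (zero)
  open A using (Part; ι; x)
  open Ideals A.ring
  open HomogeneousPrimes A.grading A.isDirectSum
  open MonoidSum +-monoid using (sum; sum-cong-≋)
  open SemiringSolver commutativeSemiring using (solve; _:+_; _:*_; _:=_)

  record NoetherianSubring : Set₂ where
    field
      member     : Pred Carrier 0ℓ
      subring    : IsSubring member
      noetherian : IsNoetherian member
      constants  : ∀ a → member (ι a)

  open NoetherianSubring

  private
    Constant : Pred Carrier 0ℓ
    Constant s = ∃[ a ] ι a ≈ s

    constant-ring : NoetherianSubring
    constant-ring = record
      { member     = Constant
      ; subring    = record
        { ≈-resp = λ e (a , p) → a , trans p e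
        ; 0∈A    = k.0# , ι.0#-homo
        ; 1∈A    = k.1# , ι.1#-homo
        ; +∈A    = λ (a , p) (b , q) → a k.+ b , trans (ι.+-homo a b) (+-cong p q)
        ; *∈A    = *∈
        ; -∈A    = λ (a , p) → k.- a , trans (ι.-‿homo a) (-‿cong p)
        }
      ; noetherian = field-noetherian em Constant (k.1# , ι.1#-homo) *∈ λ {x} → inv {x}
      ; constants  = λ a → a , refl
      }
      where
      *∈ : ∀ {x y} → Constant x → Constant y → Constant (x * y)
      *∈ (a , p) (b , q) = a k.* b , trans (ι.*-homo a b) (*-cong p q)

      inv : ∀ {x} → Constant x → ¬ x ≈ 0# → ∃[ y ] Constant y × x * y ≈ 1#
      inv (a , p) x≉0 =
        let (b , e) = IsField.inverse isField a (λ a≈0 → x≉0 (trans (sym p) (trans (ι.⟦⟧-cong a≈0) ι.0#-homo)))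
        in ι b , (b , refl) ,
           trans (*-congʳ (sym p)) (trans (sym (ι.*-homo a b)) (trans (ι.⟦⟧-cong e) ι.1#-homo))

    -- The coordinates are adjoined one at a time inside S, relations included, so no polynomial
    -- ring has to be built and mapped onto S.
    adjoin : ∀ m (y : Fin m → Carrier) → Σ[ B ∈ NoetherianSubring ] ∀ i → member B (y i)
    adjoin zero    y = constant-ring , λ ()
    adjoin (suc m) y =
      let (B , y∈) = adjoin m (y ∘ Fin.suc)
          module B[y] = Adjoin (subring B) (y Fin.zero)
      in record
           { member = B[y].A[x] ; subring = B[y].isSubring
           ; noetherian = B[y].isNoetherian (noetherian B)
           ; constants = λ a → B[y].A⊆A[x] (constants B a) }
       , λ { Fin.zero → B[y].x∈A[x] ; (Fin.suc i) → B[y].A⊆A[x] (y∈ i) }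

    generated-ring : Σ[ B ∈ NoetherianSubring ] ∀ i → member B (x i)
    generated-ring = adjoin (suc A.n) x

    open NoetherianSubring (proj₁ generated-ring) using () renaming (member to B; subring to B-subring)
    module B = IsSubring B-subring

    sum∈ : ∀ n (c : Fin n → Carrier) → (∀ i → B (c i)) → B (sum c)
    sum∈ zero    c c∈ = B.0∈A
    sum∈ (suc n) c c∈ = B.+∈A (c∈ Fin.zero) (sum∈ n (c ∘ Fin.suc) (c∈ ∘ Fin.suc))

    part∈ : ∀ d {s} → Part d s → B s
    part∈ zero    s∈ = let (a , e) = A.degree-0 s∈ in B.≈-resp e (constants (proj₁ generated-ring) a)
    part∈ (suc d) s∈ =
      let (c , c∈ , e) = A.generated s∈
      in B.≈-resp (sym e) (sum∈ _ _ (λ i → B.*∈A (part∈ d (c∈ i)) (proj₂ generated-ring i)))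

    all∈ : ∀ s → B s
    all∈ s = let (n , c , c∈ , e) = IsDirectSum.decompose A.isDirectSum s
             in B.≈-resp (sym e) (sum∈ n c (λ i → part∈ (toℕ i) (c∈ i)))

  Everything : Pred Carrier 0ℓ
  Everything _ = ⊤

  Ideal : ∀ {g} → Pred Carrier g → Pred Carrier g
  Ideal = Span Everything

  finitely-generated : ∀ {T : Set₁} (v : T → Carrier) → ∃[ L ] ∀ t → Ideal (v ⟨ L ⟩) (v t)
  finitely-generated v =
    let (L , p) = noetherian (proj₁ generated-ring) v (λ t → all∈ (v t))
    in L , λ t → Span-widen (λ _ → tt) (p t)

  Ideal-* : ∀ {g h j} {G : Pred Carrier g} {H : Pred Carrier h} {J : Pred Carrier j} →
            (∀ {x y} → G x → H y → Ideal J (x * y)) →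
            ∀ {x y} → Ideal G x → Ideal H y → Ideal J (x * y)
  Ideal-* {G = G} {H} {J} f {x} {y} p q = left p
    where
    right : ∀ {z} → G z → ∀ {y} → Ideal H y → Ideal J (z * y)
    right g (span-gen h)     = f g h
    right g span-0          = span-≈ (sym (zeroʳ _)) span-0
    right g (span-+ p q)   = span-≈ (sym (distribˡ _ _ _)) (span-+ (right g p) (right g q))
    right g (span-* _ p) = span-≈ (solve 3 (λ r z y → r :* (z :* y) := z :* (r :* y))
      refl _ _ _) (span-* tt (right g p))
    right g (span-≈ e p)  = span-≈ (*-congˡ e) (right g p)

    left : ∀ {z} → Ideal G z → Ideal J (z * y)
    left (span-gen g)     = right g q
    left span-0          = span-≈ (sym (zeroˡ _)) span-0
    left (span-+ p p′)  = span-≈ (sym (distribʳ _ _ _)) (span-+ (left p) (left p′))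
    left (span-* _ p) = span-≈ (sym (*-assoc _ _ _)) (span-* tt (left p))
    left (span-≈ e p)  = span-≈ (*-congʳ e) (left p)

  Ideal-sum : ∀ {g} {G : Pred Carrier g} n (c : Fin n → Carrier) → (∀ i → Ideal G (c i)) → Ideal G (sum c)
  Ideal-sum zero    c c∈ = span-0
  Ideal-sum (suc n) c c∈ = span-+ (c∈ Fin.zero) (Ideal-sum n (c ∘ Fin.suc) (c∈ ∘ Fin.suc))

  -- S_(m+n) is spanned by S_m S_n, in the form of an induction principle.
  part-* : ∀ {g} {G : Pred Carrier g} m {n} → (∀ {p q} → Part m p → Part n q → Ideal G (p * q)) →
           ∀ {s} → Part (m ℕ.+ n) s → Ideal G s
  part-* {G = G} m {n} f {s} s∈ =
    span-≈ (*-identityʳ s) (go m 1# (λ p∈ q∈ → span-≈ (sym (*-identityʳ _)) (f p∈ q∈)) s∈)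
    where
    -- `u` is the product of the coordinates already split off, so that the induction can run on the
    -- coefficients, of lower degree.
    go : ∀ m u → (∀ {p q} → Part m p → Part n q → Ideal G ((p * q) * u)) →
         ∀ {s} → Part (m ℕ.+ n) s → Ideal G (s * u)
    go zero    u f {s} s∈ = span-≈ (*-congʳ (*-identityˡ s)) (f A.1-closed s∈)
    go (suc m) u f {s} s∈ =
      let (c , c∈ , e) = A.generated s∈
      in span-≈ (*-congʳ (sym e)) (span-≈ (sym (*-distribʳ-sum u (λ i → c i * x i)))
           (Ideal-sum (suc A.n) _ (λ i → span-≈ (sym (*-assoc (c i) (x i) u))
             (go m (x i * u)
               (λ {p} {q} p∈ q∈ → span-≈ (solve 4 (λ p q x u → ((p :* x) :* q) :* u := (p :* q) :* (x :* u))
                 refl p q (x i) u)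
                 (f (≡.subst (λ d → Part d (p * x i)) (ℕₚ.+-comm m 1) (A.*-closed p∈ (A.x-degree i))) q∈))
               (c∈ i)))))
      where open import Algebra.Properties.Semiring.Sum semiring using (*-distribʳ-sum)

  Homogeneous : Set₁
  Homogeneous = Σ[ s ∈ Carrier ] Lift 1ℓ (∃[ d ] Part d s)

  -- Unlike _⟨_⟩, in Set₀, where the ideals of points live.
  Elements : List Homogeneous → Pred Carrier 0ℓ
  Elements []      _ = ⊥
  Elements (t ∷ L) s = s ≡ proj₁ t ⊎ Elements L s

  -- The condition, by the Nullstellensatz, for L to have a zero in Proj S.
  Proper : List Homogeneous → Set
  Proper L = ∀ m → ∃[ s ] Part m s × ¬ Ideal (Elements L) s

  private
    -- The ascending chain condition as a contradiction: if every good list could be enlarged by an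
    -- element outside its ideal, finitely many of the new elements would generate them all, and the
    -- element added after a stage containing those would not be new.
    module Iterate (Good : Pred (List Homogeneous) 0ℓ) (L₀ : List Homogeneous) (good₀ : Good L₀)
                   (step : ∀ L → Good L → Σ[ t ∈ Homogeneous ] Good (t ∷ L) × ¬ Ideal (Elements L) (proj₁ t))
                     where
      chain : ℕ → ∃ Good
      chain zero    = L₀ , good₀
      chain (suc n) = let (L , good) = chain n ; (t , good′ , _) = step L good in t ∷ L , good′

      new : ℕ → Homogeneous
      new n = proj₁ (step (proj₁ (chain n)) (proj₂ (chain n)))

      old : ∀ {m n} → m ℕ.<′ n → Elements (proj₁ (chain n)) (proj₁ (new m))
      old ℕ.≤′-refl      = inj₁ ≡.refl
      old (ℕ.≤′-step p)  = inj₂ (old p)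

      bound : List (Lift 1ℓ ℕ) → ℕ
      bound []             = 0
      -- `new n` belongs to the chain only from stage `suc n` on.
      bound (lift n ∷ L) = suc n ℕ.⊔ bound L

      olds : ∀ L {N s} → bound L ℕ.≤ N → ((λ n → proj₁ (new (lower n))) ⟨ L ⟩) s → Elements (proj₁ (chain N)) s
      olds (lift n ∷ L) p (here ≡.refl) = old (ℕₚ.≤⇒≤′ (ℕₚ.≤-trans (ℕₚ.m≤m⊔n (suc n) (bound L)) p))
      olds (lift n ∷ L) p (there i)     = olds L (ℕₚ.≤-trans (ℕₚ.m≤n⊔m (suc n) (bound L)) p) i

      absurd : ⊥
      absurd =
        let (L , p) = finitely-generated (λ n → proj₁ (new (lower n)))
            N = bound L
        in proj₂ (proj₂ (step (proj₁ (chain N)) (proj₂ (chain N))))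
             (Span-bind (λ i → span-gen (olds L ℕₚ.≤-refl i)) (p (lift N)))

  -- Takes the place of Zorn's lemma: noetherianity makes the enlargement of a good list stop.
  maximal : ∀ (Good : Pred (List Homogeneous) 0ℓ) {L₀} → Good L₀ →
            ∃[ L ] Good L × (∀ t → Good (t ∷ L) → Ideal (Elements L) (proj₁ t))
  maximal Good {L₀} good₀ with em {P = ∃[ L ] Good L × (∀ t → Good (t ∷ L) → Ideal (Elements L) (proj₁ t))}
  ... | yes m = m
  ... | no ∄  = ⊥-elim (Iterate.absurd Good L₀ good₀ step)
    where
    step : ∀ L → Good L → Σ[ t ∈ Homogeneous ] Good (t ∷ L) × ¬ Ideal (Elements L) (proj₁ t)
    step L good with em {P = Σ[ t ∈ Homogeneous ] Good (t ∷ L) × ¬ Ideal (Elements L) (proj₁ t)}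
    ... | yes s = s
    ... | no ∄t = ⊥-elim (∄ (L , good , λ t good′ → decidable-stable em (λ t∉ → ∄t (t , good′ , t∉))))

  -- If `s` and `t` were outside the ideal, adjoining either one would by maximality swallow a whole
  -- S_m and S_n. Since st is in the ideal, so would be S_m S_n, hence S_(m+n), against properness.
  Proper-prime : ∀ L → Proper L → (∀ t → Proper (t ∷ L) → Ideal (Elements L) (proj₁ t)) → HomogeneousPrime
  Proper-prime L proper max = record
    { H          = λ d s → Part d s × Ideal (Elements L) s
    ; H⊆Part     = proj₁
    ; H-resp     = λ e (s∈ , s∈L) → A.resp e s∈ , span-≈ e s∈L
    ; H-0        = A.0-closed , span-0
    ; H-+        = λ (s∈ , s∈L) (t∈ , t∈L) → A.+-closed s∈ t∈ , span-+ s∈L t∈L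
    ; H-*        = λ (s∈ , s∈L) t∈ → A.*-closed s∈ t∈ , span-≈ (*-comm _ _) (span-* tt s∈L)
    ; H-prime    = prime
    ; H-relevant = let (s , s∈ , s∉) = proper 1 in 0 , s , s∈ , λ (_ , s∈L) → s∉ s∈L
    }
    where
    improper : ∀ (t : Homogeneous) → ¬ Ideal (Elements L) (proj₁ t) →
               ∃[ m ] ∀ {s} → Part m s → Ideal (Elements (t ∷ L)) s
    improper t t∉ with em {P = ∃[ m ] ∀ {s} → Part m s → Ideal (Elements (t ∷ L)) s}
    ... | yes p = p
    ... | no ∄m = ⊥-elim (t∉ (max t λ m → decidable-stable em
                    (λ ∄s → ∄m (m , λ {s} s∈ → decidable-stable em (λ s∉ → ∄s (s , s∈ , s∉))))))

    prime : ∀ {d e s t} → Part d s → Part e t → Part (d ℕ.+ e) (s * t) × Ideal (Elements L) (s * t) →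
            (Part d s × Ideal (Elements L) s) ⊎ (Part e t × Ideal (Elements L) t)
    prime {d} {e} {s} {t} s∈ t∈ (_ , st∈)
      with em {P = Ideal (Elements L) s} | em {P = Ideal (Elements L) t}
    ... | yes s∈L | _       = inj₁ (s∈ , s∈L)
    ... | no _    | yes t∈L = inj₂ (t∈ , t∈L)
    ... | no s∉   | no t∉   =
      let s′ = s , lift (d , s∈)
          t′ = t , lift (e , t∈)
          (m , p) = improper s′ s∉
          (n , q) = improper t′ t∉
          (r , r∈ , r∉) = proper (m ℕ.+ n)
      in ⊥-elim (r∉ (part-* m (λ u∈ v∈ → Ideal-* {G = Elements (s′ ∷ L)} {H = Elements (t′ ∷ L)} product
           (p u∈) (q v∈)) r∈))
      where
      product : ∀ {x y} → x ≡ s ⊎ Elements L x → y ≡ t ⊎ Elements L y → Ideal (Elements L) (x * y)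
      product (inj₁ ≡.refl) (inj₁ ≡.refl) = st∈
      product (inj₁ ≡.refl) (inj₂ y∈)     = span-* tt (span-gen y∈)
      product (inj₂ x∈)     _             = span-≈ (*-comm _ _) (span-* tt (span-gen x∈))

  nonempty : ∀ L₀ → Proper L₀ → Σ[ P ∈ Proj.Point A.grading ] ∀ {d s} → Part d s → Elements L₀ s →
    Proj.Point.ideal P s
  nonempty L₀ proper₀ =
    let (L , (proper , extends) , max) =
          maximal (λ L → Proper L × (∀ {s} → Elements L₀ s → Elements L s)) {L₀} (proper₀ , λ s∈ → s∈)
        prime = Proper-prime L proper (λ t good → max t (good , λ s∈ → inj₂ (extends s∈)))
    in HomogeneousPrime.point prime , λ s∈ s∈L₀ → HomogeneousPrime.H⇒I prime (s∈ , span-gen (extends s∈L₀))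

  module _ {q : ℕ} (enumerate : Fin q → k.Carrier) (enumerated : ∀ a → ∃[ i ] enumerate i k.≈ a) where

    -- The finiteness of k enters here: an element of S_(d+1) is determined by one coefficient from
    -- S_d for each coordinate.
    part-finite : ∀ d → ∃[ N ] Σ[ f ∈ (Fin N → Carrier) ] ∀ {s} → Part d s → ∃[ i ] f i ≈ s
    part-finite zero    = q , ι ∘ enumerate , λ s∈ →
      let (a , e) = A.degree-0 s∈ ; (i , p) = enumerated a in i , trans (ι.⟦⟧-cong p) e
    part-finite (suc d) =
      let (N , f , p) = part-finite d
      in N ℕ.^ suc A.n , (λ i → sum (λ j → f (finToFun i j) * x j)) , λ s∈ →
         let (c , c∈ , e) = A.generated s∈
             g = λ j → proj₁ (p (c∈ j))
         in funToFin g , sym (trans e (sum-cong-≋ (λ j → *-congʳ {x j} (sym (trans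
              (reflexive (≡.cong f (Finₚ.finToFun-funToFin g j))) (proj₂ (p (c∈ j))))))))

-- Fields, inverses and integer powers.

module FieldTheory (em : ∀ {ℓ} → ExcludedMiddle ℓ) (F : Ring₀) (isField : IsField F) where
  open CommutativeRing F hiding (zero)
  open IsField isField
  open Exp semiring using (_^_; ^-congˡ; ^-homo-*)
  open CExp commutativeSemiring using (^-distrib-*)
  open SemiringSolver commutativeSemiring using (solve; _:+_; _:*_; _:=_)
  open import Relation.Binary.Reasoning.Setoid setoid

  infix 4 _≉0
  _≉0 : Pred Carrier 0ℓ
  x ≉0 = ¬ x ≈ 0#

  -- inv 0 = 0
  inv : Carrier → Carrier
  inv x with em {P = x ≈ 0#}
  ... | yes _   = 0#
  ... | no x≉0 = proj₁ (inverse x x≉0)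

  inv-inverse : ∀ {x} → x ≉0 → x * inv x ≈ 1#
  inv-inverse {x} x≉0 with em {P = x ≈ 0#}
  ... | yes x≈0 = ⊥-elim (x≉0 x≈0)
  ... | no x≉0′ = proj₂ (inverse x x≉0′)

  inv-0 : ∀ {x} → x ≈ 0# → inv x ≈ 0#
  inv-0 {x} x≈0 with em {P = x ≈ 0#}
  ... | yes _  = refl
  ... | no x≉0 = ⊥-elim (x≉0 x≈0)

  inv-unique : ∀ {x y} → x * y ≈ 1# → y ≈ inv x
  inv-unique {x} {y} e = begin
    y                   ≈⟨ sym (*-identityˡ y) ⟩
    1# * y              ≈⟨ *-congʳ (sym (inv-inverse x≉0)) ⟩
    (x * inv x) * y     ≈⟨ solve 3 (λ x i y → (x :* i) :* y := (x :* y) :* i) refl x (inv x) y ⟩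
    (x * y) * inv x     ≈⟨ trans (*-congʳ e) (*-identityˡ _) ⟩
    inv x               ∎
    where
    x≉0 : x ≉0
    x≉0 x≈0 = 1≉0 (trans (sym e) (trans (*-congʳ x≈0) (zeroˡ y)))

  inv-cong : ∀ {x y} → x ≈ y → inv x ≈ inv y
  inv-cong {x} {y} e with em {P = x ≈ 0#}
  ... | yes x≈0 = sym (inv-0 (trans (sym e) x≈0))
  ... | no x≉0  = inv-unique (trans (*-congʳ (sym e)) (proj₂ (inverse x x≉0)))

  ≉0-resp : ∀ {x y} → x ≈ y → x ≉0 → y ≉0
  ≉0-resp e x≉0 y≈0 = x≉0 (trans e y≈0)

  ≉0-factorˡ : ∀ {x y} → x * y ≉0 → x ≉0
  ≉0-factorˡ xy≉0 x≈0 = xy≉0 (trans (*-congʳ x≈0) (zeroˡ _))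

  ≉0-factorʳ : ∀ {x y} → x * y ≉0 → y ≉0
  ≉0-factorʳ xy≉0 y≈0 = xy≉0 (trans (*-congˡ y≈0) (zeroʳ _))

  *-cancelˡ : ∀ {x y z} → x ≉0 → x * y ≈ x * z → y ≈ z
  *-cancelˡ {x} {y} {z} x≉0 e = begin
    y                 ≈⟨ expand y ⟩
    inv x * (x * y)   ≈⟨ *-congˡ e ⟩
    inv x * (x * z)   ≈⟨ sym (expand z) ⟩
    z                 ∎
    where
    expand : ∀ y → y ≈ inv x * (x * y)
    expand y = trans (sym (*-identityˡ y)) (trans (*-congʳ (sym (inv-inverse x≉0)))
                 (solve 3 (λ x i y → (x :* i) :* y := i :* (x :* y)) refl x (inv x) y))

  *-cancelʳ : ∀ {x y z} → x ≉0 → y * x ≈ z * x → y ≈ z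
  *-cancelʳ x≉0 e = *-cancelˡ x≉0 (trans (*-comm _ _) (trans e (*-comm _ _)))

  *-≉0 : ∀ {x y} → x ≉0 → y ≉0 → x * y ≉0
  *-≉0 {x} {y} x≉0 y≉0 e = y≉0 (*-cancelˡ x≉0 (trans e (sym (zeroʳ x))))

  inv-≉0 : ∀ {x} → x ≉0 → inv x ≉0
  inv-≉0 x≉0 = ≉0-factorʳ (≉0-resp (sym (inv-inverse x≉0)) 1≉0)

  inv-* : ∀ {x y} → x ≉0 → y ≉0 → inv (x * y) ≈ inv x * inv y
  inv-* {x} {y} x≉0 y≉0 = sym (inv-unique (begin
    (x * y) * (inv x * inv y)
      ≈⟨ solve 4 (λ x y u v → (x :* y) :* (u :* v) := (x :* u) :* (y :* v)) refl x y (inv x) (inv y) ⟩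
    (x * inv x) * (y * inv y)   ≈⟨ trans (*-cong (inv-inverse x≉0) (inv-inverse y≉0)) (*-identityˡ 1#) ⟩
    1#                          ∎))

  inv-inv : ∀ {x} → x ≉0 → inv (inv x) ≈ x
  inv-inv {x} x≉0 = sym (inv-unique (trans (*-comm _ _) (inv-inverse x≉0)))

  inv-1 : inv 1# ≈ 1#
  inv-1 = sym (inv-unique (*-identityˡ 1#))

  /-cancel : ∀ {x y} → y ≉0 → (x * inv y) * y ≈ x
  /-cancel {x} {y} y≉0 = trans (*-assoc _ _ _) (trans (*-congˡ (trans (*-comm _ _) (inv-inverse y≉0)))
    (*-identityʳ x))

  */-cancel : ∀ {x y} → y ≉0 → (x * y) * inv y ≈ x
  */-cancel {x} {y} y≉0 = trans (*-assoc _ _ _) (trans (*-congˡ (inv-inverse y≉0)) (*-identityʳ x))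

  ^-≉0 : ∀ {x} → x ≉0 → ∀ n → x ^ n ≉0
  ^-≉0 x≉0 zero    = 1≉0
  ^-≉0 x≉0 (suc n) = *-≉0 x≉0 (^-≉0 x≉0 n)

  inv-^ : ∀ {x} → x ≉0 → ∀ n → inv (x ^ n) ≈ inv x ^ n
  inv-^ x≉0 zero    = inv-1
  inv-^ x≉0 (suc n) = trans (inv-* x≉0 (^-≉0 x≉0 n)) (*-congˡ (inv-^ x≉0 n))

  infixr 8 _^ᶻ_
  _^ᶻ_ : Carrier → ℤ → Carrier
  x ^ᶻ (+ n)      = x ^ n
  x ^ᶻ (-[1+ n ]) = inv x ^ suc n

  module _ {x} (x≉0 : x ≉0) where
    private
      ^-cancel : ∀ n → x ^ n * inv x ^ n ≈ 1#
      ^-cancel zero    = *-identityˡ 1#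
      ^-cancel (suc n) = begin
        (x * x ^ n) * (inv x * inv x ^ n)
          ≈⟨ solve 4 (λ x y u v → (x :* y) :* (u :* v) := (x :* u) :* (y :* v))
            refl x (x ^ n) (inv x) (inv x ^ n) ⟩
        (x * inv x) * (x ^ n * inv x ^ n)   ≈⟨ trans (*-cong (inv-inverse x≉0) (^-cancel n)) (*-identityˡ 1#) ⟩
        1#                                  ∎

    ^ᶻ-⊖ : ∀ m n → x ^ᶻ (m ⊖ n) ≈ x ^ m * inv x ^ n
    ^ᶻ-⊖ zero    zero    = sym (*-identityˡ 1#)
    ^ᶻ-⊖ zero    (suc n) = sym (*-identityˡ _)
    ^ᶻ-⊖ (suc m) zero    = sym (*-identityʳ _)
    ^ᶻ-⊖ (suc m) (suc n) = begin
      x ^ᶻ (suc m ⊖ suc n)                ≡⟨ ≡.cong (x ^ᶻ_) (ℤₚ.[1+m]⊖[1+n]≡m⊖n m n) ⟩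
      x ^ᶻ (m ⊖ n)                        ≈⟨ ^ᶻ-⊖ m n ⟩
      x ^ m * inv x ^ n                   ≈⟨ sym (trans (*-congʳ (inv-inverse x≉0)) (*-identityˡ _)) ⟩
      (x * inv x) * (x ^ m * inv x ^ n)
        ≈⟨ solve 4 (λ x u y v → (x :* u) :* (y :* v) := (x :* y) :* (u :* v))
          refl x (inv x) (x ^ m) (inv x ^ n) ⟩
      (x * x ^ m) * (inv x * inv x ^ n)   ∎

    ^ᶻ-+ : ∀ m n → x ^ᶻ (m ℤ.+ n) ≈ x ^ᶻ m * x ^ᶻ n
    ^ᶻ-+ (+ m)      (+ n)      = ^-homo-* x m n
    ^ᶻ-+ (+ m)      (-[1+ n ]) = ^ᶻ-⊖ m (suc n)
    ^ᶻ-+ (-[1+ m ]) (+ n)      = trans (^ᶻ-⊖ n (suc m)) (*-comm _ _)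
    ^ᶻ-+ (-[1+ m ]) (-[1+ n ]) = begin
      inv x ^ suc (suc (m ℕ.+ n))   ≡⟨ ≡.cong (λ k → inv x ^ suc k) (≡.sym (ℕₚ.+-suc m n)) ⟩
      inv x ^ (suc m ℕ.+ suc n)     ≈⟨ ^-homo-* (inv x) (suc m) (suc n) ⟩
      inv x ^ suc m * inv x ^ suc n ∎

    ^ᶻ-≉0 : ∀ n → x ^ᶻ n ≉0
    ^ᶻ-≉0 (+ n)      = ^-≉0 x≉0 n
    ^ᶻ-≉0 (-[1+ n ]) = ^-≉0 (inv-≉0 x≉0) (suc n)

    ^ᶻ-neg : ∀ n → x ^ᶻ (ℤ.- n) ≈ inv (x ^ᶻ n)
    ^ᶻ-neg n = inv-unique (begin
      x ^ᶻ n * x ^ᶻ (ℤ.- n)     ≈⟨ sym (^ᶻ-+ n (ℤ.- n)) ⟩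
      x ^ᶻ (n ℤ.+ ℤ.- n)        ≡⟨ ≡.cong (x ^ᶻ_) (ℤₚ.+-inverseʳ n) ⟩
      1#                        ∎)

  -- Local subrings of a field and discrete valuations.

  record IsLocalSubring (O M : Pred Carrier 0ℓ) : Set where
    field
      O-resp : ∀ {x y} → x ≈ y → O x → O y
      O-1    : O 1#
      O-+    : ∀ {x y} → O x → O y → O (x + y)
      O-*    : ∀ {x y} → O x → O y → O (x * y)
      M-resp : ∀ {x y} → x ≈ y → M x → M y
      M-0    : M 0#
      M⊆O    : ∀ {x} → M x → O x
      M-*    : ∀ {a x} → O a → M x → M (a * x)
      1∉M    : ¬ M 1#
      O-inv  : ∀ {x} → O x → ¬ M x → O (inv x)

  module LocalSubring {O M : Pred Carrier 0ℓ} (local : IsLocalSubring O M) where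
    open IsLocalSubring local

    Unit : Pred Carrier 0ℓ
    Unit x = x ≉0 × O x × O (inv x)

    unit-resp : ∀ {x y} → x ≈ y → Unit x → Unit y
    unit-resp e (x≉0 , x∈ , i∈) = ≉0-resp e x≉0 , O-resp e x∈ , O-resp (inv-cong e) i∈

    unit-1 : Unit 1#
    unit-1 = 1≉0 , O-1 , O-resp (sym inv-1) O-1

    unit-* : ∀ {x y} → Unit x → Unit y → Unit (x * y)
    unit-* (x≉0 , x∈ , i∈) (y≉0 , y∈ , j∈) =
      *-≉0 x≉0 y≉0 , O-* x∈ y∈ , O-resp (sym (inv-* x≉0 y≉0)) (O-* i∈ j∈)

    unit-inv : ∀ {x} → Unit x → Unit (inv x)
    unit-inv (x≉0 , x∈ , i∈) = inv-≉0 x≉0 , i∈ , O-resp (sym (inv-inv x≉0)) x∈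

    unit-^ : ∀ {x} → Unit x → ∀ n → Unit (x ^ n)
    unit-^ u zero    = unit-1
    unit-^ u (suc n) = unit-* u (unit-^ u n)

    ∉M⇒unit : ∀ {x} → O x → ¬ M x → Unit x
    ∉M⇒unit x∈ x∉ = (λ x≈0 → x∉ (M-resp (sym x≈0) M-0)) , x∈ , O-inv x∈ x∉

    unit⇒∉M : ∀ {x} → Unit x → ¬ M x
    unit⇒∉M (x≉0 , _ , i∈) x∈M = 1∉M (M-resp (trans (*-comm _ _) (inv-inverse x≉0)) (M-* i∈ x∈M))

    Uniformizer : Pred Carrier 0ℓ
    Uniformizer t = M t × (∀ f → M f → ∃[ a ] O a × f ≈ a * t)

    -- Copies the shape of the order of a rational function on the curve, over an abstract field, so
    -- that the two can be identified once K is substituted.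
    Ord≥ : ℤ → Pred Carrier 0ℓ
    Ord≥ (+ n)      f = ∀ t → Uniformizer t → ∃[ a ] O a × f ≈ a * t ^ n
    Ord≥ (-[1+ n ]) f = ∀ t → Uniformizer t → O (f * t ^ suc n)

    Ord : ℤ → Pred Carrier 0ℓ
    Ord n f = Ord≥ n f × ¬ Ord≥ (1ℤ ℤ.+ n) f

    module _ {t} (t∈M : M t) (t≉0 : t ≉0) (generates : ∀ f → M f → ∃[ a ] O a × f ≈ a * t) where

      t⁻¹∉O : ¬ O (inv t)
      t⁻¹∉O i∈ = 1∉M (M-resp (trans (*-comm _ _) (inv-inverse t≉0)) (M-* i∈ t∈M))

      -- This is ⋂ tⁿ O; divisibility by tⁿ is tested with the inverse of t in the field.
      ⋂ : Pred Carrier 0ℓ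
      ⋂ x = ∀ n → O (x * inv t ^ n)

      /t : ∀ {x} → M x → O (x * inv t)
      /t {x} x∈ = let (a , a∈ , e) = generates x x∈
                  in O-resp (sym (trans (*-congʳ e) (*/-cancel t≉0))) a∈

      -- At the last `n` for which tⁿ divides x, the quotient is a unit: were it in `M`, it could be
      -- divided by t once more.
      leading-unit : ∀ {x} → O x → ¬ ⋂ x → ∃[ n ] Unit (x * inv t ^ n)
      leading-unit {x} x∈ x∉ = let (n , x/tⁿ∉) = fails in search n x/tⁿ∉
        where
        fails : ∃[ n ] ¬ O (x * inv t ^ n)
        fails = decidable-stable em (λ ∄ → x∉ (λ n → decidable-stable em (λ ¬O → ∄ (n , ¬O))))

        search : ∀ n → ¬ O (x * inv t ^ n) → ∃[ n ] Unit (x * inv t ^ n)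
        search zero    ∉ = ⊥-elim (∉ (O-resp (sym (*-identityʳ x)) x∈))
        search (suc n) ∉ with em {P = O (x * inv t ^ n)}
        ... | no ∉′  = search n ∉′
        ... | yes ∈O = n , ∉M⇒unit ∈O (λ ∈M → ∉ (O-resp
                (solve 3 (λ x y i → (x :* y) :* i := x :* (i :* y)) refl x (inv t ^ n) (inv t)) (/t ∈M)))

      -- Otherwise x and y are units times powers tᵐ and tⁿ, and divisibility of xy by the next
      -- power of t after tᵐ⁺ⁿ would make t invertible in `O`.
      ⋂-prime : ∀ {x y} → O x → O y → ⋂ (x * y) → ⋂ x ⊎ ⋂ y
      ⋂-prime {x} {y} x∈ y∈ xy∈ with em {P = ⋂ x} | em {P = ⋂ y}
      ... | yes p | _     = inj₁ p
      ... | no _  | yes q = inj₂ q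
      ... | no p  | no q  =
        let (m , u) = leading-unit x∈ p
            (n , v) = leading-unit y∈ q
            (w≉0 , _ , i∈) = unit-* u v
            s = inv t
            i = inv ((x * s ^ m) * (y * s ^ n))
        in ⊥-elim (t⁻¹∉O (O-resp (begin
             i * ((x * y) * (s * s ^ (m ℕ.+ n)))          ≈⟨ *-congˡ (*-congˡ (*-congˡ (^-homo-* s m n))) ⟩
             i * ((x * y) * (s * (s ^ m * s ^ n)))
               ≈⟨ solve 6 (λ i x y s u v → i :* ((x :* y) :* (s :* (u :* v))) :=
                 (s :* ((x :* u) :* (y :* v))) :* i) refl i x y s (s ^ m) (s ^ n) ⟩
             (s * ((x * s ^ m) * (y * s ^ n))) * i        ≈⟨ */-cancel w≉0 ⟩
             s                                            ∎)
             (O-* i∈ (xy∈ (suc (m ℕ.+ n))))))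

      ⋂-* : ∀ {a x} → O a → ⋂ x → ⋂ (a * x)
      ⋂-* a∈ x∈ n = O-resp (sym (*-assoc _ _ _)) (O-* a∈ (x∈ n))

      ⋂-0 : ⋂ 0#
      ⋂-0 n = O-resp (sym (zeroˡ _)) (M⊆O M-0)

      ⋂-+ : ∀ {x y} → ⋂ x → ⋂ y → ⋂ (x + y)
      ⋂-+ x∈ y∈ n = O-resp (sym (distribʳ _ _ _)) (O-+ (x∈ n) (y∈ n))

      t∉⋂ : ¬ ⋂ t
      t∉⋂ t∈ = t⁻¹∉O (O-resp (begin
        t * (inv t * (inv t * 1#))   ≈⟨ trans (sym (*-assoc _ _ _)) (*-congʳ (inv-inverse t≉0)) ⟩
        1# * (inv t * 1#)            ≈⟨ trans (*-identityˡ _) (*-identityʳ _) ⟩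
        inv t                        ∎) (t∈ 2))

      ⋂-resp : ∀ {x y} → x ≈ y → ⋂ x → ⋂ y
      ⋂-resp e x∈ n = O-resp (*-congʳ e) (x∈ n)

  record IsDVR (O M : Pred Carrier 0ℓ) : Set where
    field
      isLocal   : IsLocalSubring O M
      t         : Carrier
      t∈M       : M t
      t≉0       : t ≉0
      generates : ∀ f → M f → ∃[ a ] O a × f ≈ a * t
      ⋂≈0       : ∀ x → LocalSubring.⋂ isLocal t∈M t≉0 generates x → x ≈ 0#
      fractions : ∀ f → ∃[ a ] ∃[ b ] O a × O b × b ≉0 × f * b ≈ a

  module DVR {O M : Pred Carrier 0ℓ} (dvr : IsDVR O M) where
    open IsDVR dvr
    open IsLocalSubring isLocal
    open LocalSubring isLocal

    private
      infix 4 _≥_ _is_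
      -- Orders measured with the one chosen `t`, uniformly in the sign of n, whereas `Ord≥`
      -- quantifies over all uniformizers and distinguishes signs. The valuation is computed in this
      -- form and translated back.
      _≥_ _is_ : Carrier → ℤ → Set
      f ≥ n  = O (f * t ^ᶻ (ℤ.- n))
      f is n = Unit (f * t ^ᶻ (ℤ.- n))

      uniformizer : Uniformizer t
      uniformizer = t∈M , generates

      uniformizer-ratio : ∀ {s} → Uniformizer s → ∃[ u ] Unit u × s ≈ u * t
      uniformizer-ratio {s} (s∈ , s-gen) =
        let (u , u∈ , e) = generates s s∈
            (v , v∈ , e′) = s-gen t t∈M
            uv≈1 : u * v ≈ 1#
            uv≈1 = *-cancelˡ t≉0 (begin
              t * (u * v)   ≈⟨ solve 3 (λ t u v → t :* (u :* v) := v :* (u :* t)) refl t u v ⟩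
              v * (u * t)   ≈⟨ *-congˡ (sym e) ⟩
              v * s         ≈⟨ sym e′ ⟩
              t             ≈⟨ sym (*-identityʳ t) ⟩
              t * 1#        ∎)
        in u , ( ≉0-factorˡ (≉0-resp (sym uv≈1) 1≉0) , u∈ , O-resp (inv-unique uv≈1) v∈) , e

      to≥ : ∀ n {f} → Ord≥ n f → f ≥ n
      to≥ (+ zero)  {f} p = let (a , a∈ , e) = p t uniformizer in
        O-resp (sym (trans (*-identityʳ f) (trans e (*-identityʳ a)))) a∈
      to≥ (+ suc n) {f} p = let (a , a∈ , e) = p t uniformizer in
        O-resp (sym (trans (*-cong e (sym (inv-^ t≉0 (suc n)))) (*/-cancel (^-≉0 t≉0 (suc n))))) a∈
      to≥ (-[1+ n ]) p = p t uniformizer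

      -- Any uniformizer is s = u t with u a unit, so t ^ n = u ^ - n * s ^ n.
      from≥ : ∀ n {f} → f ≥ n → Ord≥ n f
      from≥ (+ n) {f} p s s-unif =
        let (u , u-unit , e) = uniformizer-ratio s-unif
            a = f * t ^ᶻ (ℤ.- (+ n))
            (i≉0 , i∈ , _) = unit-inv (unit-^ u-unit n)
        in a * inv (u ^ n) , O-* p i∈ , (begin
             f                                        ≈⟨ sym (/-cancel (^-≉0 t≉0 n)) ⟩
             (f * inv (t ^ n)) * t ^ n                ≈⟨ *-congʳ (*-congˡ (sym (^ᶻ-neg t≉0 (+ n)))) ⟩
             a * t ^ n                                ≈⟨ *-congʳ (sym (/-cancel (proj₁ (unit-^ u-unit n)))) ⟩
             ((a * inv (u ^ n)) * u ^ n) * t ^ n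
               ≈⟨ trans (*-assoc _ _ _) (*-congˡ (sym (^-distrib-* u t n))) ⟩
             (a * inv (u ^ n)) * (u * t) ^ n          ≈⟨ *-congˡ (^-congˡ n (sym e)) ⟩
             (a * inv (u ^ n)) * s ^ n                ∎)
      from≥ (-[1+ n ]) {f} p s s-unif =
        let (u , u-unit , e) = uniformizer-ratio s-unif
        in O-resp (begin
             u ^ suc n * (f * t ^ suc n)
               ≈⟨ solve 3 (λ u f t → u :* (f :* t) := f :* (u :* t)) refl (u ^ suc n) f (t ^ suc n) ⟩
             f * (u ^ suc n * t ^ suc n)    ≈⟨ *-congˡ (sym (^-distrib-* u t (suc n))) ⟩
             f * (u * t) ^ suc n            ≈⟨ *-congˡ (^-congˡ (suc n) (sym e)) ⟩
             f * s ^ suc n                  ∎)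
           (O-* (proj₁ (proj₂ (unit-^ u-unit (suc n)))) p)

      succ : ∀ n f → f * t ^ᶻ (ℤ.- (1ℤ ℤ.+ n)) ≈ (f * t ^ᶻ (ℤ.- n)) * inv t
      succ n f = begin
        f * t ^ᶻ (ℤ.- (1ℤ ℤ.+ n))            ≡⟨ ≡.cong (λ k → f * t ^ᶻ k)
          (≡.trans (ℤₚ.neg-distrib-+ 1ℤ n) (ℤₚ.+-comm (ℤ.- 1ℤ) (ℤ.- n))) ⟩
        f * t ^ᶻ (ℤ.- n ℤ.+ ℤ.- 1ℤ)          ≈⟨ *-congˡ (^ᶻ-+ t≉0 (ℤ.- n) (ℤ.- 1ℤ)) ⟩
        f * (t ^ᶻ (ℤ.- n) * (inv t * 1#))    ≈⟨ trans (sym (*-assoc _ _ _)) (*-congˡ (*-identityʳ _)) ⟩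
        (f * t ^ᶻ (ℤ.- n)) * inv t           ∎

      to-is : ∀ n {f} → Ord n f → f is n
      to-is n {f} (p , ¬q) = ∉M⇒unit (to≥ n p)
        (λ ∈M → ¬q (from≥ (1ℤ ℤ.+ n) (O-resp (sym (succ n f)) (/t t∈M t≉0 generates ∈M))))

      from-is : ∀ n {f} → f is n → Ord n f
      from-is n {f} (w≉0 , w∈ , i∈) = from≥ n w∈ , λ q → t⁻¹∉O t∈M t≉0 generates
        (O-resp (begin
          inv w * (f * t ^ᶻ (ℤ.- (1ℤ ℤ.+ n)))    ≈⟨ *-congˡ (succ n f) ⟩
          inv w * (w * inv t)
            ≈⟨ solve 3 (λ i w j → i :* (w :* j) := (j :* w) :* i) refl (inv w) w (inv t) ⟩
          (inv t * w) * inv w                    ≈⟨ */-cancel w≉0 ⟩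
          inv t                                  ∎) (O-* i∈ (to≥ (1ℤ ℤ.+ n) q)))
        where
        w : Carrier
        w = f * t ^ᶻ (ℤ.- n)

      is-* : ∀ m n {f g} → f is m → g is n → f * g is (m ℤ.+ n)
      is-* m n {f} {g} p q = unit-resp (begin
        (f * t ^ᶻ (ℤ.- m)) * (g * t ^ᶻ (ℤ.- n))
          ≈⟨ solve 4 (λ f a g b → (f :* a) :* (g :* b) := (f :* g) :* (a :* b))
            refl f (t ^ᶻ (ℤ.- m)) g (t ^ᶻ (ℤ.- n)) ⟩
        (f * g) * (t ^ᶻ (ℤ.- m) * t ^ᶻ (ℤ.- n))   ≈⟨ *-congˡ (sym (^ᶻ-+ t≉0 (ℤ.- m) (ℤ.- n))) ⟩
        (f * g) * t ^ᶻ (ℤ.- m ℤ.+ ℤ.- n)          ≡⟨ ≡.cong (λ k → (f * g) * t ^ᶻ k)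
          (≡.sym (ℤₚ.neg-distrib-+ m n)) ⟩
        (f * g) * t ^ᶻ (ℤ.- (m ℤ.+ n))            ∎) (unit-* p q)

      is-inv : ∀ n {f} → f is n → inv f is (ℤ.- n)
      is-inv n {f} p = unit-resp (begin
        inv (f * t ^ᶻ (ℤ.- n))            ≈⟨ inv-* (≉0-factorˡ (proj₁ p)) (^ᶻ-≉0 t≉0 (ℤ.- n)) ⟩
        inv f * inv (t ^ᶻ (ℤ.- n))        ≈⟨ *-congˡ (sym (^ᶻ-neg t≉0 (ℤ.- n))) ⟩
        inv f * t ^ᶻ (ℤ.- (ℤ.- n))        ∎) (unit-inv p)

      is-O : ∀ {f} → O f → f ≉0 → ∃[ n ] f is (+ n)
      is-O {f} f∈ f≉0 =
        let (n , u) = leading-unit t∈M t≉0 generates f∈ (λ f∈⋂ → f≉0 (⋂≈0 f f∈⋂))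
        in n , unit-resp (*-congˡ (trans (sym (inv-^ t≉0 n)) (sym (^ᶻ-neg t≉0 (+ n))))) u

    -- b is a unit times tⁿ and t divides a, so b divides aⁿ.
    power-divisible : ∀ {a b} → M a → O b → b ≉0 → ∃[ n ] O (a ^ n * inv b)
    power-divisible {a} {b} a∈ b∈ b≉0 =
      let (n , u) = leading-unit t∈M t≉0 generates b∈ (λ b∈⋂ → b≉0 (⋂≈0 b b∈⋂))
          (a′ , a′∈ , e) = generates a a∈
          b′ = b * inv t ^ n
          (b′≉0 , _ , i∈) = u
      in n , O-resp (begin
           a′ ^ n * inv b′                              ≈⟨ *-congˡ (inv-* b≉0 (≉0-factorʳ b′≉0)) ⟩
           a′ ^ n * (inv b * inv (inv t ^ n))
             ≈⟨ *-congˡ (*-congˡ (trans (inv-cong (sym (inv-^ t≉0 n))) (inv-inv (^-≉0 t≉0 n)))) ⟩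
           a′ ^ n * (inv b * t ^ n)
             ≈⟨ solve 3 (λ a b t → a :* (b :* t) := (a :* t) :* b) refl (a′ ^ n) (inv b) (t ^ n) ⟩
           (a′ ^ n * t ^ n) * inv b
             ≈⟨ *-congʳ (trans (sym (^-distrib-* a′ t n)) (^-congˡ n (sym e))) ⟩
           a ^ n * inv b                                ∎) (O-* (power∈O n a′∈) i∈)
      where
      power∈O : ∀ n {x} → O x → O (x ^ n)
      power∈O zero    x∈ = O-1
      power∈O (suc n) x∈ = O-* x∈ (power∈O n x∈)

    t^-ord : ∀ n → Ord n (t ^ᶻ n)
    t^-ord n = from-is n (unit-resp (begin
      1#                          ≡⟨ ≡.cong (t ^ᶻ_) (≡.sym (ℤₚ.+-inverseʳ n)) ⟩
      t ^ᶻ (n ℤ.+ ℤ.- n)          ≈⟨ ^ᶻ-+ t≉0 n (ℤ.- n) ⟩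
      t ^ᶻ n * t ^ᶻ (ℤ.- n)       ∎) unit-1)

    ord-resp : ∀ {n f g} → f ≈ g → Ord n f → Ord n g
    ord-resp {n} e p = from-is n (unit-resp (*-congʳ e) (to-is n p))

    ord-≉0 : ∀ {n f} → Ord n f → f ≉0
    ord-≉0 {n} p = ≉0-factorˡ (proj₁ (to-is n p))

    ord-exists : ∀ {f} → f ≉0 → ∃[ n ] Ord n f
    ord-exists {f} f≉0 =
      let (a , b , a∈ , b∈ , b≉0 , e) = fractions f
          (m , p) = is-O a∈ (≉0-resp e (*-≉0 f≉0 b≉0))
          (n , q) = is-O b∈ b≉0
          k = + m ℤ.+ ℤ.- (+ n)
      in k , from-is k (unit-resp (*-congʳ (trans (*-congʳ (sym e)) (*/-cancel b≉0)))
                 (is-* (+ m) (ℤ.- (+ n)) p (is-inv (+ n) q)))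

    ord-* : ∀ {m n f g} → Ord m f → Ord n g → Ord (m ℤ.+ n) (f * g)
    ord-* {m} {n} p q = from-is (m ℤ.+ n) (is-* m n (to-is m p) (to-is n q))

    ord-inv : ∀ {n f} → Ord n f → Ord (ℤ.- n) (inv f)
    ord-inv {n} p = from-is (ℤ.- n) (is-inv n (to-is n p))

    ord-unit : ∀ {f} → Unit f → Ord 0ℤ f
    ord-unit {f} u = from-is 0ℤ (unit-resp (sym (*-identityʳ f)) u)

    unit-ord : ∀ {f} → Ord 0ℤ f → Unit f
    unit-ord {f} p = unit-resp (*-identityʳ f) (to-is 0ℤ p)

    -- With its converse `O⇒Ord≥`, this lets any function of order n stand in for tⁿ, so that stalks
    -- of `𝓛 D` are handled through quotients by local equations.
    Ord≥⇒O : ∀ {n f g} → Ord n g → Ord≥ n f → O (f * inv g)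
    Ord≥⇒O {n} {f} {g} p q =
      let (w≉0 , w∈ , i∈) = to-is n p
          tⁿ = t ^ᶻ (ℤ.- n)
      in O-resp (begin
        (f * tⁿ) * inv (g * tⁿ)         ≈⟨ *-congˡ (inv-* (≉0-factorˡ w≉0) (≉0-factorʳ w≉0)) ⟩
        (f * tⁿ) * (inv g * inv tⁿ)
          ≈⟨ solve 4 (λ f a g b → (f :* a) :* (g :* b) := ((f :* g) :* a) :* b) refl f tⁿ (inv g) (inv tⁿ) ⟩
        ((f * inv g) * tⁿ) * inv tⁿ     ≈⟨ */-cancel (≉0-factorʳ w≉0) ⟩
        f * inv g                       ∎) (O-* (to≥ n q) i∈)

    O⇒Ord≥ : ∀ {n f g} → Ord n g → O (f * inv g) → Ord≥ n f
    O⇒Ord≥ {n} {f} {g} p q =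
      let (w≉0 , w∈ , _) = to-is n p
          tⁿ = t ^ᶻ (ℤ.- n)
      in from≥ n (O-resp (begin
        (f * inv g) * (g * tⁿ)     ≈⟨ sym (*-assoc _ _ _) ⟩
        ((f * inv g) * g) * tⁿ     ≈⟨ *-congʳ (/-cancel (≉0-factorˡ w≉0)) ⟩
        f * tⁿ                     ∎) (O-* q w∈))

    private
      t^∉unit : ∀ n → ¬ Unit (t ^ suc n)
      t^∉unit n u = unit⇒∉M u (M-resp (*-comm _ _) (M-* (t^∈O n) t∈M))
        where
        t^∈O : ∀ n → O (t ^ n)
        t^∈O zero    = O-1
        t^∈O (suc n) = O-* (M⊆O t∈M) (t^∈O n)

      1-ord : ∀ k → Ord k 1# → k ≡ 0ℤ
      1-ord k p = cases k (unit-resp (*-identityˡ _) (to-is k p))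
        where
        cases : ∀ k → Unit (t ^ᶻ (ℤ.- k)) → k ≡ 0ℤ
        cases (+ zero)   _ = ≡.refl
        cases (+ suc n)  u = ⊥-elim (t^∉unit n (unit-resp
          (trans (inv-cong (sym (inv-^ t≉0 (suc n)))) (inv-inv (^-≉0 t≉0 (suc n)))) (unit-inv u)))
        cases (-[1+ n ]) u = ⊥-elim (t^∉unit n u)

    ord-unique : ∀ {m n f} → Ord m f → Ord n f → m ≡ n
    ord-unique {m} {n} p q = ℤₚ.i-j≡0⇒i≡j m n
      (1-ord (m ℤ.- n) (ord-resp (inv-inverse (ord-≉0 p)) (ord-* p (ord-inv q))))

-- Generic and closed points, and uniformizers obtained from smoothness.

module Points (em : ∀ {ℓ} → ExcludedMiddle ℓ) {k : Ring₀} (isField : IsField k) (X : SmoothProjectiveCurve k)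
  where
  open Curve X
  open CommutativeRing S.ring hiding (zero)

  η≤ : ∀ P → η ≤ P
  η≤ P x≈0 = Point.ideal-resp P (sym x≈0) (Point.ideal-0 P)

  no-chain : ∀ P Q R → P < Q → ¬ Q < R
  no-chain P Q R P<Q Q<R = proj₂ dimension-1 R (_▷_ {Q} {R} (_▷_ {P} {Q} (stop {P}) P<Q) Q<R)

  -- A point that is both generic and closed would be equivalent to every other one, against the
  -- chain of length 1.
  closed⇒≰η : ∀ P → IsClosedPoint P → ¬ P ≤ η
  closed⇒≰η P closed P≤η with proj₁ dimension-1
  ... | P₁ , (_▷_ {Q} _ (Q≤P₁ , P₁≰Q)) =
    P₁≰Q (λ x∈ → η≤ Q (P≤η (closed P₁ (λ y∈ → η≤ P₁ (P≤η y∈)) x∈)))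

  -- Otherwise `η < P < Q` would be a chain of length 2. Hence every point is generic or closed.
  ≰η⇒closed : ∀ P → ¬ P ≤ η → IsClosedPoint P
  ≰η⇒closed P P≰η Q P≤Q = decidable-stable em (λ Q≰P → no-chain η P Q (η≤ P , P≰η) ((λ {x} → P≤Q {x}) , Q≰P))

  private
    kExt : FieldExtension k
    kExt = record { ring = k ; isField = isField ; embed = id
                  ; isRingHomomorphism = Identity.isRingHomomorphism _ (CommutativeRing.refl k) }

    open BaseChange coordinateRing kExt using (Term; fromS; fromL; _⊞_; _⊠_; ⊟_; PartL)
    module B = BaseChange coordinateRing kExt
    module BR = CommutativeRing B.ring
    module PB = Proj B.grading
    module ι = IsRingHomomorphism S.isRingHomomorphism
    open MonoidSum +-monoid using (sum)
    open MonoidSum BR.+-monoid using () renaming (sum to sumᵇ; sum-cong-≋ to sumᵇ-cong)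

    -- The isomorphism from S ⊗ₖ k to S, inverse to `fromS`. Smoothness, applied to the extension k
    -- of k, is carried over to X along it.
    ev : Term → Carrier
    ev (fromS s) = s
    ev (fromL a) = S.ι a
    ev (s ⊞ t)   = ev s + ev t
    ev (s ⊠ t)   = ev s * ev t
    ev (⊟ s)     = - ev s

    ev-cong : ∀ {s t} → s B.∼ t → ev s ≈ ev t
    ev-cong B.∼-refl            = refl
    ev-cong (B.∼-sym p)         = sym (ev-cong p)
    ev-cong (B.∼-trans p q)     = trans (ev-cong p) (ev-cong q)
    ev-cong (B.⊞-cong p q)      = +-cong (ev-cong p) (ev-cong q)
    ev-cong (B.⊠-cong p q)      = *-cong (ev-cong p) (ev-cong q)
    ev-cong (B.⊟-cong p)        = -‿cong (ev-cong p)
    ev-cong (B.⊞-assoc x y z)   = +-assoc _ _ _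
    ev-cong (B.⊞-comm x y)      = +-comm _ _
    ev-cong (B.⊞-identityˡ x)   = +-identityˡ _
    ev-cong (B.⊞-inverseˡ x)    = -‿inverseˡ _
    ev-cong (B.⊠-assoc x y z)   = *-assoc _ _ _
    ev-cong (B.⊠-comm x y)      = *-comm _ _
    ev-cong (B.⊠-identityˡ x)   = *-identityˡ _
    ev-cong (B.⊠-distribˡ x y z) = distribˡ _ _ _
    ev-cong (B.fromS-cong e)    = e
    ev-cong (B.fromS-+ s t)     = refl
    ev-cong (B.fromS-* s t)     = refl
    ev-cong (B.fromL-cong e)    = ι.⟦⟧-cong e
    ev-cong (B.fromL-+ a b)     = ι.+-homo a b
    ev-cong (B.fromL-* a b)     = ι.*-homo a b
    ev-cong (B.from-k a)        = refl

    fromS-neg : ∀ s → fromS (- s) B.∼ ⊟ fromS s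
    fromS-neg s = +-inverseˡ-unique (fromS (- s)) (fromS s)
      (BR.trans (BR.sym (B.fromS-+ (- s) s)) (B.fromS-cong (-‿inverseˡ s)))
      where open RingProperties BR.ring using (+-inverseˡ-unique)

    ev-section : ∀ s → s B.∼ fromS (ev s)
    ev-section (fromS s) = B.∼-refl
    ev-section (fromL a) = B.∼-sym (B.from-k a)
    ev-section (s ⊞ t)   = B.∼-trans (B.⊞-cong (ev-section s) (ev-section t)) (B.∼-sym (B.fromS-+ _ _))
    ev-section (s ⊠ t)   = B.∼-trans (B.⊠-cong (ev-section s) (ev-section t)) (B.∼-sym (B.fromS-* _ _))
    ev-section (⊟ s)     = B.∼-trans (B.⊟-cong (ev-section s)) (B.∼-sym (fromS-neg _))

    ev-part : ∀ {d s} → PartL d s → S.Part d (ev s)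
    ev-part (B.part-resp e p) = S.resp (ev-cong e) (ev-part p)
    ev-part (B.part-S p)      = p
    ev-part (B.part-L a)      = S.ι-degree a
    ev-part (B.part-⊞ p q)    = S.+-closed (ev-part p) (ev-part q)
    ev-part (B.part-⊟ p)      = S.neg-closed (ev-part p)
    ev-part (B.part-⊠ p q)    = S.*-closed (ev-part p) (ev-part q)

    ev-sum : ∀ n (c : Fin n → Term) → ev (sumᵇ c) ≈ sum (ev ∘ c)
    ev-sum zero    c = refl
    ev-sum (suc n) c = +-congˡ (ev-sum n (c ∘ Fin.suc))

    push : Point → PB.Point
    push P = record
      { ideal       = λ s → P.ideal (ev s)
      ; ideal-resp  = λ e → P.ideal-resp (ev-cong e)
      ; ideal-0     = P.ideal-0
      ; ideal-+     = P.ideal-+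
      ; ideal-*     = λ s → P.ideal-* (ev s)
      ; homogeneous = λ {s} s∈ → let (n , c , c∈ , e) = P.homogeneous s∈ in
          n , fromS ∘ c , (λ i → B.part-S (proj₁ (c∈ i)) , proj₂ (c∈ i)) ,
          B.∼-trans (ev-section s) (B.∼-trans (B.fromS-cong e) (fromS-sum n c))
      ; prime       = P.prime
      ; relevant    = let (d , s , s∈ , s∉) = P.relevant in d , fromS s , B.part-S s∈ , s∉
      }
      where
      module P = Point P
      fromS-sum : ∀ n (c : Fin n → Carrier) → fromS (sum c) B.∼ sumᵇ (fromS ∘ c)
      fromS-sum zero    c = B.∼-refl
      fromS-sum (suc n) c = B.∼-trans (B.fromS-+ _ _) (B.⊞-cong B.∼-refl (fromS-sum n (c ∘ Fin.suc)))

    pull : PB.Point → Point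
    pull Q = record
      { ideal       = λ s → Q.ideal (fromS s)
      ; ideal-resp  = λ e → Q.ideal-resp (B.fromS-cong e)
      ; ideal-0     = Q.ideal-0
      ; ideal-+     = λ s∈ t∈ → Q.ideal-resp (B.∼-sym (B.fromS-+ _ _)) (Q.ideal-+ s∈ t∈)
      ; ideal-*     = λ s t∈ → Q.ideal-resp (B.∼-sym (B.fromS-* _ _)) (Q.ideal-* (fromS s) t∈)
      ; homogeneous = λ s∈ → let (n , c , c∈ , e) = Q.homogeneous s∈ in
          n , ev ∘ c , (λ i → ev-part (proj₁ (c∈ i)) , Q.ideal-resp (ev-section (c i)) (proj₂ (c∈ i))) ,
          trans (ev-cong e) (ev-sum n c)
      ; prime       = λ st∈ → Q.prime (Q.ideal-resp (B.fromS-* _ _) st∈)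
      ; relevant    = let (d , s , s∈ , s∉) = Q.relevant in
          d , ev s , ev-part s∈ , λ s∈Q → s∉ (Q.ideal-resp (B.∼-sym (ev-section s)) s∈Q)
      }
      where module Q = PB.Point Q

    pull-< : ∀ Q Q′ → Q PB.< Q′ → pull Q < pull Q′
    pull-< Q Q′ (Q≤Q′ , Q′≰Q) = (λ x∈ → Q≤Q′ x∈) , λ p → Q′≰Q (λ {s} s∈ →
      PB.Point.ideal-resp Q (B.∼-sym (ev-section s)) (p (PB.Point.ideal-resp Q′ (ev-section s) s∈)))

  module _ {P : Point} (closed : IsClosedPoint P) where
    private
      evᶠ : PB.Fraction (push P) → Fraction P
      evᶠ (PB.fraction a b a∈ b∈ b∉) = fraction (ev a) (ev b) (ev-part a∈) (ev-part b∈) b∉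

      fromSᶠ : Fraction P → PB.Fraction (push P)
      fromSᶠ (fraction a b a∈ b∈ b∉) = PB.fraction (fromS a) (fromS b) (B.part-S a∈) (B.part-S b∈) b∉

    -- The local dimension at a closed point is 1: it is not 0 because of `η < P`, and a larger one
    -- would give a chain of length 2 on X. So regularity supplies exactly one generator.
    uniformizer : Σ[ t ∈ Fraction P ] InMaximalIdeal P t ×
                  (∀ x → InMaximalIdeal P x → ∃[ c ] toK P x K.≈ toK P c K.* toK P t)
    uniformizer with smooth kExt (push P)
    ... | zero , (_ , ¬chain) , _ =
      ⊥-elim (¬chain (PB._▷_ {push η} (PB.stop {push η}) ((λ x≈0 → η≤ P x≈0) , λ P≤η → closed⇒≰η P closed
        (λ {s} s∈ → P≤η {fromS s} s∈))))
    ... | suc (suc n) , (PB._▷_ {Q′} (PB._▷_ {Q} _ Q<Q′) Q′<P , _) , _ =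
      ⊥-elim (no-chain (pull Q) (pull Q′) P (pull-< Q Q′ Q<Q′) (pull-< Q′ (push P) Q′<P))
    ... | suc zero , _ , t , t∈ , gen = evᶠ (t Fin.zero) , t∈ Fin.zero , λ x x∈ →
      let (c , d , u , u∈ , u∉ , e) = gen (fromSᶠ x) x∈
          c₀ = evᶠ (c Fin.zero)
          t₀ = evᶠ (t Fin.zero)
          module 𝒪 = CommutativeRing (stalk P)
          (d′ , v , v∈ , v∉ , e′) = 𝒪.trans {x} {c₀ 𝒪.* t₀ 𝒪.+ 𝒪.0#} {c₀ 𝒪.* t₀}
            (d , ev u , ev-part u∈ , u∉ , ev-cong e) (𝒪.+-identityʳ (c₀ 𝒪.* t₀))
      in c₀ , d′ , v , v∈ , (λ v≈0 → v∉ (η≤ P v≈0)) , e′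

-- Homomorphisms, direct sums and tensor products of sheaves of modules.

module _ {r ℓr m₁ ℓm₁ m₂ ℓm₂} {R : CommutativeRing r ℓr} (M : Module R m₁ ℓm₁) (N : Module R m₂ ℓm₂) where
  private
    module M = Module M
    module N = Module N

  linear-from : (f : M.Carrierᴹ → N.Carrierᴹ) → (∀ {s t} → s M.≈ᴹ t → f s N.≈ᴹ f t) →
                (∀ s t → f (s M.+ᴹ t) N.≈ᴹ f s N.+ᴹ f t) → (∀ a s → f (a M.*ₗ s) N.≈ᴹ a N.*ₗ f s) →
                IsModuleHomomorphism M.rawModule N.rawModule f
  linear-from f f-cong f-+ f-* = record
    { isBimoduleHomomorphism = record
      { +ᴹ-isGroupHomomorphism = record
        { isMonoidHomomorphism = record
          { isMagmaHomomorphism = record { isRelHomomorphism = record { cong = f-cong } ; homo = f-+ }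
          ; ε-homo = f-0
          }
        ; ⁻¹-homo = λ s → inverseˡ-unique (f (M.-ᴹ s)) (f s)
            (N.≈ᴹ-trans (N.≈ᴹ-sym (f-+ _ _)) (N.≈ᴹ-trans (f-cong (M.-ᴹ‿inverseˡ s)) f-0))
        }
      ; *ₗ-homo = f-*
      ; *ᵣ-homo = λ a s → N.≈ᴹ-trans (f-cong (M.≈ᴹ-sym (M.*ₗ-*ᵣ-coincident a s)))
                    (N.≈ᴹ-trans (f-* a s) (N.*ₗ-*ᵣ-coincident a (f s)))
      }
    }
    where
    open GroupProperties N.+ᴹ-group using (inverseˡ-unique)
    f-0 : f M.0ᴹ N.≈ᴹ N.0ᴹ
    f-0 = N.≈ᴹ-trans (f-cong (M.≈ᴹ-sym (M.*ₗ-zeroˡ M.0ᴹ))) (N.≈ᴹ-trans (f-* _ _) (N.*ₗ-zeroˡ (f M.0ᴹ)))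

module CurveTheory (em : ∀ {ℓ} → ExcludedMiddle ℓ) {k : Ring₀} (isField : IsField k)
  (X : SmoothProjectiveCurve k) where
  open Curve X

  ⊆-refl : ∀ {U} → U ⊆ U
  ⊆-refl = inclusion id

  ⊆-trans : ∀ {U V W} → W ⊆ V → V ⊆ U → W ⊆ U
  ⊆-trans i j = inclusion (λ p → ⊆-elim j (⊆-elim i p))

  ∩-⊆ˡ : ∀ {U V} → U ∩ V ⊆ U
  ∩-⊆ˡ = inclusion proj₁

  ∩-⊆ʳ : ∀ {U V} → U ∩ V ⊆ V
  ∩-⊆ʳ = inclusion proj₂

  module HomProperties {M N : 𝒪-Module} (h : Hom M N) (U : Open) =
    IsModuleHomomorphism (Hom.linear h U)
  module BilinearˡProperties {M L N : 𝒪-Module} (τ : Bilinear M L N) (U : Open) (l : 𝒪-Module.Γ.Carrierᴹ L U) =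
    IsModuleHomomorphism (Bilinear.linearˡ τ U l)
  module BilinearʳProperties {M L N : 𝒪-Module} (τ : Bilinear M L N) (U : Open) (m : 𝒪-Module.Γ.Carrierᴹ M U) =
    IsModuleHomomorphism (Bilinear.linearʳ τ U m)

  hom-id : ∀ M → Hom M M
  hom-id M = record
    { map     = λ _ → id
    ; linear  = λ U → linear-from (Γ U) (Γ U) id id (λ _ _ → ≈ᴹ-refl U) (λ _ _ → ≈ᴹ-refl U)
    ; natural = λ {_} {V} _ _ → ≈ᴹ-refl V
    }
    where
    open 𝒪-Module M
    open Γ using (≈ᴹ-refl)

  _∘ʰ_ : ∀ {M N P} → Hom N P → Hom M N → Hom M P
  _∘ʰ_ {M} {N} {P} g f = record
    { map     = λ U → g.map U ∘ f.map U
    ; linear  = λ U → linear-from (M.Γ U) (P.Γ U) _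
        (λ e → G.⟦⟧-cong U (F.⟦⟧-cong U e))
        (λ s t → P.Γ.≈ᴹ-trans U (G.⟦⟧-cong U (F.+ᴹ-homo U s t)) (G.+ᴹ-homo U _ _))
        (λ a s → P.Γ.≈ᴹ-trans U (G.⟦⟧-cong U (F.*ₗ-homo U a s)) (G.*ₗ-homo U a _))
    ; natural = λ {U} {V} i s → P.Γ.≈ᴹ-trans V (g.natural i _) (G.⟦⟧-cong V (f.natural i s))
    }
    where
    module M = 𝒪-Module M
    module P = 𝒪-Module P
    module f = Hom f
    module g = Hom g
    module F = HomProperties f
    module G = HomProperties g

  ≅-refl : ∀ {M} → M ≅ M
  ≅-refl {M} = record
    { to = hom-id M ; from = hom-id M ; from-to = λ U _ → ≈ᴹ-refl U ; to-from = λ U _ → ≈ᴹ-refl U }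
    where open 𝒪-Module.Γ M using (≈ᴹ-refl)

  ≅-sym : ∀ {M N} → M ≅ N → N ≅ M
  ≅-sym f = record { to = f.from ; from = f.to ; from-to = f.to-from ; to-from = f.from-to }
    where module f = _≅_ f

  ≅-trans : ∀ {M N P} → M ≅ N → N ≅ P → M ≅ P
  ≅-trans {M} {N} {P} f g = record
    { to      = g.to ∘ʰ f.to
    ; from    = f.from ∘ʰ g.from
    ; from-to = λ U s → 𝒪-Module.Γ.≈ᴹ-trans M U (HomProperties.⟦⟧-cong f.from U (g.from-to U _)) (f.from-to U s)
    ; to-from = λ U s → 𝒪-Module.Γ.≈ᴹ-trans P U (HomProperties.⟦⟧-cong g.to U (f.to-from U _)) (g.to-from U s)
    }
    where
    module f = _≅_ f
    module g = _≅_ g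

  hom-⊕ : ∀ {M M′ N N′} → Hom M N → Hom M′ N′ → Hom (M ⊕ M′) (N ⊕ N′)
  hom-⊕ {M} {M′} {N} {N′} f g = record
    { map     = λ U (s , t) → Hom.map f U s , Hom.map g U t
    ; linear  = λ U → linear-from (𝒪-Module.Γ (M ⊕ M′) U) (𝒪-Module.Γ (N ⊕ N′) U) _
        (λ (p , q) → F.⟦⟧-cong U p , G.⟦⟧-cong U q)
        (λ _ _ → F.+ᴹ-homo U _ _ , G.+ᴹ-homo U _ _)
        (λ a _ → F.*ₗ-homo U a _ , G.*ₗ-homo U a _)
    ; natural = λ i (s , t) → Hom.natural f i s , Hom.natural g i t
    }
    where
    module F = HomProperties f
    module G = HomProperties g

  ≅-⊕ : ∀ {M M′ N N′} → M ≅ N → M′ ≅ N′ → M ⊕ M′ ≅ N ⊕ N′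
  ≅-⊕ f g = record
    { to = hom-⊕ f.to g.to ; from = hom-⊕ f.from g.from
    ; from-to = λ U (s , t) → f.from-to U s , g.from-to U t
    ; to-from = λ U (s , t) → f.to-from U s , g.to-from U t
    }
    where
    module f = _≅_ f
    module g = _≅_ g

  hom-swap : ∀ M N → Hom (M ⊕ N) (N ⊕ M)
  hom-swap M N = record
    { map     = λ _ (s , t) → t , s
    ; linear  = λ U → linear-from (𝒪-Module.Γ (M ⊕ N) U) (𝒪-Module.Γ (N ⊕ M) U) _ (λ (p , q) → q , p)
        (λ _ _ → N.Γ.≈ᴹ-refl U , M.Γ.≈ᴹ-refl U) (λ _ _ → N.Γ.≈ᴹ-refl U , M.Γ.≈ᴹ-refl U)
    ; natural = λ {_} {V} _ _ → N.Γ.≈ᴹ-refl V , M.Γ.≈ᴹ-refl V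
    }
    where
    module M = 𝒪-Module M
    module N = 𝒪-Module N

  ⊕-swap : ∀ M N → M ⊕ N ≅ N ⊕ M
  ⊕-swap M N = record
    { to = hom-swap M N ; from = hom-swap N M
    ; from-to = λ U _ → M.Γ.≈ᴹ-refl U , N.Γ.≈ᴹ-refl U
    ; to-from = λ U _ → N.Γ.≈ᴹ-refl U , M.Γ.≈ᴹ-refl U
    }
    where
    module M = 𝒪-Module M
    module N = 𝒪-Module N

  bilinear-∘ : ∀ {M L L′ N N′} → Hom N N′ → Bilinear M L N → Hom L′ L → Bilinear M L′ N′
  bilinear-∘ {M} {L} {L′} {N} {N′} h τ g = record
    { map     = λ U m l → h.map U (τ.map U m (g.map U l))
    ; linearˡ = λ U l → linear-from (M.Γ U) (N′.Γ U) _
        (λ e → H.⟦⟧-cong U (Tˡ.⟦⟧-cong U _ e))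
        (λ s t → N′.Γ.≈ᴹ-trans U (H.⟦⟧-cong U (Tˡ.+ᴹ-homo U _ s t)) (H.+ᴹ-homo U _ _))
        (λ a s → N′.Γ.≈ᴹ-trans U (H.⟦⟧-cong U (Tˡ.*ₗ-homo U _ a s)) (H.*ₗ-homo U a _))
    ; linearʳ = λ U m → linear-from (L′.Γ U) (N′.Γ U) _
        (λ e → H.⟦⟧-cong U (Tʳ.⟦⟧-cong U m (G.⟦⟧-cong U e)))
        (λ s t → N′.Γ.≈ᴹ-trans U (H.⟦⟧-cong U (N.Γ.≈ᴹ-trans U (Tʳ.⟦⟧-cong U m (G.+ᴹ-homo U s t))
          (Tʳ.+ᴹ-homo U m _ _))) (H.+ᴹ-homo U _ _))
        (λ a s → N′.Γ.≈ᴹ-trans U (H.⟦⟧-cong U (N.Γ.≈ᴹ-trans U (Tʳ.⟦⟧-cong U m (G.*ₗ-homo U a s))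
          (Tʳ.*ₗ-homo U m a _))) (H.*ₗ-homo U a _))
    ; natural = λ {U} {V} i m l → N′.Γ.≈ᴹ-trans V (h.natural i _)
        (H.⟦⟧-cong V (N.Γ.≈ᴹ-trans V (τ.natural i m _) (Tʳ.⟦⟧-cong V _ (g.natural i l))))
    }
    where
    module M = 𝒪-Module M
    module L′ = 𝒪-Module L′
    module N = 𝒪-Module N
    module N′ = 𝒪-Module N′
    module h = Hom h
    module g = Hom g
    module τ = Bilinear τ
    module H = HomProperties h
    module G = HomProperties g
    module Tˡ = BilinearˡProperties τ
    module Tʳ = BilinearʳProperties τ

  tensor-resp : ∀ {M L L′ N N′} → L ≅ L′ → N ≅ N′ → IsTensorProduct M L N → IsTensorProduct M L′ N′
  tensor-resp {M} {L} {L′} {N} {N′} f g T = record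
    { tensor = bilinear-∘ g.to tensor f.from
    ; factor = λ P β →
        let (h , p) = factor P (bilinear-∘ (hom-id P) β f.to)
            module P = 𝒪-Module P
        in h ∘ʰ g.from , λ U m l → P.Γ.≈ᴹ-trans U (HomProperties.⟦⟧-cong h U (g.from-to U _))
             (P.Γ.≈ᴹ-trans U (p U m _) (BilinearʳProperties.⟦⟧-cong β U m (f.to-from U l)))
    ; unique = λ P β h h′ p p′ U n →
        let module P = 𝒪-Module P
            q = λ (h : Hom N′ P)
                  (p : ∀ U m l → P.Γ._≈ᴹ_ U
                         (Hom.map h U (Bilinear.map (bilinear-∘ g.to tensor f.from) U m l)) (Bilinear.map β U m l))
                  U m l →
                  P.Γ.≈ᴹ-trans U (HomProperties.⟦⟧-cong h U (HomProperties.⟦⟧-cong g.to U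
                    (BilinearʳProperties.⟦⟧-cong tensor U m (𝒪-Module.Γ.≈ᴹ-sym L U (f.from-to U l)))))
                      (p U m (f′.map U l))
        in P.Γ.≈ᴹ-trans U (HomProperties.⟦⟧-cong h U (𝒪-Module.Γ.≈ᴹ-sym N′ U (g.to-from U n)))
             (P.Γ.≈ᴹ-trans U
               (unique P (bilinear-∘ (hom-id P) β f.to) (h ∘ʰ g.to) (h′ ∘ʰ g.to) (q h p) (q h′ p′) U
                 (Hom.map g.from U n))
               (HomProperties.⟦⟧-cong h′ U (g.to-from U n)))
    }
    where
    open IsTensorProduct T
    module f = _≅_ f
    module g = _≅_ g
    module f′ = Hom f.to

  tensor-unique : ∀ {M L N N′} → IsTensorProduct M L N → IsTensorProduct M L N′ → N ≅ N′
  tensor-unique {M} {L} {N} {N′} T₁ T₂ = record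
    { to      = f
    ; from    = g
    ; from-to = λ U n → T₁.unique N T₁.tensor (g ∘ʰ f) (hom-id N)
        (λ U m l → N.Γ.≈ᴹ-trans U (HomProperties.⟦⟧-cong g U (p U m l)) (q U m l)) (λ U m l → N.Γ.≈ᴹ-refl U) U n
    ; to-from = λ U n → T₂.unique N′ T₂.tensor (f ∘ʰ g) (hom-id N′)
        (λ U m l → N′.Γ.≈ᴹ-trans U (HomProperties.⟦⟧-cong f U (q U m l)) (p U m l))
          (λ U m l → N′.Γ.≈ᴹ-refl U) U n
    }
    where
    module T₁ = IsTensorProduct T₁
    module T₂ = IsTensorProduct T₂
    module N = 𝒪-Module N
    module N′ = 𝒪-Module N′
    f = proj₁ (T₁.factor N′ T₂.tensor)
    p = proj₂ (T₁.factor N′ T₂.tensor)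
    g = proj₁ (T₂.factor N T₁.tensor)
    q = proj₂ (T₂.factor N T₁.tensor)

  -- Recognising tensor products on local trivialisations.

  module Pieces (U : Point → Open) (P∈U : ∀ P → P ∈ U P) where
    Piece : Open → Set₁
    Piece V = Σ[ P ∈ Point ] P ∈ V

    piece : ∀ V → Piece V → Open
    piece V (P , _) = V ∩ U P

    piece⊆ : ∀ V (j : Piece V) → piece V j ⊆ V
    piece⊆ V (P , _) = ∩-⊆ˡ {V} {U P}

    piece⊆U : ∀ V (j : Piece V) → piece V j ⊆ U (proj₁ j)
    piece⊆U V (P , _) = ∩-⊆ʳ {V} {U P}

    covers : ∀ V P → P ∈ V → Σ[ j ∈ Piece V ] P ∈ piece V j
    covers V P PV = (P , PV) , PV , P∈U P

    module _ (M : 𝒪-Module) where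
      open 𝒪-Module M

      locally : ∀ {V} s t → (∀ (j : Piece V) → Γ._≈ᴹ_ (piece V j) (s ∣ piece⊆ V j) (t ∣ piece⊆ V j)) →
                Γ._≈ᴹ_ V s t
      locally {V} = separated (piece V) (piece⊆ V) (covers V)

  -- A bilinear map β factors through τ as, locally, τ (m , e) ↦ β (m , e).
  module TensorCriterion {M L N : 𝒪-Module} (τ : Bilinear M L N)
      (U : Point → Open) (P∈U : ∀ P → P ∈ U P) (e : ∀ P → 𝒪-Module.Γ.Carrierᴹ L (U P)) where
    private
      module M = 𝒪-Module M
      module L = 𝒪-Module L
      module N = 𝒪-Module N
      module τ = Bilinear τ

    module _
      (spans : ∀ P {V} (i : V ⊆ U P) l → ∃[ a ] L.Γ._≈ᴹ_ V l (L.Γ._*ₗ_ V a (e P L.∣ i)))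
      (injective : ∀ P {V} (i : V ⊆ U P) m m′ →
        N.Γ._≈ᴹ_ V (τ.map V m (e P L.∣ i)) (τ.map V m′ (e P L.∣ i)) → M.Γ._≈ᴹ_ V m m′)
      (surjective : ∀ P {V} (i : V ⊆ U P) n → ∃[ m ] N.Γ._≈ᴹ_ V (τ.map V m (e P L.∣ i)) n) where

      open Pieces U P∈U

      module Factorisation (Q : 𝒪-Module) (β : Bilinear M L Q) where
        private
          module Q = 𝒪-Module Q
          module β = Bilinear β
          module Tˡ = BilinearˡProperties τ
          module Tʳ = BilinearʳProperties τ
          module Bˡ = BilinearˡProperties β
          module Bʳ = BilinearʳProperties β

        -- Writing l′ as a multiple of the generator, l′ = a e, moves `a` to the other side: τ (m ,
        -- e) = τ (a m′ , e) forces m = a m′, and then bilinearity of β gives the equality.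
        balanced : ∀ P {V} (i : V ⊆ U P) m m′ l′ →
                   N.Γ._≈ᴹ_ V (τ.map V m (e P L.∣ i)) (τ.map V m′ l′) →
                   Q.Γ._≈ᴹ_ V (β.map V m (e P L.∣ i)) (β.map V m′ l′)
        balanced P {V} i m m′ l′ p =
          let (a , q) = spans P i l′
              ei = e P L.∣ i
              m≈am′ : M.Γ._≈ᴹ_ V m (M.Γ._*ₗ_ V a m′)
              m≈am′ = injective P i m _ (N.Γ.≈ᴹ-trans V p (N.Γ.≈ᴹ-trans V (Tʳ.⟦⟧-cong V m′ q)
                        (N.Γ.≈ᴹ-trans V (Tʳ.*ₗ-homo V m′ a ei) (N.Γ.≈ᴹ-sym V (Tˡ.*ₗ-homo V ei a m′)))))
          in Q.Γ.≈ᴹ-trans V (Bˡ.⟦⟧-cong V ei m≈am′)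
               (Q.Γ.≈ᴹ-trans V (Bˡ.*ₗ-homo V ei a m′)
               (Q.Γ.≈ᴹ-trans V (Q.Γ.≈ᴹ-sym V (Bʳ.*ₗ-homo V m′ a ei))
                 (Bʳ.⟦⟧-cong V m′ (L.Γ.≈ᴹ-sym V q))))

        restrict : ∀ P {V W} (i : V ⊆ U P) (j : W ⊆ V) (k : W ⊆ U P) m →
                   Q.Γ._≈ᴹ_ W (β.map V m (e P L.∣ i) Q.∣ j) (β.map W (m M.∣ j) (e P L.∣ k))
        restrict P {V} {W} i j k m = Q.Γ.≈ᴹ-trans W (β.natural j m _) (Bʳ.⟦⟧-cong W _ (L.∣-∘ i j k _))

        restrictᵗ : ∀ P {V W} (i : V ⊆ U P) (j : W ⊆ V) (k : W ⊆ U P) m →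
                    N.Γ._≈ᴹ_ W (τ.map V m (e P L.∣ i) N.∣ j) (τ.map W (m M.∣ j) (e P L.∣ k))
        restrictᵗ P {V} {W} i j k m = N.Γ.≈ᴹ-trans W (τ.natural j m _) (Tʳ.⟦⟧-cong W _ (L.∣-∘ i j k _))

        module _ {V : Open} (n : N.Γ.Carrierᴹ V) where
          coefficient : ∀ (j : Piece V) → M.Γ.Carrierᴹ (piece V j)
          coefficient j = proj₁ (surjective (proj₁ j) (piece⊆U V j) (n N.∣ piece⊆ V j))

          coefficient-eq : ∀ (j : Piece V) →
            N.Γ._≈ᴹ_ (piece V j) (τ.map (piece V j) (coefficient j) (e (proj₁ j) L.∣ piece⊆U V j))
              (n N.∣ piece⊆ V j)
          coefficient-eq j = proj₂ (surjective (proj₁ j) (piece⊆U V j) (n N.∣ piece⊆ V j))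

          local-value : ∀ (j : Piece V) → Q.Γ.Carrierᴹ (piece V j)
          local-value j = β.map (piece V j) (coefficient j) (e (proj₁ j) L.∣ piece⊆U V j)

          local-unique : ∀ (j : Piece V) {W} (a : W ⊆ piece V j) (k : W ⊆ V) m l →
                         N.Γ._≈ᴹ_ W (τ.map W m l) (n N.∣ k) →
                         Q.Γ._≈ᴹ_ W (local-value j Q.∣ a) (β.map W m l)
          local-unique j {W} a k m l p = Q.Γ.≈ᴹ-trans W (restrict (proj₁ j) (piece⊆U V j) a a′ (coefficient j))
            (balanced (proj₁ j) a′ _ m l
              (N.Γ.≈ᴹ-trans W (N.Γ.≈ᴹ-sym W (restrictᵗ (proj₁ j) (piece⊆U V j) a a′ (coefficient j)))
              (N.Γ.≈ᴹ-trans W (N.∣-cong a (coefficient-eq j))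
              (N.Γ.≈ᴹ-trans W (N.∣-∘ (piece⊆ V j) a k n) (N.Γ.≈ᴹ-sym W p)))))
            where
            a′ : W ⊆ U (proj₁ j)
            a′ = ⊆-trans a (piece⊆U V j)

          agree : ∀ (j j′ : Piece V) W (a : W ⊆ piece V j) (b : W ⊆ piece V j′) →
                  Q.Γ._≈ᴹ_ W (local-value j Q.∣ a) (local-value j′ Q.∣ b)
          agree j j′ W a b = Q.Γ.≈ᴹ-trans W
            (local-unique j a (⊆-trans b (piece⊆ V j′)) _ _
              (N.Γ.≈ᴹ-trans W (N.Γ.≈ᴹ-sym W (restrictᵗ (proj₁ j′) (piece⊆U V j′) b b′ (coefficient j′)))
              (N.Γ.≈ᴹ-trans W (N.∣-cong b (coefficient-eq j′)) (N.∣-∘ (piece⊆ V j′) b _ n))))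
            (Q.Γ.≈ᴹ-sym W (restrict (proj₁ j′) (piece⊆U V j′) b b′ (coefficient j′)))
            where
            b′ : W ⊆ U (proj₁ j′)
            b′ = ⊆-trans b (piece⊆U V j′)

          value : Q.Γ.Carrierᴹ V
          value = proj₁ (Q.glue (piece V) (piece⊆ V) (covers V) local-value agree)

          value-local : ∀ (j : Piece V) → Q.Γ._≈ᴹ_ (piece V j) (value Q.∣ piece⊆ V j) (local-value j)
          value-local = proj₂ (Q.glue (piece V) (piece⊆ V) (covers V) local-value agree)

          -- This characterises `value`: wherever `n` restricts to a pure tensor τ (m , l), it
          -- restricts to β (m , l). Linearity, naturality and the factorisation are all checked
          -- with it.
          value-unique : ∀ {W} (k : W ⊆ V) m l → N.Γ._≈ᴹ_ W (τ.map W m l) (n N.∣ k) →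
                         Q.Γ._≈ᴹ_ W (value Q.∣ k) (β.map W m l)
          value-unique {W} k m l p = locally Q _ _ λ (P , PW) →
            let W′ = W ∩ U P
                j : Piece V
                j  = P , ⊆-elim k PW
                w : W′ ⊆ W
                w  = ∩-⊆ˡ {W} {U P}
                a : W′ ⊆ piece V j
                a = inclusion (λ (q , u) → ⊆-elim k q , u)
                k′ = ⊆-trans w k
            in Q.Γ.≈ᴹ-trans W′ (Q.∣-∘ k w k′ value)
               (Q.Γ.≈ᴹ-trans W′ (Q.Γ.≈ᴹ-sym W′ (Q.∣-∘ (piece⊆ V j) a k′ value))
               (Q.Γ.≈ᴹ-trans W′ (Q.∣-cong a (value-local j))
               (Q.Γ.≈ᴹ-trans W′ (local-unique j a k′ _ _
                 (N.Γ.≈ᴹ-trans W′ (N.Γ.≈ᴹ-sym W′ (τ.natural w m l))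
                 (N.Γ.≈ᴹ-trans W′ (N.∣-cong w p) (N.∣-∘ k w k′ n))))
                 (Q.Γ.≈ᴹ-sym W′ (β.natural w m l)))))

        hom : Hom N Q
        hom = record
          { map     = λ V → value {V}
          ; linear  = λ V → linear-from (N.Γ V) (Q.Γ V) value
              (λ {n} {n′} p → locally Q _ _ λ j → let W = piece V j in
                Q.Γ.≈ᴹ-trans W (value-local n j) (Q.Γ.≈ᴹ-sym W (value-unique n′ (piece⊆ V j) _ _
                  (N.Γ.≈ᴹ-trans W (coefficient-eq n j) (N.∣-cong (piece⊆ V j) p)))))
              (λ n n′ → locally Q _ _ λ j → let W = piece V j ; ej = e (proj₁ j) L.∣ piece⊆U V j in
                Q.Γ.≈ᴹ-trans W (value-unique (n N+ n′) (piece⊆ V j) _ _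
                  (N.Γ.≈ᴹ-trans W (Tˡ.+ᴹ-homo W ej _ _)
                  (N.Γ.≈ᴹ-trans W (N.Γ.+ᴹ-cong W (coefficient-eq n j) (coefficient-eq n′ j))
                    (N.Γ.≈ᴹ-sym W (N.∣-+ (piece⊆ V j) n n′)))))
                (Q.Γ.≈ᴹ-trans W (Bˡ.+ᴹ-homo W ej _ _)
                (Q.Γ.≈ᴹ-trans W (Q.Γ.+ᴹ-cong W (Q.Γ.≈ᴹ-sym W (value-local n j))
                  (Q.Γ.≈ᴹ-sym W (value-local n′ j)))
                  (Q.Γ.≈ᴹ-sym W (Q.∣-+ (piece⊆ V j) _ _)))))
              (λ a n → locally Q _ _ λ j → let W = piece V j ; ej = e (proj₁ j) L.∣ piece⊆U V j in
                Q.Γ.≈ᴹ-trans W (value-unique (N.Γ._*ₗ_ V a n) (piece⊆ V j) _ _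
                  (N.Γ.≈ᴹ-trans W (Tˡ.*ₗ-homo W ej (a |ˢ piece⊆ V j) _)
                  (N.Γ.≈ᴹ-trans W (N.Γ.*ₗ-cong W (Γ𝒪.refl W {a |ˢ piece⊆ V j}) (coefficient-eq n j))
                    (N.Γ.≈ᴹ-sym W (N.∣-* (piece⊆ V j) a n)))))
                (Q.Γ.≈ᴹ-trans W (Bˡ.*ₗ-homo W ej (a |ˢ piece⊆ V j) _)
                (Q.Γ.≈ᴹ-trans W (Q.Γ.*ₗ-cong W (Γ𝒪.refl W {a |ˢ piece⊆ V j}) (Q.Γ.≈ᴹ-sym W (value-local n j)))
                  (Q.Γ.≈ᴹ-sym W (Q.∣-* (piece⊆ V j) a _)))))
          ; natural = λ {V} {W} i n → locally Q _ _ λ j → let W′ = piece W j ; k = ⊆-trans (piece⊆ W j) i in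
              Q.Γ.≈ᴹ-trans W′ (Q.∣-∘ i (piece⊆ W j) k _)
              (Q.Γ.≈ᴹ-trans W′ (value-unique n k _ _
                (N.Γ.≈ᴹ-trans W′ (coefficient-eq (n N.∣ i) j) (N.∣-∘ i (piece⊆ W j) k n)))
                (Q.Γ.≈ᴹ-sym W′ (value-local (n N.∣ i) j)))
          }
          where
          _N+_ : ∀ {V} → N.Γ.Carrierᴹ V → N.Γ.Carrierᴹ V → N.Γ.Carrierᴹ V
          _N+_ {V} = N.Γ._+ᴹ_ V

        factors : ∀ V m l → Q.Γ._≈ᴹ_ V (value (τ.map V m l)) (β.map V m l)
        factors V m l = Q.Γ.≈ᴹ-trans V (Q.Γ.≈ᴹ-sym V (Q.∣-id ⊆-refl _))
          (value-unique (τ.map V m l) ⊆-refl m l (N.Γ.≈ᴹ-sym V (N.∣-id ⊆-refl _)))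

        hom-unique : ∀ (g h : Hom N Q) →
                     (∀ V m l → Q.Γ._≈ᴹ_ V (Hom.map g V (τ.map V m l)) (β.map V m l)) →
                     (∀ V m l → Q.Γ._≈ᴹ_ V (Hom.map h V (τ.map V m l)) (β.map V m l)) →
                     ∀ V n → Q.Γ._≈ᴹ_ V (Hom.map g V n) (Hom.map h V n)
        hom-unique g h p q V n = locally Q _ _ λ j →
          let W = piece V j
          in Q.Γ.≈ᴹ-trans W (on-piece g p j) (Q.Γ.≈ᴹ-sym W (on-piece h q j))
          where
          on-piece : ∀ (g : Hom N Q) → (∀ V m l → Q.Γ._≈ᴹ_ V (Hom.map g V (τ.map V m l)) (β.map V m l)) →
                     ∀ (j : Piece V) → Q.Γ._≈ᴹ_ (piece V j) (Hom.map g V n Q.∣ piece⊆ V j) (local-value n j)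
          on-piece g p j = let W = piece V j in
            Q.Γ.≈ᴹ-trans W (Hom.natural g (piece⊆ V j) n)
            (Q.Γ.≈ᴹ-trans W (HomProperties.⟦⟧-cong g W (N.Γ.≈ᴹ-sym W (coefficient-eq n j))) (p W _ _))

      isTensorProduct : IsTensorProduct M L N
      isTensorProduct = record
        { tensor = τ
        ; factor = λ Q β → Factorisation.hom Q β , Factorisation.factors Q β
        ; unique = λ Q β → Factorisation.hom-unique Q β
        }

  -- Homomorphisms of direct sums as matrices.

  module _ (M : 𝒪-Module) where
    open 𝒪-Module M

    restrict-0 : ∀ {U V} (i : V ⊆ U) → Γ._≈ᴹ_ V (Γ.0ᴹ U ∣ i) (Γ.0ᴹ V)
    restrict-0 {U} {V} i = Γ.≈ᴹ-trans V (∣-cong i (Γ.≈ᴹ-sym U (Γ.*ₗ-zeroˡ U (Γ.0ᴹ U))))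
      (Γ.≈ᴹ-trans V (∣-* i (Γ𝒪.0# U) (Γ.0ᴹ U)) (Γ.≈ᴹ-trans V
        (Γ.*ₗ-cong V {Γ𝒪.0# U |ˢ i} {Γ𝒪.0# V} (λ _ _ → K.refl {K.0#}) (Γ.≈ᴹ-refl V)) (Γ.*ₗ-zeroˡ V _)))

  module _ (M N : 𝒪-Module) where
    private
      module M = 𝒪-Module M
      module N = 𝒪-Module N

    ι₁ : Hom M (M ⊕ N)
    ι₁ = record
      { map     = λ U m → m , N.Γ.0ᴹ U
      ; linear  = λ U → linear-from (M.Γ U) (𝒪-Module.Γ (M ⊕ N) U) _ (λ e → e , N.Γ.≈ᴹ-refl U)
          (λ _ _ → M.Γ.≈ᴹ-refl U , N.Γ.≈ᴹ-sym U (N.Γ.+ᴹ-identityˡ U _))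
          (λ a _ → M.Γ.≈ᴹ-refl U , N.Γ.≈ᴹ-sym U (N.Γ.*ₗ-zeroʳ U a))
      ; natural = λ {_} {V} i _ → M.Γ.≈ᴹ-refl V , restrict-0 N i
      }

    ι₂ : Hom N (M ⊕ N)
    ι₂ = record
      { map     = λ U n → M.Γ.0ᴹ U , n
      ; linear  = λ U → linear-from (N.Γ U) (𝒪-Module.Γ (M ⊕ N) U) _ (λ e → M.Γ.≈ᴹ-refl U , e)
          (λ _ _ → M.Γ.≈ᴹ-sym U (M.Γ.+ᴹ-identityˡ U _) , N.Γ.≈ᴹ-refl U)
          (λ a _ → M.Γ.≈ᴹ-sym U (M.Γ.*ₗ-zeroʳ U a) , N.Γ.≈ᴹ-refl U)
      ; natural = λ {_} {V} i _ → restrict-0 M i , N.Γ.≈ᴹ-refl V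
      }

    π₁ : Hom (M ⊕ N) M
    π₁ = record
      { map     = λ _ → proj₁
      ; linear  = λ U → linear-from (𝒪-Module.Γ (M ⊕ N) U) (M.Γ U) _ proj₁ (λ _ _ → M.Γ.≈ᴹ-refl U)
           (λ _ _ → M.Γ.≈ᴹ-refl U)
      ; natural = λ {_} {V} _ _ → M.Γ.≈ᴹ-refl V
      }

    π₂ : Hom (M ⊕ N) N
    π₂ = record
      { map     = λ _ → proj₂
      ; linear  = λ U → linear-from (𝒪-Module.Γ (M ⊕ N) U) (N.Γ U) _ proj₂ (λ _ _ → N.Γ.≈ᴹ-refl U)
           (λ _ _ → N.Γ.≈ᴹ-refl U)
      ; natural = λ {_} {V} _ _ → N.Γ.≈ᴹ-refl V
      }

  -- One diagonal entry of the matrix equation saying that two homomorphisms of direct sums compose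
  -- to the identity.
  record SumsToIdentity {M P Q : 𝒪-Module} (g : Hom P M) (f : Hom M P) (g′ : Hom Q M) (f′ : Hom M Q) : Set₁
    where
    open 𝒪-Module.Γ M
    field
      identity : ∀ U m → _≈ᴹ_ U m (_+ᴹ_ U (Hom.map g U (Hom.map f U m)) (Hom.map g′ U (Hom.map f′ U m)))

  -- Opaque, lest the entries be unfolded when they are compared.
  module _ {M N P Q : 𝒪-Module} where
    private
      module M = 𝒪-Module M
      module N = 𝒪-Module N
      module P = 𝒪-Module P
      module Q = 𝒪-Module Q

    opaque
      entry₁₁ : Hom (M ⊕ N) (P ⊕ Q) → Hom M P
      entry₁₁ h = π₁ P Q ∘ʰ (h ∘ʰ ι₁ M N)

      entry₁₂ : Hom (M ⊕ N) (P ⊕ Q) → Hom N P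
      entry₁₂ h = π₁ P Q ∘ʰ (h ∘ʰ ι₂ M N)

      entry₂₁ : Hom (M ⊕ N) (P ⊕ Q) → Hom M Q
      entry₂₁ h = π₂ P Q ∘ʰ (h ∘ʰ ι₁ M N)

      entry₂₂ : Hom (M ⊕ N) (P ⊕ Q) → Hom N Q
      entry₂₂ h = π₂ P Q ∘ʰ (h ∘ʰ ι₂ M N)

    module _ (h : Hom (M ⊕ N) (P ⊕ Q)) where
      private
        split : ∀ U m n → 𝒪-Module.Γ._≈ᴹ_ (P ⊕ Q) U (Hom.map h U (m , n))
                  (𝒪-Module.Γ._+ᴹ_ (P ⊕ Q) U (Hom.map h U (m , N.Γ.0ᴹ U)) (Hom.map h U (M.Γ.0ᴹ U , n)))
        split U m n = 𝒪-Module.Γ.≈ᴹ-trans (P ⊕ Q) U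
          (HomProperties.⟦⟧-cong h U (M.Γ.≈ᴹ-sym U (M.Γ.+ᴹ-identityʳ U m) , N.Γ.≈ᴹ-sym U
            (N.Γ.+ᴹ-identityˡ U n)))
          (HomProperties.+ᴹ-homo h U (m , N.Γ.0ᴹ U) (M.Γ.0ᴹ U , n))

      opaque
        unfolding entry₁₁

        row₁ : ∀ U m n → P.Γ._≈ᴹ_ U (proj₁ (Hom.map h U (m , n)))
          (P.Γ._+ᴹ_ U (Hom.map (entry₁₁ h) U m) (Hom.map (entry₁₂ h) U n))
        row₁ U m n = proj₁ (split U m n)

        row₂ : ∀ U m n → Q.Γ._≈ᴹ_ U (proj₂ (Hom.map h U (m , n)))
          (Q.Γ._+ᴹ_ U (Hom.map (entry₂₁ h) U m) (Hom.map (entry₂₂ h) U n))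
        row₂ U m n = proj₂ (split U m n)

  module _ {M N P Q : 𝒪-Module} (φ : M ⊕ N ≅ P ⊕ Q) where
    private
      module φ = _≅_ {M ⊕ N} {P ⊕ Q} φ
      module M = 𝒪-Module M
      module N = 𝒪-Module N

    opaque
      unfolding entry₁₁

      product₁₁ : SumsToIdentity (entry₁₁ {P} {Q} {M} {N} φ.from) (entry₁₁ {M} {N} {P} {Q} φ.to)
        (entry₁₂ {P} {Q} {M} {N} φ.from) (entry₂₁ {M} {N} {P} {Q} φ.to)
      product₁₁ = record { identity = λ U m →
        M.Γ.≈ᴹ-trans U (M.Γ.≈ᴹ-sym U (proj₁ (φ.from-to U (m , N.Γ.0ᴹ U)))) (row₁ {P} {Q} {M} {N} φ.from U _ _) }

      product₂₂ : SumsToIdentity (entry₂₁ {P} {Q} {M} {N} φ.from) (entry₁₂ {M} {N} {P} {Q} φ.to)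
        (entry₂₂ {P} {Q} {M} {N} φ.from) (entry₂₂ {M} {N} {P} {Q} φ.to)
      product₂₂ = record { identity = λ U n →
        N.Γ.≈ᴹ-trans U (N.Γ.≈ᴹ-sym U (proj₂ (φ.from-to U (M.Γ.0ᴹ U , n)))) (row₂ {P} {Q} {M} {N} φ.from U _ _) }

  -- The function field and the local rings inside it.

  open Points em isField X
  open HomogeneousPrimes S.grading S.isDirectSum
  open CoordinateRings em isField coordinateRing
  open Ideals S.ring
  open Stalks using (InStalk; stalk-resp; stalk-+; stalk-*)
  open Section
  open Divisor
  private
    module R = CommutativeRing S.ring
    module RS = SemiringSolver R.commutativeSemiring
    module ℤS = ℤSolver.+-*-Solver

  *-cancelᴿ : ∀ {u a b} → ¬ u R.≈ R.0# → u R.* a R.≈ u R.* b → a R.≈ b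
  *-cancelᴿ {u} {a} {b} u≉0 e with IsDomain.noZeroDivisors isDomain u (a R.+ R.- b) (begin
      u R.* (a R.+ R.- b)              ≈⟨ R.distribˡ u a (R.- b) ⟩
      u R.* a R.+ u R.* R.- b          ≈⟨ R.+-cong e (R.sym (-‿distribʳ-* u b)) ⟩
      u R.* b R.+ R.- (u R.* b)        ≈⟨ R.-‿inverseʳ _ ⟩
      R.0#                             ∎)
    where
    open import Relation.Binary.Reasoning.Setoid R.setoid
    open RingProperties R.ring using (-‿distribʳ-*)
  ... | inj₁ u≈0   = ⊥-elim (u≉0 u≈0)
  ... | inj₂ a-b≈0 = begin
      a                      ≈⟨ R.sym (R.+-identityʳ a) ⟩
      a R.+ R.0#             ≈⟨ R.+-congˡ (R.sym (R.-‿inverseˡ b)) ⟩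
      a R.+ (R.- b R.+ b)    ≈⟨ R.sym (R.+-assoc _ _ _) ⟩
      (a R.+ R.- b) R.+ b    ≈⟨ R.trans (R.+-congʳ a-b≈0) (R.+-identityˡ b) ⟩
      b                      ∎
    where open import Relation.Binary.Reasoning.Setoid R.setoid

  *-≉0ᴿ : ∀ {a b} → ¬ a R.≈ R.0# → ¬ b R.≈ R.0# → ¬ a R.* b R.≈ R.0#
  *-≉0ᴿ a≉0 b≉0 e = [ a≉0 , b≉0 ]′ (IsDomain.noZeroDivisors isDomain _ _ e)

  ∉⇒≉0 : ∀ P {s} → ¬ ideal P s → ¬ s R.≈ R.0#
  ∉⇒≉0 P s∉ s≈0 = s∉ (η≤ P s≈0)

  -- K, made opaque lest its elements be unfolded to fractions.
  opaque
    infix  4 _≈_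
    infixl 6 _+_
    infixl 7 _*_
    infix  8 -_

    _≈_ : K.Carrier → K.Carrier → Set
    _≈_ = K._≈_

    _+_ _*_ : K.Carrier → K.Carrier → K.Carrier
    _+_ = K._+_
    _*_ = K._*_

    -_ : K.Carrier → K.Carrier
    -_ = K.-_

    0# 1# : K.Carrier
    0# = K.0#
    1# = K.1#

    isCommutativeRing : IsCommutativeRing _≈_ _+_ _*_ -_ 0# 1#
    isCommutativeRing = K.isCommutativeRing

  𝕂 : Ring₀
  𝕂 = record { isCommutativeRing = isCommutativeRing }

  open CommutativeRing 𝕂 public hiding (zero; _≈_; _+_; _*_; -_; 0#; 1#; isCommutativeRing)

  NonZeroᴿ : Pred R.Carrier 0ℓ
  NonZeroᴿ s = ¬ s R.≈ R.0#

  infixl 9 _/_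
  _/_ : ∀ {d s y} → S.Part d s → S.Part d y × NonZeroᴿ y → K.Carrier
  s∈ / (y∈ , y≉0) = fraction _ _ s∈ y∈ y≉0

  opaque
    unfolding _≈_

    ≈-in : ∀ {x y} → x K.≈ y → x ≈ y
    ≈-in p = p

    ≈-out : ∀ {x y} → x ≈ y → x K.≈ y
    ≈-out p = p

    cross : ∀ (x y : Fraction η) → Fraction.num x R.* Fraction.den y R.≈ Fraction.num y R.* Fraction.den x →
      x ≈ y
    cross x y e = 0 , R.1# , S.1-closed , IsDomain.1≉0 isDomain , R.*-congˡ e

    uncross : ∀ (x y : Fraction η) → x ≈ y →
      Fraction.num x R.* Fraction.den y R.≈ Fraction.num y R.* Fraction.den x
    uncross x y (d , u , u∈ , u≉0 , e) = *-cancelᴿ u≉0 e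

    O M : Point → Pred K.Carrier 0ℓ
    O = InLocalRing
    M = InLocalMaximalIdeal

    /-≈ : ∀ {d e s t y z} (s∈ : S.Part d s) (y∈ : S.Part d y × NonZeroᴿ y)
          (t∈ : S.Part e t) (z∈ : S.Part e z × NonZeroᴿ z) →
          s R.* z R.≈ t R.* y → s∈ / y∈ ≈ t∈ / z∈
    /-≈ s∈ y∈ t∈ z∈ = cross (s∈ / y∈) (t∈ / z∈)

    /-* : ∀ {d e f s t u y z w} (s∈ : S.Part d s) (y∈ : S.Part d y × NonZeroᴿ y)
          (t∈ : S.Part e t) (z∈ : S.Part e z × NonZeroᴿ z)
          (u∈ : S.Part f u) (w∈ : S.Part f w × NonZeroᴿ w) →
          u R.* (y R.* z) R.≈ (s R.* t) R.* w → u∈ / w∈ ≈ s∈ / y∈ * t∈ / z∈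
    /-* s∈ y∈ t∈ z∈ u∈ w∈ = cross (u∈ / w∈) (s∈ / y∈ * t∈ / z∈)

    /-+ : ∀ {d s t y} (s∈ : S.Part d s) (t∈ : S.Part d t) (s+t∈ : S.Part d (s R.+ t))
      (y∈ : S.Part d y × NonZeroᴿ y) →
          s+t∈ / y∈ ≈ s∈ / y∈ + t∈ / y∈
    /-+ {d} {s} {t} {y} s∈ t∈ s+t∈ y∈ = cross (s+t∈ / y∈) (s∈ / y∈ + t∈ / y∈)
      (RS.solve 3 (λ s t y → (s RS.:+ t) RS.:* (y RS.:* y) RS.:= (s RS.:* y RS.:+ t RS.:* y) RS.:* y)
        R.refl s t y)

  opaque
    unfolding _≈_ O

    fraction-≈0 : ∀ x → Fraction.num x R.≈ R.0# → x ≈ 0#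
    fraction-≈0 x e = cross x 0# (R.trans (R.*-congʳ e) (R.trans (R.zeroˡ _) (R.sym (R.zeroˡ _))))

    ≈0-fraction : ∀ x → x ≈ 0# → Fraction.num x R.≈ R.0#
    ≈0-fraction x p = R.trans (R.sym (R.*-identityʳ _)) (R.trans (uncross x 0# p) (R.zeroˡ _))

    𝕂-isField : IsField 𝕂
    𝕂-isField = record
      { 1≉0     = λ p → IsDomain.1≉0 isDomain (≈0-fraction 1# p)
      ; inverse = λ x x≉0 →
          let y = fraction (Fraction.den x) (Fraction.num x) (Fraction.den-part x) (Fraction.num-part x)
                    (λ e → x≉0 (fraction-≈0 x e))
          in y , cross (x * y) 1# (R.trans (R.*-identityʳ _) (R.trans (R.*-comm _ _) (R.sym (R.*-identityˡ _))))
      }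

  open FieldTheory em 𝕂 𝕂-isField public

  opaque
    unfolding _≈_ O

    isLocalSubring : ∀ P → IsLocalSubring (O P) (M P)
    isLocalSubring P = record
      { O-resp = λ {x} {y} e x∈ → lower (𝒪ˢ.stalk-resp P {x} {y} e (lift x∈))
      ; O-1    = 1ᶠ P , K.refl {K.1#}
      ; O-+    = λ {x} {y} x∈ y∈ → lower (𝒪ˢ.stalk-+ P {x} {y} (lift x∈) (lift y∈))
      ; O-*    = λ {x} {y} x∈ y∈ → lower (𝒪ˢ.stalk-* P {x} {y} x∈ (lift y∈))
      ; M-resp = λ {x} {y} e (g , g∈ , p) → g , g∈ , K.trans {toK P g} {x} {y} p e
      ; M-0    = 0ᶠ P , P.ideal-0 , K.refl {K.0#}
      ; M⊆O    = λ (g , _ , p) → g , p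
      ; M-*    = λ {a} {x} (h , q) (g , g∈ , p) → _*ᶠ_ P h g , P.ideal-* (Fraction.num h) g∈ ,
                   K.*-cong {toK P h} {a} {toK P g} {x} q p
      ; 1∉M    = λ (g , g∈ , p) → Fraction.den∉ g (P.ideal-resp
                   (R.trans (R.sym (R.*-identityʳ _)) (R.trans (uncross (toK P g) K.1# p) (R.*-identityˡ _)))
                     g∈)
      ; O-inv  = λ {x} (g , p) x∉ →
          let h = fraction (Fraction.den g) (Fraction.num g) (Fraction.den-part g) (Fraction.num-part g)
                    (λ num∈ → x∉ (g , num∈ , p))
          in h , inv-unique {x} {toK P h} (trans {x * toK P h} {toK P g * toK P h} {1#}
               (*-congʳ {toK P h} {x} {toK P g} (sym {toK P g} {x} p))
               (cross (toK P g * toK P h) 1#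
                 (R.trans (R.*-identityʳ _) (R.trans (R.*-comm _ _) (R.sym (R.*-identityˡ _))))))
      }
      where
      module P = Point P
      module 𝒪ˢ = Stalks 𝒪ˢ

    𝕂-uniformizer : ∀ {P} → IsClosedPoint P →
      Σ[ t ∈ K.Carrier ] M P t × (∀ f → M P f → ∃[ a ] O P a × f ≈ a * t)
    𝕂-uniformizer {P} closed =
      let (t , t∈ , gen) = uniformizer {P} closed
      in toK P t , (t , t∈ , K.refl {toK P t}) , λ f (g , g∈ , p) →
         let (c , e) = gen g g∈
         in toK P c , (c , K.refl {toK P c}) , K.trans {f} {toK P g} {toK P c K.* toK P t}
              (K.sym {toK P g} {f} p) e

  module Local (P : Point) where
    open IsLocalSubring (isLocalSubring P) public
    open LocalSubring (isLocalSubring P) public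

  open Exp R.semiring using () renaming (_^_ to _^ᴿ_; ^-homo-* to ^ᴿ-homo-*)
  open Exp semiring using (_^_; ^-congˡ; ^-homo-*)
  open MonoidSum R.+-monoid using (sum)
  open SemiringSolver commutativeSemiring using (solve; _:+_; _:*_; _:=_)

  opaque
    unfolding _≈_ O

    /∈O : ∀ P {d s y} (s∈ : S.Part d s) (y∈ : S.Part d y × NonZeroᴿ y) → ¬ ideal P y → O P (s∈ / y∈)
    /∈O P s∈ y∈ y∉ =
      let g = fraction _ _ s∈ (proj₁ y∈) y∉ in g , K.refl {toK P g}

    /∈M : ∀ P {d s y} (s∈ : S.Part d s) (y∈ : S.Part d y × NonZeroᴿ y) → ideal P s → ¬ ideal P y → M P (s∈ / y∈)
    /∈M P s∈ y∈ s∈P y∉ =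
      let g = fraction _ _ s∈ (proj₁ y∈) y∉ in g , s∈P , K.refl {toK P g}

    M/⇒∈ : ∀ P {d s y} (s∈ : S.Part d s) (y∈ : S.Part d y × NonZeroᴿ y) → M P (s∈ / y∈) → ideal P s
    M/⇒∈ P {s = s} {y} s∈ y∈ (g , g∈ , p) with Point.prime P (Point.ideal-resp P
      (R.trans (R.*-comm _ _) (uncross (toK P g) (s∈ / y∈) p)) (Point.ideal-* P y g∈))
    ... | inj₁ s∈P   = s∈P
    ... | inj₂ den∈P = ⊥-elim (Fraction.den∉ g den∈P)

    O⇒/ : ∀ P {x} → O P x → ∃[ d ] ∃[ s ] ∃[ y ] Σ[ s∈ ∈ S.Part d s ] Σ[ y∈ ∈ S.Part d y × NonZeroᴿ y ]
            ¬ ideal P y × x ≈ s∈ / y∈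
    O⇒/ P {x} (fraction a b a∈ b∈ b∉ , p) =
      _ , a , b , a∈ , (b∈ , ∉⇒≉0 P b∉) , b∉ , sym {toK P (fraction a b a∈ b∈ b∉)} {x} p

    /-surjective : ∀ x → ∃[ d ] ∃[ s ] ∃[ y ] Σ[ s∈ ∈ S.Part d s ] Σ[ y∈ ∈ S.Part d y × NonZeroᴿ y ] x ≈ s∈ / y∈
    /-surjective x@(fraction a b a∈ b∈ b∉) = _ , a , b , a∈ , (b∈ , b∉) , refl {x}

    /≈0⇒ : ∀ {d s y} (s∈ : S.Part d s) (y∈ : S.Part d y × NonZeroᴿ y) → s∈ / y∈ ≈ 0# → s R.≈ R.0#
    /≈0⇒ s∈ y∈ = ≈0-fraction (s∈ / y∈)

    ⇒/≈0 : ∀ {d s y} (s∈ : S.Part d s) (y∈ : S.Part d y × NonZeroᴿ y) → s R.≈ R.0# → s∈ / y∈ ≈ 0#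
    ⇒/≈0 s∈ y∈ = fraction-≈0 (s∈ / y∈)

    /-≈⁻¹ : ∀ {d e s t y z} (s∈ : S.Part d s) (y∈ : S.Part d y × NonZeroᴿ y)
          (t∈ : S.Part e t) (z∈ : S.Part e z × NonZeroᴿ z) →
          s∈ / y∈ ≈ t∈ / z∈ → s R.* z R.≈ t R.* y
    /-≈⁻¹ s∈ y∈ t∈ z∈ = uncross (s∈ / y∈) (t∈ / z∈)

    /-1 : ∀ {d s} (s∈ : S.Part d s) (y∈ : S.Part d s × NonZeroᴿ s) → s∈ / y∈ ≈ 1#
    /-1 s∈ y∈ = cross (s∈ / y∈) 1# (R.*-comm _ _)

  ideal-sum : ∀ P n (c : Fin n → R.Carrier) → (∀ i → ideal P (c i)) → ideal P (sum c)
  ideal-sum P zero    c c∈ = Point.ideal-0 P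
  ideal-sum P (suc n) c c∈ = Point.ideal-+ P (c∈ Fin.zero) (ideal-sum P n (c ∘ Fin.suc) (c∈ ∘ Fin.suc))

  ≤-homogeneous : ∀ Q P → (∀ {d s} → S.Part d s → ideal Q s → ideal P s) → Q ≤ P
  ≤-homogeneous Q P f s∈ =
    let (n , c , c∈ , e) = Point.homogeneous Q s∈
    in Point.ideal-resp P (R.sym e) (ideal-sum P n c (λ i → f (proj₁ (c∈ i)) (proj₂ (c∈ i))))

  -- If all coordinates lay in P, so would all homogeneous elements of positive degree, against
  -- `relevant`.
  coordinate∉ : ∀ P → ∃[ i ] ¬ ideal P (S.x i)
  coordinate∉ P with em {P = ∃[ i ] ¬ ideal P (S.x i)}
  ... | yes p = p
  ... | no ∄  =
    let (d , s , s∈ , s∉) = Point.relevant P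
        (c , _ , e) = S.generated s∈
    in ⊥-elim (s∉ (Point.ideal-resp P (R.sym e) (ideal-sum P _ _ (λ i →
         Point.ideal-* P (c i) (decidable-stable em (λ xᵢ∉ → ∄ (i , xᵢ∉)))))))

  -- Division by powers of a coordinate outside P turns homogeneous elements into elements of the
  -- local ring. Homogeneous primes and primes of the local ring are compared along this map.
  module Dehomogenise (P : Point) where
    y : R.Carrier
    y = S.x (proj₁ (coordinate∉ P))

    y∉ : ¬ ideal P y
    y∉ = proj₂ (coordinate∉ P)

    y^∉ : ∀ d → ¬ ideal P (y ^ᴿ d)
    y^∉ zero    = Point.proper P
    y^∉ (suc d) y^∈ = [ y∉ , y^∉ d ]′ (Point.prime P y^∈)

    y^∈ : ∀ d → S.Part d (y ^ᴿ d)
    y^∈ zero    = S.1-closed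
    y^∈ (suc d) = S.*-closed (S.x-degree _) (y^∈ d)

    y^ : ∀ d → S.Part d (y ^ᴿ d) × NonZeroᴿ (y ^ᴿ d)
    y^ d = y^∈ d , ∉⇒≉0 P (y^∉ d)

    ⟦_⟧ : ∀ {d s} → S.Part d s → K.Carrier
    ⟦_⟧ {d} s∈ = s∈ / y^ d

    ⟦⟧∈O : ∀ {d s} (s∈ : S.Part d s) → O P ⟦ s∈ ⟧
    ⟦⟧∈O {d} s∈ = /∈O P s∈ (y^ d) (y^∉ d)

    ⟦⟧-* : ∀ {d e s t} (s∈ : S.Part d s) (t∈ : S.Part e t) (st∈ : S.Part (d ℕ.+ e) (s R.* t)) →
           ⟦ st∈ ⟧ ≈ ⟦ s∈ ⟧ * ⟦ t∈ ⟧
    ⟦⟧-* {d} {e} s∈ t∈ st∈ = /-* s∈ (y^ d) t∈ (y^ e) st∈ (y^ (d ℕ.+ e)) (R.*-congˡ (R.sym (^ᴿ-homo-* y d e)))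

    ⟦⟧-cong : ∀ {d s t} (s∈ : S.Part d s) (t∈ : S.Part d t) → s R.≈ t → ⟦ s∈ ⟧ ≈ ⟦ t∈ ⟧
    ⟦⟧-cong {d} s∈ t∈ e = /-≈ s∈ (y^ d) t∈ (y^ d) (R.*-congʳ e)

    ⟦⟧-/ : ∀ {d s z} (s∈ : S.Part d s) (z∈ : S.Part d z × NonZeroᴿ z) → s∈ / z∈ * ⟦ proj₁ z∈ ⟧ ≈ ⟦ s∈ ⟧
    ⟦⟧-/ {d} {s} {z} s∈ z∈ = sym
      (/-* s∈ z∈ (proj₁ z∈) (y^ d) s∈ (y^ d)
        (RS.solve 3 (λ s z y → s RS.:* (z RS.:* y) RS.:= (s RS.:* z) RS.:* y) R.refl s z (y ^ᴿ d)))

  -- The local ring at a closed point is a discrete valuation ring.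

  module ClosedPoint {P : Point} (closed : IsClosedPoint P) where
    open Dehomogenise P
    open Local P

    t : K.Carrier
    t = proj₁ (𝕂-uniformizer {P} closed)

    t∈M : M P t
    t∈M = proj₁ (proj₂ (𝕂-uniformizer {P} closed))

    generates : ∀ f → M P f → ∃[ a ] O P a × f ≈ a * t
    generates = proj₂ (proj₂ (𝕂-uniformizer {P} closed))

    -- With t = 0 the maximal ideal would be 0, so P would be generic.
    t≉0 : t ≉0
    t≉0 t≈0 = closed⇒≰η P closed (≤-homogeneous P η λ {d} s∈ s∈P →
      let (a , _ , e) = generates ⟦ s∈ ⟧ (/∈M P s∈ (y^ d) s∈P (y^∉ d))
      in /≈0⇒ s∈ (y^ d) (trans e (trans (*-congˡ t≈0) (zeroʳ a))))

    private
      ⋂ᴾ : Pred K.Carrier 0ℓ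
      ⋂ᴾ = ⋂ t∈M t≉0 generates

    -- The prime ideal ⋂ tⁿ 𝒪_P is not maximal, so it corresponds to the
    -- generic point.
    ⋂-point : HomogeneousPrime
    ⋂-point = record
      { H          = λ d s → Σ[ s∈ ∈ S.Part d s ] ⋂ᴾ ⟦ s∈ ⟧
      ; H⊆Part     = proj₁
      ; H-resp     = λ e (s∈ , p) → S.resp e s∈ , resp′ (⟦⟧-cong s∈ (S.resp e s∈) e) p
      ; H-0        = λ {d} → S.0-closed , resp′ (sym (⇒/≈0 S.0-closed (y^ d) R.refl)) (⋂-0 t∈M t≉0 generates)
      ; H-+        = λ {d} (s∈ , p) (t∈ , q) → S.+-closed s∈ t∈ ,
                       resp′ (sym (/-+ s∈ t∈ (S.+-closed s∈ t∈) (y^ d))) (⋂-+ t∈M t≉0 generates p q)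
      ; H-*        = λ (s∈ , p) t∈ → S.*-closed s∈ t∈ ,
                       resp′ (trans (*-comm _ _) (sym (⟦⟧-* s∈ t∈ (S.*-closed s∈ t∈))))
                         (⋂-* t∈M t≉0 generates (⟦⟧∈O t∈) p)
      ; H-prime    = λ s∈ t∈ (st∈ , p) → [ (λ q → inj₁ (s∈ , q)) , (λ q → inj₂ (t∈ , q)) ]′
                       (⋂-prime t∈M t≉0 generates (⟦⟧∈O s∈) (⟦⟧∈O t∈) (resp′ (⟦⟧-* s∈ t∈ st∈) p))
      ; H-relevant = 0 , y ^ᴿ 1 , y^∈ 1 , λ (y∈ , p) → 1∉⋂ (resp′ (/-1 y∈ (y^ 1)) p)
      }
      where
      resp′ : ∀ {x y} → x ≈ y → ⋂ᴾ x → ⋂ᴾ y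
      resp′ = ⋂-resp t∈M t≉0 generates

      1∉⋂ : ¬ ⋂ᴾ 1#
      1∉⋂ p = t∉⋂ t∈M t≉0 generates (resp′ (*-identityʳ t) (⋂-* t∈M t≉0 generates (M⊆O t∈M) p))

    private
      module Q = HomogeneousPrime ⋂-point

      ⋂⊆M : ∀ {x} → ⋂ᴾ x → M P x
      ⋂⊆M {x} p = M-resp (/-cancel t≉0) (M-* (O-resp (*-congˡ (*-identityʳ _)) (p 1)) t∈M)

      Q≤P : Q.point ≤ P
      Q≤P (n , p) = low n p
        where
        low : ∀ n {s} → Low Q.H n s → ideal P s
        low zero    s≈0 = η≤ P s≈0
        low (suc n) (a , b , (a∈ , p) , q , e) =
          Point.ideal-resp P (R.sym e) (Point.ideal-+ P (M/⇒∈ P a∈ (y^ _) (⋂⊆M p)) (low n q))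

      -- The numerator of t lies in P. Were it in Q, then t itself would be divisible by all powers
      -- of t.
      P≰Q : ¬ P ≤ Q.point
      P≰Q P≤Q =
        let (d , s , z , s∈ , z∈ , z∉ , e) = O⇒/ P (M⊆O t∈M)
            s∈P = M/⇒∈ P s∈ z∈ (M-resp e t∈M)
            (s∈′ , p) = Q.I⇒H s∈ (P≤Q s∈P)
        in t∉⋂ t∈M t≉0 generates (⋂-resp t∈M t≉0 generates
             (trans (sym (/-* (y^∈ d) z∈ s∈′ (y^ d) s∈ z∈
               (RS.solve 3 (λ s z y → s RS.:* (z RS.:* y) RS.:= (y RS.:* s) RS.:* z)
                 R.refl s z (y ^ᴿ d)))) (sym e))
             (⋂-* t∈M t≉0 generates (/∈O P (y^∈ d) z∈ z∉) p))

      -- Otherwise η < Q < P would be a chain of length 2.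
      Q≤η : Q.point ≤ η
      Q≤η = decidable-stable em (λ Q≰η → no-chain η Q.point P (η≤ Q.point , Q≰η) ((λ {x} → Q≤P {x}) , P≰Q))

    ⋂≈0 : ∀ x → ⋂ᴾ x → x ≈ 0#
    ⋂≈0 x p =
      let (d , s , z , s∈ , z∈ , z∉ , e) = O⇒/ P (O-resp (*-identityʳ x) (p 0))
          q = ⋂-resp t∈M t≉0 generates (trans (*-congˡ e) (trans (*-comm _ _) (⟦⟧-/ s∈ z∈)))
                (⋂-* t∈M t≉0 generates (⟦⟧∈O (proj₁ z∈)) p)
      in trans e (⇒/≈0 s∈ z∈ (Q≤η (Q.H⇒I (s∈ , q))))

    isDVR : IsDVR (O P) (M P)
    isDVR = record
      { isLocal = isLocalSubring P ; t = t ; t∈M = t∈M ; t≉0 = t≉0 ; generates = generates ; ⋂≈0 = ⋂≈0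
      ; fractions = λ f →
          let (d , s , z , s∈ , z∈ , e) = /-surjective f
          in ⟦ s∈ ⟧ , ⟦ proj₁ z∈ ⟧ , ⟦⟧∈O s∈ , ⟦⟧∈O (proj₁ z∈)
           , (λ p → proj₂ z∈ (/≈0⇒ (proj₁ z∈) (y^ d) p))
           , trans (*-congʳ e) (⟦⟧-/ s∈ z∈)
      }

    open DVR isDVR public

  -- Finiteness of zeros, isolation of points and degrees of quotients.

  Ideal⊆ : ∀ Q {g} {G : Pred R.Carrier g} → (∀ {s} → G s → ideal Q s) → ∀ {s} → Ideal G s → ideal Q s
  Ideal⊆ Q f (span-gen s∈)    = f s∈
  Ideal⊆ Q f span-0          = Point.ideal-0 Q
  Ideal⊆ Q f (span-+ p q)   = Point.ideal-+ Q (Ideal⊆ Q f p) (Ideal⊆ Q f q)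
  Ideal⊆ Q f (span-* {r} _ p) = Point.ideal-* Q r (Ideal⊆ Q f p)
  Ideal⊆ Q f (span-≈ e p)  = Point.ideal-resp Q e (Ideal⊆ Q f p)

  power-prime : ∀ Q {s} m → ideal Q (s ^ᴿ m) → ideal Q s
  power-prime Q zero    1∈ = ⊥-elim (Point.proper Q 1∈)
  power-prime Q (suc m) p  = [ id , power-prime Q m ]′ (Point.prime Q p)

  module Separate {P : Point} (closed : IsClosedPoint P) {e f} (f∈ : S.Part e f) (f≉0 : NonZeroᴿ f) where
    open Dehomogenise P
    open ClosedPoint {P} closed

    Separator : Pred R.Carrier 0ℓ → Set₁
    Separator I = ∃[ g ] ¬ ideal P g × (∀ Q → ideal Q f → ¬ ideal Q g → ∀ {s} → I s → ideal Q s)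

    ^-part : ∀ {d s} → S.Part d s → ∀ m → S.Part (m ℕ.* d) (s ^ᴿ m)
    ^-part s∈ zero    = S.1-closed
    ^-part s∈ (suc m) = S.*-closed s∈ (^-part s∈ m)

    ⟦⟧-^ : ∀ {d s} (s∈ : S.Part d s) m → ⟦ ^-part s∈ m ⟧ ≈ ⟦ s∈ ⟧ ^ m
    ⟦⟧-^ s∈ zero    = /-1 S.1-closed (y^ 0)
    ⟦⟧-^ s∈ (suc m) = trans (⟦⟧-* s∈ (^-part s∈ m) (^-part s∈ (suc m))) (*-congˡ (⟦⟧-^ s∈ m))

    -- A power of s is divisible by f in the local ring at P.
    separate₁ : ∀ {d s} → S.Part d s → ideal P s → Separator (_≡ s)
    separate₁ {d} {s} s∈ s∈P =
      let (m , p) = power-divisible (/∈M P s∈ (y^ d) s∈P (y^∉ d)) (⟦⟧∈O f∈)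
           (λ f/y≈0 → f≉0 (/≈0⇒ f∈ (y^ e) f/y≈0))
          (r , a , b , a∈ , b∈ , b∉ , w≈) = O⇒/ P p
          ab∈ = S.*-closed a∈ f∈
          by∈ = S.*-closed (proj₁ b∈) (y^∈ e) , *-≉0ᴿ (proj₂ b∈) (proj₂ (y^ e))
          eq : s ^ᴿ m R.* (b R.* y ^ᴿ e) R.≈ (a R.* f) R.* y ^ᴿ (m ℕ.* d)
          eq = /-≈⁻¹ (^-part s∈ m) (y^ (m ℕ.* d)) ab∈ by∈ (trans (⟦⟧-^ s∈ m)
                 (trans (sym (/-cancel (λ f/y≈0 → f≉0 (/≈0⇒ f∈ (y^ e) f/y≈0))))
                 (trans (*-congʳ w≈) (sym (/-* a∈ b∈ f∈ (y^ e) ab∈ by∈ R.refl)))))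
      -- By `eq`, a zero of f at which b and y do not vanish is a zero of a power of s.
      in b R.* y ^ᴿ e , (λ by∈P → [ b∉ , y^∉ e ]′ (Point.prime P by∈P)) , λ where
           Q f∈Q g∉Q ≡.refl → power-prime Q m ([ id , (λ g∈Q → ⊥-elim (g∉Q g∈Q)) ]′ (Point.prime Q
             (Point.ideal-resp Q (R.trans
               (RS.solve 3 (λ a f y → (a RS.:* y) RS.:* f RS.:= (a RS.:* f) RS.:* y)
                 R.refl a f (y ^ᴿ (m ℕ.* d))) (R.sym eq))
               (Point.ideal-* Q (a R.* y ^ᴿ (m ℕ.* d)) f∈Q))))

    private
      Member : Set₁
      Member = Lift 1ℓ (∃[ s ] ideal P s × ∃[ d ] S.Part d s)

      value′ : Member → R.Carrier
      value′ (lift (s , _)) = s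

    separate-all : (L : List Member) → ∃[ g ] ¬ ideal P g ×
                     (∀ Q → ideal Q f → ¬ ideal Q g → ∀ {s} → (value′ ⟨ L ⟩) s → ideal Q s)
    separate-all [] = R.1# , Point.proper P , λ _ _ _ ()
    separate-all (lift (s , s∈P , d , s∈) ∷ L) =
      let (g , g∉ , p) = separate₁ s∈ s∈P
          (h , h∉ , q) = separate-all L
      in g R.* h , (λ gh∈P → [ g∉ , h∉ ]′ (Point.prime P gh∈P)) , λ where
           Q f∈Q gh∉Q (here ≡.refl) →
             p Q f∈Q (λ g∈Q → gh∉Q (Point.ideal-resp Q (R.*-comm h g) (Point.ideal-* Q h g∈Q))) ≡.refl
           Q f∈Q gh∉Q (there i)     → q Q f∈Q (λ h∈Q → gh∉Q (Point.ideal-* Q g h∈Q)) i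

    -- The ideal of P is generated by finitely many homogeneous elements, and the product of their
    -- separators serves them all. So near P every zero of f lies in the closure of P.
    separator : ∃[ g ] ¬ ideal P g × (∀ Q → ideal Q f → ¬ ideal Q g → P ≤ Q)
    separator =
      let (L , p) = finitely-generated value′
          (g , g∉ , q) = separate-all L
      in g , g∉ , λ Q f∈Q g∉Q → ≤-homogeneous P Q (λ s∈ s∈P →
           Ideal⊆ Q (q Q f∈Q g∉Q) (p (lift (_ , s∈P , _ , s∈))))

  -- Finitely many separators generate those of all zeros. At a zero Q its own separator does not
  -- vanish, hence neither does one of the finitely many; Q then lies in the closure of the zero
  -- belonging to it, and closed points have no other points in their closure.
  zeros : ∀ {d f} → S.Part d f → NonZeroᴿ f → ∃[ L ] ∀ Q → IsClosedPoint Q → ideal Q f → Any (Q ≋_) L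
  zeros {f = f} f∈ f≉0 =
    let (L , p) = finitely-generated sep
    in map proj₁ L , λ Q closed f∈Q → Anyₚ.map⁺ (found L Q f∈Q (λ q →
         proj₁ (proj₂ (separatorOf (Q , closed , f∈Q))) (Ideal⊆ Q q (p (Q , closed , f∈Q)))))
    where
    Zero : Set₁
    Zero = Σ[ P ∈ Point ] IsClosedPoint P × ideal P f

    separatorOf : ((P , _) : Zero) → ∃[ g ] ¬ ideal P g × (∀ Q → ideal Q f → ¬ ideal Q g → P ≤ Q)
    separatorOf (P , closed , _) = Separate.separator {P} closed f∈ f≉0

    sep : Zero → R.Carrier
    sep z = proj₁ (separatorOf z)

    found : ∀ L Q → ideal Q f → ¬ (∀ {s} → (sep ⟨ L ⟩) s → ideal Q s) → Any (λ z → Q ≋ proj₁ z) L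
    found []      Q f∈Q ∉ = ⊥-elim (∉ λ ())
    found (z ∷ L) Q f∈Q ∉ with em {P = ideal Q (sep z)}
    ... | yes sep∈ = there (found L Q f∈Q (λ p → ∉ λ { (here ≡.refl) → sep∈ ; (there i) → p i }))
    ... | no sep∉  =
      let P≤Q = λ {x} → proj₂ (proj₂ (separatorOf z)) Q f∈Q sep∉ {x}
      in here ((λ {x} → proj₁ (proj₂ z) Q P≤Q {x}) , λ {x} → P≤Q {x})

  D₊ : ∀ {d f} → S.Part d f → Open
  D₊ {d} {f} f∈ = record
    { member = λ P → ¬ ideal P f
    ; basic  = λ f∉ → d , f , f∈ , f∉ , id
    }

  ≰-homogeneous : ∀ Q P → ¬ Q ≤ P → ∃[ d ] ∃[ s ] S.Part d s × ideal Q s × ¬ ideal P s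
  ≰-homogeneous Q P Q≰P = decidable-stable em (λ ∄ → Q≰P (≤-homogeneous Q P (λ s∈ s∈Q →
    decidable-stable em (λ s∉P → ∄ (_ , _ , s∈ , s∈Q , s∉P)))))

  -- A listed point without `P` in its closure is cut away by an element of its ideal that is not in
  -- P. A closed point with P in its closure is P itself, so it may stay.
  isolate : ∀ (L : List Point) P → Σ[ U ∈ Open ] P ∈ U ×
              (∀ Q → Q ∈ U → IsClosedPoint Q → Any (Q ≋_) L → Q ≋ P)
  isolate []      P = D₊ S.1-closed , Point.proper P , λ _ _ _ ()
  isolate (R ∷ L) P with em {P = R ≤ P} | isolate L P
  ... | yes R≤P | (U , PU , p) = U , PU , λ where
    Q QU closed (here Q≋R) →
      (λ {x} x∈ → R≤P (proj₁ Q≋R {x} x∈)) , λ {x} → closed P (λ {x} x∈ → R≤P (proj₁ Q≋R {x} x∈)) {x}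
    Q QU closed (there i)  → p Q QU closed i
  ... | no R≰P  | (U , PU , p) =
    let (d , s , s∈ , s∈R , s∉P) = ≰-homogeneous R P R≰P
    in D₊ s∈ ∩ U , (s∉P , PU) , λ where
      Q (s∉Q , QU) closed (here Q≋R) → ⊥-elim (s∉Q (proj₂ Q≋R s∈R))
      Q (s∉Q , QU) closed (there i)  → p Q QU closed i

  -- Needed for a rational function a / b to act on one part S_m: when s a = b s′ with `s` in S_m,
  -- this puts s′ back into S_m.
  quotient-part : ∀ {d e b s} → S.Part d b → NonZeroᴿ b → S.Part (e ℕ.+ d) (b R.* s) → S.Part e s
  quotient-part {d} {e} {b} {s} b∈ b≉0 bs∈ = let (n , s∈) = low-all s in go n s∈ bs∈
    where
    Low-shift : ∀ n {s} → Low S.Part n s → Low S.Part (n ℕ.+ d) (b R.* s)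
    Low-shift n s∈ = low-resp (n ℕ.+ d) (R.*-comm _ _) (low-*-single S.0-closed S.+-closed S.*-closed n s∈ b∈)

    shift-part : ∀ {n s} → S.Part n s → S.Part (n ℕ.+ d) (b R.* s)
    shift-part s∈ = S.resp (R.*-comm _ _) (S.*-closed s∈ b∈)

    cancel : ∀ {s} → b R.* s R.≈ R.0# → s R.≈ R.0#
    cancel e = *-cancelᴿ b≉0 (R.trans e (R.sym (R.zeroʳ b)))

    -- All components of s in degrees other than e vanish, from the top.
    go : ∀ n {s} → Low S.Part n s → S.Part (e ℕ.+ d) (b R.* s) → S.Part e s
    go zero    s≈0 _ = S.resp (R.sym s≈0) S.0-closed
    go (suc n) {s} low@(c , r , c∈ , r∈ , p) bs∈ with ℕₚ.<-cmp n e
    ... | tri< n<e _ _ = S.resp (R.sym (cancel (top-unique (e ℕ.+ d) bs∈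
            (low-0 S.0-closed (e ℕ.+ d)) S.0-closed
            (low-≤ S.0-closed (ℕₚ.≤⇒≤′ (ℕₚ.+-monoˡ-≤ d n<e)) (Low-shift (suc n) low))
            (R.+-comm _ _)))) S.0-closed
    ... | tri≈ _ ≡.refl _ = S.resp (*-cancelᴿ b≉0 (R.sym (top-unique (n ℕ.+ d) bs∈
            (low-0 S.0-closed (n ℕ.+ d)) (shift-part c∈) (Low-shift n r∈)
            (R.trans (R.+-identityʳ _) (R.trans (R.*-congˡ p) (R.distribˡ b c r)))))) c∈
    ... | tri> _ _ e<n = S.resp (R.sym s≈r) (go n r∈ (S.resp (R.*-congˡ s≈r) bs∈))
      where
      c≈0 : c R.≈ R.0#
      c≈0 = cancel (top-unique (n ℕ.+ d) (shift-part c∈) (Low-shift n r∈) S.0-closed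
              (low-≤ S.0-closed (ℕₚ.≤⇒≤′ (ℕₚ.+-monoˡ-≤ d e<n)) (low-single S.0-closed (e ℕ.+ d) bs∈))
              (R.trans (R.sym (R.distribˡ b c r)) (R.trans (R.*-congˡ (R.sym p)) (R.sym (R.+-identityˡ _)))))
      s≈r : s R.≈ r
      s≈r = R.trans p (R.trans (R.+-congʳ c≈0) (R.+-identityˡ r))

  -- Global functions over a finite field.

  module _ {q : ℕ} (enumerate : Fin q → CommutativeRing.Carrier k)
           (enumerated : ∀ a → ∃[ i ] CommutativeRing._≈_ k (enumerate i) a) where

    -- If x = a / b, the elements s with x s ∈ S form an ideal which is
    -- contained in no point.  Hence it contains some S_M, and x acts on the
    -- finite set S_M.
    module GlobalFunction {x : K.Carrier} (global : ∀ P → O P x) {d a b} (a∈ : S.Part d a)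
                          (b∈ : S.Part d b × NonZeroᴿ b) (x≈a/b : x ≈ a∈ / b∈) where
      private
        Quotient : Pred R.Carrier 0ℓ
        Quotient s = ∃[ s′ ] s R.* a R.≈ b R.* s′

        Denominator : Set₁
        Denominator = Lift 1ℓ (∃[ s ] ∃[ m ] S.Part m s × Quotient s)

        value′ : Denominator → R.Carrier
        value′ (lift (s , _)) = s

        homogeneous : List Denominator → List Homogeneous
        homogeneous []                          = []
        homogeneous (lift (s , m , s∈ , _) ∷ L) = (s , lift (m , s∈)) ∷ homogeneous L

        in-homogeneous : ∀ L {s} → (value′ ⟨ L ⟩) s → Elements (homogeneous L) s
        in-homogeneous (_ ∷ L) (here e)  = inj₁ e
        in-homogeneous (_ ∷ L) (there i) = inj₂ (in-homogeneous L i)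

        out-homogeneous : ∀ L {s} → Elements (homogeneous L) s → (∃[ m ] S.Part m s) × Quotient s
        out-homogeneous (lift (_ , m , s∈ , q) ∷ L) (inj₁ ≡.refl) = (m , s∈) , q
        out-homogeneous (_ ∷ L)                     (inj₂ i)     = out-homogeneous L i

        quotient : ∀ L {s} → Ideal (Elements (homogeneous L)) s → Quotient s
        quotient L (span-gen i)       = proj₂ (out-homogeneous L i)
        quotient L span-0            = R.0# , R.trans (R.zeroˡ a) (R.sym (R.zeroʳ b))
        quotient L (span-+ p q)     =
          let (s , e) = quotient L p ; (t , f) = quotient L q
          in s R.+ t , R.trans (R.distribʳ a _ _) (R.trans (R.+-cong e f) (R.sym (R.distribˡ b s t)))
        quotient L (span-* {r} _ p) =
          let (s , e) = quotient L p
          in r R.* s , R.trans (R.*-assoc _ _ _) (R.trans (R.*-congˡ e)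
               (RS.solve 3 (λ r b s → r RS.:* (b RS.:* s) RS.:= b RS.:* (r RS.:* s)) R.refl r b s))
        quotient L (span-≈ e p)    = let (s , f) = quotient L p in s , R.trans (R.*-congʳ (R.sym e)) f

        L : List Denominator
        L = proj₁ (finitely-generated value′)

        -- At any point, x can be written with a denominator that does not vanish there, so the
        -- denominators have no common zero.
        improper : ¬ Proper (homogeneous L)
        improper proper =
          let (P , L⊆P) = nonempty (homogeneous L) proper
              (m , α , β , α∈ , β∈ , β∉P , e) = O⇒/ P (global P)
              β∈L = proj₂ (finitely-generated value′) (lift (β , m , proj₁ β∈ , α ,
                      R.trans (R.*-comm β a) (R.trans (/-≈⁻¹ a∈ b∈ α∈ β∈ (trans (sym x≈a/b) e))
                        (R.*-comm α b))))
          in β∉P (Ideal⊆ P (λ i → let i′ = in-homogeneous L i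
                              in L⊆P (proj₂ (proj₁ (out-homogeneous L i′))) i′) β∈L)

        stable-degree : ∃[ m ] ∀ {s} → S.Part m s → Ideal (Elements (homogeneous L)) s
        stable-degree = decidable-stable em (λ ∄ → improper (λ m → decidable-stable em (λ ∄s →
          ∄ (m , λ {s} s∈ → decidable-stable em (λ s∉ → ∄s (s , s∈ , s∉))))))

        m : ℕ
        m = proj₁ stable-degree

        act : ∃ (S.Part m) → ∃ (S.Part m)
        act (s , s∈) =
          let (s′ , e) = quotient L (proj₂ stable-degree s∈)
          in s′ , quotient-part (proj₁ b∈) (proj₂ b∈) (S.resp e (S.*-closed s∈ a∈))

        act-eq : ∀ s → proj₁ s R.* a R.≈ b R.* proj₁ (act s)
        act-eq (s , s∈) = proj₂ (quotient L (proj₂ stable-degree s∈))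

        open Dehomogenise (proj₁ (proj₁ dimension-1)) using (y; y^; y^∈)

        -- The elements xⁿ yᵐ of S_m, with y a coordinate not vanishing at some point; division by
        -- yᵐ recovers the powers of x.
        orbit : ℕ → ∃ (S.Part m)
        orbit zero    = y ^ᴿ m , y^∈ m
        orbit (suc n) = act (orbit n)

        orbit-power : ∀ n → proj₂ (orbit n) / y^ m ≈ x ^ n
        orbit-power zero    = /-1 (y^∈ m) (y^ m)
        orbit-power (suc n) =
          let (s , s∈) = orbit n ; (s′ , s′∈) = orbit (suc n)
          in trans (/-* a∈ b∈ s∈ (y^ m) s′∈ (y^ m)
               (R.trans (RS.solve 3 (λ s b y → s RS.:* (b RS.:* y) RS.:= (b RS.:* s) RS.:* y)
                 R.refl s′ b (y ^ᴿ m))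
                 (R.*-congʳ (R.trans (R.sym (act-eq (orbit n))) (R.*-comm s a)))))
               (*-cong (sym x≈a/b) (orbit-power n))

      repetition : ∃[ i ] ∃[ r ] x ^ i ≈ x ^ (i ℕ.+ suc r)
      repetition =
        let (N , f , p) = part-finite enumerate enumerated m
            index = λ (n : Fin (suc N)) → proj₁ (p (proj₂ (orbit (toℕ n))))
            (i , j , i<j , e) = Finₚ.pigeonhole (ℕₚ.n<1+n N) index
            (r , eq) = ℕₚ.m≤n⇒∃[o]m+o≡n i<j
            same : proj₁ (orbit (toℕ i)) R.≈ proj₁ (orbit (toℕ j))
            same = R.trans (R.sym (proj₂ (p (proj₂ (orbit (toℕ i))))))
                     (R.trans (R.reflexive (≡.cong f e)) (proj₂ (p (proj₂ (orbit (toℕ j))))))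
        in toℕ i , r , trans (sym (orbit-power (toℕ i)))
             (trans (/-≈ (proj₂ (orbit (toℕ i))) (y^ m) (proj₂ (orbit (toℕ j))) (y^ m) (R.*-congʳ same))
             (trans (orbit-power (toℕ j))
               (reflexive (≡.cong (x ^_) (≡.trans (≡.sym eq) (≡.sym (ℕₚ.+-suc (toℕ i) r)))))))

    -- Two powers of x coincide because S_m is finite; cancelling leaves x · xʳ = 1. So the inverse
    -- is a power of x and is regular wherever x is.
    global-unit : ∀ {x} → (∀ P → O P x) → x ≉0 → ∀ P → O P (inv x)
    global-unit {x} global x≉0 P =
      let (d , a , b , a∈ , b∈ , e) = /-surjective x
          (i , r , eq) = GlobalFunction.repetition global a∈ b∈ e
          1≈ : x * x ^ r ≈ 1#
          1≈ = sym (*-cancelˡ (^-≉0 x≉0 i) (trans (*-identityʳ _) (trans eq (^-homo-* x i (suc r)))))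
      in O-resp (inv-unique 1≈) (power r)
      where
      open Local P
      power : ∀ n → O P (x ^ n)
      power zero    = O-1
      power (suc n) = O-* (global P) (power n)

  -- Orders and local equations of divisors.

  opaque
    unfolding _≈_ O

    ord≥-in : ∀ P n f → Local.Ord≥ P n f → Ord≥ P n f
    ord≥-in P (+ n)      f p = p
    ord≥-in P (-[1+ n ]) f p = p

    ord≥-out : ∀ P n f → Ord≥ P n f → Local.Ord≥ P n f
    ord≥-out P (+ n)      f p = p
    ord≥-out P (-[1+ n ]) f p = p

    O-mono : ∀ P Q → Q ≤ P → ∀ {f} → O P f → O Q f
    O-mono P Q Q≤P (fraction a b a∈ b∈ b∉ , p) = fraction a b a∈ b∈ (λ b∈Q → b∉ (Q≤P b∈Q)) , p

    O-generic : ∀ P → P ≤ η → ∀ f → O P f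
    O-generic P P≤η f@(fraction a b a∈ b∈ b∉) = fraction a b a∈ b∈ (λ b∈P → b∉ (P≤η b∈P)) , K.refl {f}

  -- A point that is not closed is generic, and its local ring is K. This is why conditions imposed
  -- at closed points decide regularity everywhere.
  O-nonclosed : ∀ P → ¬ IsClosedPoint P → ∀ f → O P f
  O-nonclosed P ¬closed = O-generic P (decidable-stable em (λ P≰η → ¬closed (≰η⇒closed P P≰η)))

  ≋-closed : ∀ P Q → Q ≋ P → IsClosedPoint P → IsClosedPoint Q
  ≋-closed P Q (Q≤P , P≤Q) closed R Q≤R x∈ = P≤Q (closed R (λ y∈ → Q≤R (P≤Q y∈)) x∈)

  ∈-≋ : ∀ U P Q → P ≋ Q → P ∈ U → Q ∈ U
  ∈-≋ U P Q (_ , Q≤P) PU = let (_ , _ , _ , f∉P , D⊆U) = Open.basic U PU in D⊆U {Q} (λ f∈Q → f∉P (Q≤P f∈Q))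

  HasOrd : Point → ℤ → Pred K.Carrier 0ℓ
  HasOrd P = Local.Ord P

  Ord-in : ∀ P {n f} → HasOrd P n f → Ord P n f
  Ord-in P {n} {f} (p , q) = ord≥-in P n f p , λ r → q (ord≥-out P (1ℤ ℤ.+ n) f r)

  Ord-out : ∀ P {n f} → Ord P n f → HasOrd P n f
  Ord-out P {n} {f} (p , q) = ord≥-out P n f p , λ r → q (ord≥-in P (1ℤ ℤ.+ n) f r)

  module _ (P : Point) (closed : IsClosedPoint P) where
    open ClosedPoint {P} closed using ()
      renaming ( ord-* to *-ord; ord-inv to inv-ord; t^-ord to power-ord; ord-resp to ≈-ord; ord-≉0 to ≉0-ord
               ; ord-exists to exists-ord; ord-unit to unit-ord′; unit-ord to ord-unit′
               ; ord-unique to unique-ord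
               ; Ord≥⇒O to Ord≥⇒O′; O⇒Ord≥ to O⇒Ord≥′; t to τ) public

  ≋-sym : ∀ P Q → P ≋ Q → Q ≋ P
  ≋-sym P Q (P≤Q , Q≤P) = Q≤P , P≤Q

  opaque
    unfolding O

    M-≋ : ∀ P Q → P ≋ Q → ∀ {x} → M P x → M Q x
    M-≋ P Q (P≤Q , Q≤P) (fraction a b a∈ b∈ b∉ , a∈P , p) =
      fraction a b a∈ b∈ (λ b∈Q → b∉ (Q≤P b∈Q)) , P≤Q a∈P , p

  uniformizer-≋ : ∀ P Q → P ≋ Q → ∀ {t} → Local.Uniformizer P t → Local.Uniformizer Q t
  uniformizer-≋ P Q P≋Q (t∈ , gen) = M-≋ P Q P≋Q t∈ , λ f f∈ →
    let (a , a∈ , e) = gen f (M-≋ Q P (≋-sym P Q P≋Q) f∈) in a , O-mono P Q (proj₂ P≋Q) a∈ , e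

  ord≥-≋ : ∀ P Q → P ≋ Q → ∀ n {f} → Local.Ord≥ P n f → Local.Ord≥ Q n f
  ord≥-≋ P Q P≋Q (+ n) p t t∈ =
    let (a , a∈ , e) = p t (uniformizer-≋ Q P (≋-sym P Q P≋Q) t∈) in a , O-mono P Q (proj₂ P≋Q) a∈ , e
  ord≥-≋ P Q P≋Q (-[1+ n ]) p t t∈ = O-mono P Q (proj₂ P≋Q) (p t (uniformizer-≋ Q P (≋-sym P Q P≋Q) t∈))

  ord-≋ : ∀ P Q → P ≋ Q → ∀ {n f} → HasOrd P n f → HasOrd Q n f
  ord-≋ P Q P≋Q {n} (p , q) = ord≥-≋ P Q P≋Q n p , λ r → q (ord≥-≋ Q P (≋-sym P Q P≋Q) (1ℤ ℤ.+ n) r)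

  -- The stalks are written inline in the definition of `𝓛`; unification extracts them here, which
  -- gives them a name.
  𝓛-stalks : ∀ D → ∃[ I ] sheaf I ≡ 𝓛 D
  𝓛-stalks D = _ , ≡.refl

  𝓛-stalks-out : ∀ D P {f g} → InStalk (proj₁ (𝓛-stalks D)) P f → ∀ p → HasOrd P (coeff D P p) g → O P (f * g)
  𝓛-stalks-out D P {f} {g} f∈ p g-ord = Local.O-resp P (*-congˡ (inv-inv (≉0-ord P p {coeff D P p} g-ord)))
    (Ord≥⇒O′ P p (inv-ord P p {coeff D P p} g-ord) (ord≥-out P (ℤ.- coeff D P p) f (f∈ p)))

  𝓛-stalks-in : ∀ D P {f} → (∀ p → ∃[ g ] HasOrd P (coeff D P p) g × O P (f * g)) →
    InStalk (proj₁ (𝓛-stalks D)) P f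
  𝓛-stalks-in D P {f} h p =
    let (g , g-ord , fg∈) = h p
    in ord≥-in P (ℤ.- coeff D P p) f (O⇒Ord≥′ P p (inv-ord P p {coeff D P p} g-ord)
         (Local.O-resp P (*-congˡ (sym (inv-inv (≉0-ord P p {coeff D P p} g-ord)))) fg∈))

  ord-with : ∀ P p n → ∃[ g ] HasOrd P n g
  ord-with P p n = τ P p ^ᶻ n , power-ord P p n

  support-of-function : ∀ f → f ≉0 → ∃[ L ] ∀ Q → IsClosedPoint Q → ¬ Any (Q ≋_) L → Local.Unit Q f
  support-of-function f f≉0 =
    let (d , a , b , a∈ , b∈ , e) = /-surjective f
        a≉0 = λ a≈0 → f≉0 (trans e (⇒/≈0 a∈ b∈ a≈0))
        (L , p) = zeros a∈ a≉0
        (M , q) = zeros (proj₁ b∈) (proj₂ b∈)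
    in L ++ M , λ Q closed Q∉ → Local.∉M⇒unit Q
         (Local.O-resp Q (sym e) (/∈O Q a∈ b∈ (λ b∈Q → Q∉ (Anyₚ.++⁺ʳ L (q Q closed b∈Q)))))
         (λ f∈M → Q∉ (Anyₚ.++⁺ˡ (p Q closed (M/⇒∈ Q a∈ b∈ (Local.M-resp Q e f∈M)))))

  -- The sign is that of a generator of `𝓛 D`, the inverse of what is usually called a local
  -- equation of `D`.
  LocalEquation : Divisor → Open → K.Carrier → Set₁
  LocalEquation D U e = e ≉0 × (∀ Q → Q ∈ U → ∀ p → HasOrd Q (ℤ.- coeff D Q p) e)

  -- At a closed point, a function of the prescribed order works on a neighbourhood that meets
  -- neither the rest of the support nor the other zeros and poles of that function. At any other
  -- point, 1 works away from the support.
  local-equation : ∀ D P → Σ[ U ∈ Open ] P ∈ U × ∃[ e ] LocalEquation D U e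
  local-equation D P with em {P = IsClosedPoint P}
  ... | no ¬closed =
    let (U , PU , p) = isolate (support D) P
    -- A closed point of the support in `U` would be equivalent to `P`, which is not closed; so all
    -- coefficients on `U` are 0, the order of 1.
    in U , PU , 1# , IsField.1≉0 𝕂-isField , λ Q QU closed →
       ≡.subst (λ n → HasOrd Q n 1#)
         (≡.sym (≡.cong ℤ.-_ (decidable-stable em (λ n≢0 → ¬closed (≋-closed Q P
           (≋-sym Q P (p Q QU closed (supported D Q closed n≢0))) closed)))))
         (unit-ord′ Q closed (Local.unit-1 Q))
  ... | yes closed =
    let n = ℤ.- coeff D P closed
        (e , e-ord) = ord-with P closed n
        e≉0 = ≉0-ord P closed {n} e-ord
        (L , q) = support-of-function e e≉0
        (U , PU , p) = isolate (support D ++ L) P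
    in U , PU , e , e≉0 , λ Q QU closed′ → equation e-ord L q {U} p Q QU closed′ (em {P = Q ≋ P})
    where
    equation : ∀ {e} → HasOrd P (ℤ.- coeff D P closed) e →
               ∀ L → (∀ Q → IsClosedPoint Q → ¬ Any (Q ≋_) L → Local.Unit Q e) →
               ∀ {U} → (∀ Q → Q ∈ U → IsClosedPoint Q → Any (Q ≋_) (support D ++ L) → Q ≋ P) →
               ∀ Q → Q ∈ U → ∀ closed′ → Dec (Q ≋ P) → HasOrd Q (ℤ.- coeff D Q closed′) e
    equation {e} e-ord L q p Q QU closed′ (yes Q≋P) =
      ≡.subst (λ n → HasOrd Q n e) (≡.cong ℤ.-_ (≡.sym (coeff-≋ D closed′ closed Q≋P)))
        (ord-≋ P Q (≋-sym Q P Q≋P) {ℤ.- coeff D P closed} e-ord)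
    equation {e} e-ord L q p Q QU closed′ (no Q≭P) =
      ≡.subst (λ n → HasOrd Q n e)
        (≡.sym (≡.cong ℤ.-_ (decidable-stable em
          (λ n≢0 → Q≭P (p Q QU closed′ (Anyₚ.++⁺ˡ (supported D Q closed′ n≢0)))))))
        (unit-ord′ Q closed′ (q Q closed′ (λ Q∈L → Q≭P (p Q QU closed′ (Anyₚ.++⁺ʳ (support D) Q∈L)))))

  -- Sections of subsheaves of the constant sheaf K.

  opaque
    unfolding _≈_ O

    K-+ : ∀ x y → x K.+ y ≈ x + y
    K-+ x y = refl {x K.+ y}

    K-* : ∀ x y → x K.* y ≈ x * y
    K-* x y = refl {x K.* y}

    K-0 : K.0# ≈ 0#
    K-0 = refl {K.0#}

    1-value : K.1# ≈ 1#
    1-value = refl {K.1#}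

    O⇒𝒪ˢ : ∀ P {f} → O P f → InStalk 𝒪ˢ P f
    O⇒𝒪ˢ P f∈ = lift f∈

    𝒪ˢ⇒O : ∀ P {f} → InStalk 𝒪ˢ P f → O P f
    𝒪ˢ⇒O P (lift f∈) = f∈

    stalk-resp′ : ∀ I P {f g} → f ≈ g → InStalk I P f → InStalk I P g
    stalk-resp′ I P {f} {g} e = stalk-resp I P {f} {g} e

    stalk-*′ : ∀ I P {a f} → O P a → InStalk I P f → InStalk I P (a * f)
    stalk-*′ I P {a} {f} = stalk-* I P {a} {f}

  η∈ : ∀ U P → P ∈ U → η ∈ U
  η∈ U P PU = let (_ , _ , _ , f∉P , D⊆U) = Open.basic U PU in D⊆U {η} (∉⇒≉0 P f∉P)

  module _ {I : Stalks} {U : Open} (s : Section I U) where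
    private
      at-η : ∀ P PU → value s η (η∈ U P PU) ≈ value s P PU
      at-η P PU = let (V , PV , c) = locallyConstant s P PU in ≈-in (c η (η∈ V P PV) (η∈ U P PU))

      η-irrelevant : ∀ (p q : η ∈ U) → value s η p ≈ value s η q
      η-irrelevant p q = let (V , PV , c) = locallyConstant s η q in ≈-in (c η PV p)

    -- Each local constancy neighbourhood contains η, so every value agrees with the value at η.
    value-constant : ∀ P PU Q QU → value s P PU ≈ value s Q QU
    value-constant P PU Q QU = trans (sym (at-η P PU)) (trans (η-irrelevant _ _) (at-η Q QU))

  section : ∀ {I U} (v : ∀ P → P ∈ U → K.Carrier) → (∀ P PU Q QU → v P PU ≈ v Q QU) →
            (∀ P PU → InStalk I P (v P PU)) → Section I U
  section {I} {U} v v-constant v∈ = record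
    { value           = v
    ; locallyConstant = λ P PU → U , PU , λ Q _ QU → ≈-out (v-constant Q QU P PU)
    ; inStalk         = v∈
    }

  constant : ∀ {I U} c → (∀ P → P ∈ U → InStalk I P c) → Section I U
  constant c c∈ = section (λ _ _ → c) (λ _ _ _ _ → refl) c∈

  -- Says I = e 𝒪 over `U`, stalk by stalk and through the quotient by e. It covers 𝒪 with e = 1 and
  -- `𝓛 D` with a local equation.
  record Generator (I : Stalks) (U : Open) (e : K.Carrier) : Set₁ where
    field
      nonzero  : e ≉0
      quotient : ∀ Q → Q ∈ U → ∀ {f} → InStalk I Q f → O Q (f * inv e)
      multiple : ∀ Q → Q ∈ U → ∀ {f} → O Q (f * inv e) → InStalk I Q f

  open Generator

  module _ {I U e} (gen : Generator I U e) where
    generator-section : Section I U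
    generator-section = constant e (λ Q QU → multiple gen Q QU {e}
      (Local.O-resp Q (sym (inv-inverse (nonzero gen))) (Local.O-1 Q)))

    quotient-section : ∀ {V} → V ⊆ U → Section I V → Section 𝒪ˢ V
    quotient-section i s = section (λ P PV → value s P PV * inv e)
      (λ P PV Q QV → *-congʳ (value-constant s P PV Q QV))
      (λ P PV → O⇒𝒪ˢ P (quotient gen P (⊆-elim i PV) {value s P PV} (inStalk s P PV)))

  line-bundle : ∀ {I} → (∀ P → Σ[ U ∈ Open ] P ∈ U × ∃[ e ] Generator I U e) → IsLineBundle (sheaf I)
  line-bundle {I} principal P =
    let (U , PU , e , gen) = principal P
        e≉0 = nonzero gen
    in U , PU , (λ _ → generator-section gen) , λ i s →
       (λ _ → quotient-section gen i s)
       , (λ Q QV → ≈-out (trans (sym (/-cancel e≉0)) (sym (combination (value s Q QV * inv e) e))))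
       , λ { b p zero Q QV → ≈-out
            (trans (*-congʳ (trans (≈-in (p Q QV)) (combination (value (b zero) Q QV) e))) (*/-cancel e≉0)) }
    where
    combination : ∀ a e → (a K.* e) K.+ K.0# ≈ a * e
    combination a e = trans (K-+ (a K.* e) K.0#) (trans (+-cong (K-* a e) K-0) (+-identityʳ _))

  sheaf-≅ : ∀ {I J} → (∀ P {f} → InStalk I P f → InStalk J P f) → (∀ P {f} → InStalk J P f → InStalk I P f) →
            sheaf I ≅ sheaf J
  sheaf-≅ {I} {J} I⊆J J⊆I = record
    { to = inclusion′ {I} {J} I⊆J ; from = inclusion′ {J} {I} J⊆I
    ; from-to = λ U s P PU → K.refl {value s P PU} ; to-from = λ U s P PU → K.refl {value s P PU}
    }
    where
    inclusion′ : ∀ {I J} → (∀ P {f} → InStalk I P f → InStalk J P f) → Hom (sheaf I) (sheaf J)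
    inclusion′ {I} {J} I⊆J = record
      { map     = λ U s → section (value s) (value-constant s) (λ P PU → I⊆J P {value s P PU} (inStalk s P PU))
      ; linear  = λ U → linear-from (𝒪-Module.Γ (sheaf I) U) (𝒪-Module.Γ (sheaf J) U) _ id
          (λ s t P PU → K.refl {value s P PU K.+ value t P PU})
            (λ a s P PU → K.refl {value a P PU K.* value s P PU})
      ; natural = λ i s P PV → K.refl {value s P (⊆-elim i PV)}
      }

  -- The factor `c` carries a linear equivalence: products of sections of `𝓛 D` and `𝓛 G` land in
  -- `𝓛 F` after multiplication by a function with divisor D + G - F.
  Multiplies : Stalks → Stalks → Stalks → K.Carrier → Set₁
  Multiplies I J I′ c = ∀ P {f g} → InStalk I P f → InStalk J P g → InStalk I′ P (c * (f * g))

  multiplication : ∀ {I J I′ c} → Multiplies I J I′ c → Bilinear (sheaf I) (sheaf J) (sheaf I′)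
  multiplication {I} {J} {I′} {c} m = record
    { map     = λ U s l → section (λ P PU → product (value s P PU) (value l P PU))
        (λ P PU Q QU → *-congˡ (*-cong (value-constant s P PU Q QU) (value-constant l P PU Q QU)))
        (λ P PU → m P {value s P PU} {value l P PU} (inStalk s P PU) (inStalk l P PU))
    ; linearˡ = λ U l → linear-from (𝒪-Module.Γ (sheaf I) U) (𝒪-Module.Γ (sheaf I′) U) _
        (λ {s} {t} p P PU → product-cong {value s P PU} {value t P PU} {value l P PU} {value l P PU}
          (p P PU) (K.refl {value l P PU}))
        (λ s t P PU → product-+ˡ (value s P PU) (value t P PU) (value l P PU))
        (λ a s P PU → product-*ˡ (value a P PU) (value s P PU) (value l P PU))
    ; linearʳ = λ U s → linear-from (𝒪-Module.Γ (sheaf J) U) (𝒪-Module.Γ (sheaf I′) U) _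
        (λ {l} {t} p P PU → product-cong {value s P PU} {value s P PU} {value l P PU} {value t P PU}
          (K.refl {value s P PU}) (p P PU))
        (λ l t P PU → product-+ʳ (value s P PU) (value l P PU) (value t P PU))
        (λ a l P PU → product-*ʳ (value a P PU) (value s P PU) (value l P PU))
    ; natural = λ i s l P PV → K.refl {product (value s P (⊆-elim i PV)) (value l P (⊆-elim i PV))}
    }
    where
    product : K.Carrier → K.Carrier → K.Carrier
    product s l = c * (s * l)

    product-cong : ∀ {s s′ l l′} → s K.≈ s′ → l K.≈ l′ → product s l K.≈ product s′ l′
    product-cong {s} {s′} {l} {l′} p q =
      ≈-out {product s l} {product s′ l′} (*-congˡ (*-cong (≈-in {s} {s′} p) (≈-in {l} {l′} q)))

    product-+ˡ : ∀ s t l → product (s K.+ t) l K.≈ product s l K.+ product t l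
    product-+ˡ s t l = ≈-out {product (s K.+ t) l} {product s l K.+ product t l}
      (trans (*-congˡ (*-congʳ (K-+ s t))) (trans
        (solve 4 (λ c s t l → c :* ((s :+ t) :* l) := c :* (s :* l) :+ c :* (t :* l)) refl c s t l)
        (sym (K-+ (product s l) (product t l)))))

    product-*ˡ : ∀ a s l → product (a K.* s) l K.≈ a K.* product s l
    product-*ˡ a s l = ≈-out {product (a K.* s) l} {a K.* product s l}
      (trans (*-congˡ (*-congʳ (K-* a s))) (trans
        (solve 4 (λ c a s l → c :* ((a :* s) :* l) := a :* (c :* (s :* l))) refl c a s l)
        (sym (K-* a (product s l)))))

    product-+ʳ : ∀ s l t → product s (l K.+ t) K.≈ product s l K.+ product s t
    product-+ʳ s l t = ≈-out {product s (l K.+ t)} {product s l K.+ product s t}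
      (trans (*-congˡ (*-congˡ (K-+ l t))) (trans
        (solve 4 (λ c s t l → c :* (s :* (l :+ t)) := c :* (s :* l) :+ c :* (s :* t)) refl c s t l)
        (sym (K-+ (product s l) (product s t)))))

    product-*ʳ : ∀ a s l → product s (a K.* l) K.≈ a K.* product s l
    product-*ʳ a s l = ≈-out {product s (a K.* l)} {a K.* product s l}
      (trans (*-congˡ (*-congˡ (K-* a l))) (trans
        (solve 4 (λ c a s l → c :* (s :* (a :* l)) := a :* (c :* (s :* l))) refl c a s l)
        (sym (K-* a (product s l)))))

  bilinear-⊕ : ∀ {M M′ L N N′} → Bilinear M L N → Bilinear M′ L N′ → Bilinear (M ⊕ M′) L (N ⊕ N′)
  bilinear-⊕ {M} {M′} {L} {N} {N′} σ τ = record
    { map     = λ U (m , m′) l → Bilinear.map σ U m l , Bilinear.map τ U m′ l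
    ; linearˡ = λ U l → linear-from (𝒪-Module.Γ (M ⊕ M′) U) (𝒪-Module.Γ (N ⊕ N′) U) _
        (λ (p , q) → BilinearˡProperties.⟦⟧-cong σ U l p , BilinearˡProperties.⟦⟧-cong τ U l q)
        (λ _ _ → BilinearˡProperties.+ᴹ-homo σ U l _ _ , BilinearˡProperties.+ᴹ-homo τ U l _ _)
        (λ a _ → BilinearˡProperties.*ₗ-homo σ U l a _ , BilinearˡProperties.*ₗ-homo τ U l a _)
    ; linearʳ = λ U (m , m′) → linear-from (𝒪-Module.Γ L U) (𝒪-Module.Γ (N ⊕ N′) U) _
        (λ p → BilinearʳProperties.⟦⟧-cong σ U m p , BilinearʳProperties.⟦⟧-cong τ U m′ p)
        (λ _ _ → BilinearʳProperties.+ᴹ-homo σ U m _ _ , BilinearʳProperties.+ᴹ-homo τ U m′ _ _)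
        (λ a _ → BilinearʳProperties.*ₗ-homo σ U m a _ , BilinearʳProperties.*ₗ-homo τ U m′ a _)
    ; natural = λ i (m , m′) l → Bilinear.natural σ i m l , Bilinear.natural τ i m′ l
    }

  module _ {I₁ I₂ J I₁′ I₂′ : Stalks} {c₁ c₂} (m₁ : Multiplies I₁ J I₁′ c₁) (m₂ : Multiplies I₂ J I₂′ c₂)
           (c₁≉0 : c₁ ≉0) (c₂≉0 : c₂ ≉0)
           (U : Point → Open) (P∈U : ∀ P → P ∈ U P) (e : Point → K.Carrier)
           (generator : ∀ P → Generator J (U P) (e P))
           (divides₁ : ∀ P Q → Q ∈ U P → ∀ {f} → InStalk I₁′ Q f → InStalk I₁ Q (f * inv (c₁ * e P)))
           (divides₂ : ∀ P Q → Q ∈ U P → ∀ {f} → InStalk I₂′ Q f → InStalk I₂ Q (f * inv (c₂ * e P))) where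
    private
      divided : ∀ {I I′ c} P {V} → (∀ Q → Q ∈ U P → ∀ {f} → InStalk I′ Q f → InStalk I Q (f * inv (c * e P))) →
                V ⊆ U P → Section I′ V → Section I V
      divided {c = c} P d i s = section (λ Q QV → value s Q QV * inv (c * e P))
        (λ Q QV Q′ QV′ → *-congʳ (value-constant s Q QV Q′ QV′))
        (λ Q QV → d Q (⊆-elim i QV) {value s Q QV} (inStalk s Q QV))

      requotient : ∀ l e → e ≉0 → l K.≈ (l * inv e) K.* e
      requotient l e e≉0 = ≈-out {l} {(l * inv e) K.* e} (trans (sym (/-cancel e≉0)) (sym (K-* (l * inv e) e)))

      cancel : ∀ {c} P → c ≉0 → ∀ f g → c * (f * e P) K.≈ c * (g * e P) → f K.≈ g
      cancel {c} P c≉0 f g p = ≈-out {f} {g}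
        (*-cancelʳ (nonzero (generator P)) (*-cancelˡ c≉0 (≈-in {c * (f * e P)} {c * (g * e P)} p)))

      undivide : ∀ {c} P → c ≉0 → ∀ f → c * ((f * inv (c * e P)) * e P) K.≈ f
      undivide {c} P c≉0 f = ≈-out {c * ((f * inv (c * e P)) * e P)} {f} (trans
        (solve 4 (λ c f i e → c :* ((f :* i) :* e) := (f :* i) :* (c :* e)) refl c f (inv (c * e P)) (e P))
        (/-cancel (*-≉0 c≉0 (nonzero (generator P)))))

      Mᴵ Nᴵ : 𝒪-Module
      Mᴵ = sheaf I₁ ⊕ sheaf I₂
      Nᴵ = sheaf I₁′ ⊕ sheaf I₂′

      σ : Bilinear Mᴵ (sheaf J) Nᴵ
      σ = bilinear-⊕ {sheaf I₁} {sheaf I₂} {sheaf J} {sheaf I₁′} {sheaf I₂′}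
        (multiplication {I₁} {J} {I₁′} {c₁} m₁) (multiplication {I₂} {J} {I₂′} {c₂} m₂)

      module C = TensorCriterion {Mᴵ} {sheaf J} {Nᴵ} σ U P∈U (λ P → generator-section (generator P))

    -- Multiplication by a constant times a local generator of J is injective, both being nonzero in
    -- K, and surjective, since division by that product lands in the right stalks.
    sheaf-tensor : IsTensorProduct (sheaf I₁ ⊕ sheaf I₂) (sheaf J) (sheaf I₁′ ⊕ sheaf I₂′)
    sheaf-tensor = C.isTensorProduct
      (λ P i l → quotient-section (generator P) i l , λ Q QV → requotient (value l Q QV) (e P)
        (nonzero (generator P)))
      (λ P i (s , t) (s′ , t′) (p , q) →
        (λ Q QV → cancel P c₁≉0 (value s Q QV) (value s′ Q QV) (p Q QV)) ,
        (λ Q QV → cancel P c₂≉0 (value t Q QV) (value t′ Q QV) (q Q QV)))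
      (λ P i (s , t) → (divided {I₁} {I₁′} {c₁} P (divides₁ P) i s , divided {I₂} {I₂′} {c₂} P (divides₂ P) i t)
        , (λ Q QV → undivide P c₁≉0 (value s Q QV)) , (λ Q QV → undivide P c₂≉0 (value t Q QV)))

  -- The stalks of the 𝓛 D, and the sheaves 𝓛 D and 𝒪, are parameters, lest
  -- equal sheaves be compared by unfolding them.
  module DivisorTheory
    (𝓛ˢ : Divisor → Stalks)
    (𝓛-out : ∀ D P {f g} → InStalk (𝓛ˢ D) P f → ∀ p → HasOrd P (coeff D P p) g → O P (f * g))
    (𝓛-in : ∀ D P {f} → (∀ p → ∃[ g ] HasOrd P (coeff D P p) g × O P (f * g)) → InStalk (𝓛ˢ D) P f)
    (𝓛′ : Divisor → 𝒪-Module) (𝓛′-def : ∀ D → 𝓛′ D ≡ sheaf (𝓛ˢ D))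
    (𝒪′ : 𝒪-Module) (𝒪′-def : 𝒪′ ≡ sheaf (Curve.𝒪ˢ X)) where

    -- Line bundles of divisors, their tensor products and direct sums.

    ord-subst : ∀ P {m n f} → m ≡ n → HasOrd P m f → HasOrd P n f
    ord-subst P {f = f} = ≡.subst (λ n → HasOrd P n f)

    local-generator : ∀ D {U e} → LocalEquation D U e → Generator (𝓛ˢ D) U e
    local-generator D {U} {e} (e≉0 , e-ord) = record
      { nonzero  = e≉0
      ; quotient = λ Q QU {f} f∈ → quotient′ Q QU f∈ (em {P = IsClosedPoint Q})
      ; multiple = λ Q QU {f} f/e∈ → 𝓛-in D Q {f} (λ p → inv e , inv-e-ord Q QU p , f/e∈)
      }
      where
      inv-e-ord : ∀ Q → Q ∈ U → ∀ p → HasOrd Q (coeff D Q p) (inv e)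
      inv-e-ord Q QU p = ord-subst Q (ℤₚ.neg-involutive (coeff D Q p))
        (inv-ord Q p {ℤ.- coeff D Q p} (e-ord Q QU p))

      quotient′ : ∀ Q → Q ∈ U → ∀ {f} → InStalk (𝓛ˢ D) Q f → Dec (IsClosedPoint Q) → O Q (f * inv e)
      quotient′ Q QU {f} f∈ (yes p)      = 𝓛-out D Q {f} {inv e} f∈ p (inv-e-ord Q QU p)
      quotient′ Q QU {f} f∈ (no ¬closed) = O-nonclosed Q ¬closed (f * inv e)

    𝓛-line-bundle : ∀ D → IsLineBundle (sheaf (𝓛ˢ D))
    𝓛-line-bundle D = line-bundle {𝓛ˢ D} λ P →
      let (U , PU , e , eq) = local-equation D P in U , PU , e , local-generator D eq

    𝒪-generator : ∀ U → Generator (Curve.𝒪ˢ X) U 1#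
    𝒪-generator U = record
      { nonzero  = IsField.1≉0 𝕂-isField
      ; quotient = λ Q _ {f} f∈ → Local.O-resp Q (f/1 f) (𝒪ˢ⇒O Q f∈)
      ; multiple = λ Q _ {f} f∈ → O⇒𝒪ˢ Q (Local.O-resp Q (sym (f/1 f)) f∈)
      }
      where
      f/1 : ∀ f → f ≈ f * inv 1#
      f/1 f = sym (trans (*-congˡ inv-1) (*-identityʳ f))

    whole : Open
    whole = D₊ S.1-closed

    ∈-whole : ∀ P → P ∈ whole
    ∈-whole = Point.proper

    𝒪-line-bundle : IsLineBundle (sheaf (Curve.𝒪ˢ X))
    𝒪-line-bundle = line-bundle {Curve.𝒪ˢ X} λ P → whole , ∈-whole P , 1# , 𝒪-generator whole

    0ᵈ : Divisor
    0ᵈ = record { coeff = λ _ _ → 0ℤ ; coeff-≋ = λ _ _ _ → ≡.refl ; support = [] ; supported = λ _ _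
      0≢0 → ⊥-elim (0≢0 ≡.refl) }

    infixl 6 _+ᵈ_
    _+ᵈ_ : Divisor → Divisor → Divisor
    D +ᵈ E = record
      { coeff     = λ P p → coeff D P p ℤ.+ coeff E P p
      ; coeff-≋   = λ p q P≋Q → ≡.cong₂ ℤ._+_ (coeff-≋ D p q P≋Q) (coeff-≋ E p q P≋Q)
      ; support   = support D ++ support E
      ; supported = λ P p n≢0 → supported′ P p n≢0 (coeff D P p ℤₚ.≟ 0ℤ)
      }
      where
      supported′ : ∀ P p → ¬ coeff D P p ℤ.+ coeff E P p ≡ 0ℤ → Dec (coeff D P p ≡ 0ℤ) →
                   Any (P ≋_) (support D ++ support E)
      supported′ P p n≢0 (no D≢0)  = Anyₚ.++⁺ˡ (supported D P p D≢0)
      supported′ P p n≢0 (yes D≡0) =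
        Anyₚ.++⁺ʳ (support D) (supported E P p (λ E≡0 → n≢0 (≡.cong₂ ℤ._+_ D≡0 E≡0)))

    0ᵈ-generator : Generator (𝓛ˢ 0ᵈ) whole 1#
    0ᵈ-generator = local-generator 0ᵈ {whole} {1#} (IsField.1≉0 𝕂-isField , λ Q _ p → unit-ord′ Q p {1#}
      (Local.unit-1 Q))

    𝓛0⊆𝒪 : ∀ P {f} → InStalk (𝓛ˢ 0ᵈ) P f → InStalk (Curve.𝒪ˢ X) P f
    𝓛0⊆𝒪 P {f} f∈ = multiple (𝒪-generator whole) P (∈-whole P) {f} (quotient 0ᵈ-generator P (∈-whole P) {f} f∈)

    𝒪⊆𝓛0 : ∀ P {f} → InStalk (Curve.𝒪ˢ X) P f → InStalk (𝓛ˢ 0ᵈ) P f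
    𝒪⊆𝓛0 P {f} f∈ = multiple 0ᵈ-generator P (∈-whole P) {f} (quotient (𝒪-generator whole) P (∈-whole P) {f} f∈)

    𝓛0≅𝒪 : sheaf (𝓛ˢ 0ᵈ) ≅ sheaf (Curve.𝒪ˢ X)
    𝓛0≅𝒪 = sheaf-≅ {𝓛ˢ 0ᵈ} {Curve.𝒪ˢ X} (λ P {f} → 𝓛0⊆𝒪 P {f}) (λ P {f} → 𝒪⊆𝓛0 P {f})

    module _ (D G F : Divisor) {f} (f≉0 : f ≉0)
             (f-ord : ∀ P p → HasOrd P ((coeff D P p ℤ.+ coeff G P p) ℤ.- coeff F P p) f) where
      private
        multiplies₁ : Multiplies (𝓛ˢ D) (𝓛ˢ G) (𝓛ˢ F) f
        multiplies₁ P {a} {b} a∈ b∈ = 𝓛-in F P λ p →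
          let n = coeff D P p ; m = coeff G P p ; l = coeff F P p
              (u , u-ord) = ord-with P p n
              (v , v-ord) = ord-with P p m
          in (u * v) * inv f
           , ord-subst P (arith n m l) (*-ord P p {n ℤ.+ m} {ℤ.- ((n ℤ.+ m) ℤ.- l)}
                (*-ord P p {n} {m} u-ord v-ord)
               (inv-ord P p {(n ℤ.+ m) ℤ.- l} (f-ord P p)))
           , Local.O-resp P (sym (trans
               (solve 6 (λ f a b u v i → (f :* (a :* b)) :* ((u :* v) :* i) :=
                 ((((a :* u) :* (b :* v)) :* f) :* i)) refl f a b u v (inv f))
               (*/-cancel f≉0)))
               (Local.O-* P (𝓛-out D P {a} {u} a∈ p u-ord) (𝓛-out G P {b} {v} b∈ p v-ord))
          where
          arith : ∀ n m l → (n ℤ.+ m) ℤ.+ ℤ.- ((n ℤ.+ m) ℤ.- l) ≡ l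
          arith = ℤS.solve 3 (λ n m l → (n ℤS.:+ m) ℤS.:+ ℤS.:- ((n ℤS.:+ m) ℤS.:- l) ℤS.:= l) ≡.refl

        multiplies₂ : Multiplies (Curve.𝒪ˢ X) (𝓛ˢ G) (𝓛ˢ G) 1#
        multiplies₂ P {a} {b} a∈ b∈ = stalk-resp′ (𝓛ˢ G) P {a * b} {1# * (a * b)} (sym (*-identityˡ _))
          (stalk-*′ (𝓛ˢ G) P {a} {b} (𝒪ˢ⇒O P a∈) b∈)

        U : Point → Open
        U P = proj₁ (local-equation G P)

        e : Point → K.Carrier
        e P = proj₁ (proj₂ (proj₂ (local-equation G P)))

        equation : ∀ P → LocalEquation G (U P) (e P)
        equation P = proj₂ (proj₂ (proj₂ (local-equation G P)))

        divides₁ : ∀ P Q → Q ∈ U P → ∀ {a} → InStalk (𝓛ˢ F) Q a → InStalk (𝓛ˢ D) Q (a * inv (f * e P))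
        divides₁ P Q QU {a} a∈ = 𝓛-in D Q {a * inv (f * e P)} λ p →
          let n = coeff D Q p ; m = coeff G Q p ; l = coeff F Q p
              (g , g-ord) = ord-with Q p n
          in g , g-ord , Local.O-resp Q (sym (*-assoc a (inv (f * e P)) g))
               (𝓛-out F Q {a} {inv (f * e P) * g} a∈ p
                 (ord-subst Q (arith n m l)
                   (*-ord Q p {ℤ.- (((n ℤ.+ m) ℤ.- l) ℤ.+ ℤ.- m)} {n}
                     (inv-ord Q p {((n ℤ.+ m) ℤ.- l) ℤ.+ ℤ.- m}
                       (*-ord Q p {(n ℤ.+ m) ℤ.- l} {ℤ.- m} (f-ord Q p) (proj₂ (equation P) Q QU p))) g-ord)))
          where
          arith : ∀ n m l → ℤ.- (((n ℤ.+ m) ℤ.- l) ℤ.+ ℤ.- m) ℤ.+ n ≡ l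
          arith = ℤS.solve 3 (λ n m l → ℤS.:- (((n ℤS.:+ m) ℤS.:- l) ℤS.:+ ℤS.:- m) ℤS.:+ n ℤS.:= l) ≡.refl

        divides₂ : ∀ P Q → Q ∈ U P → ∀ {a} → InStalk (𝓛ˢ G) Q a → InStalk (Curve.𝒪ˢ X) Q (a * inv (1# * e P))
        divides₂ P Q QU {a} a∈ = O⇒𝒪ˢ Q {a * inv (1# * e P)}
          (Local.O-resp Q (*-congˡ (inv-cong (sym (*-identityˡ (e P)))))
          (quotient (local-generator G {U P} {e P} (equation P)) Q QU {a} a∈))

      -- The pairing is multiplication followed by f on the first summand, and plain multiplication
      -- on the second. Asking only that D + G - F be principal lets one lemma cover both twisting
      -- and linear equivalence.
      divisor-tensor : IsTensorProduct (sheaf (𝓛ˢ D) ⊕ sheaf (Curve.𝒪ˢ X)) (sheaf (𝓛ˢ G))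
        (sheaf (𝓛ˢ F) ⊕ sheaf (𝓛ˢ G))
      divisor-tensor = sheaf-tensor {𝓛ˢ D} {Curve.𝒪ˢ X} {𝓛ˢ G} {𝓛ˢ F} {𝓛ˢ G} {f} {1#} multiplies₁ multiplies₂
        f≉0 (IsField.1≉0 𝕂-isField) U (λ P → proj₁ (proj₂ (local-equation G P))) e
        (λ P → local-generator G (equation P)) divides₁ divides₂

    module _ (M : 𝒪-Module) where
      open 𝒪-Module M

      module _ {V} {e e′ z} (e≈e′ : Γ._≈ᴹ_ V e e′) (z≈0 : Γ._≈ᴹ_ V z (Γ.0ᴹ V)) (a b : Γ𝒪.Carrier V) where
        open Γ V

        drop-second : (a *ₗ e +ᴹ (b *ₗ z +ᴹ 0ᴹ)) ≈ᴹ (a *ₗ e′ +ᴹ 0ᴹ)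
        drop-second = +ᴹ-cong (*ₗ-cong (Γ𝒪.refl V {a}) e≈e′)
          (≈ᴹ-trans (+ᴹ-identityʳ _) (≈ᴹ-trans (*ₗ-cong (Γ𝒪.refl V {b}) z≈0) (*ₗ-zeroʳ b)))

        drop-first : (a *ₗ z +ᴹ (b *ₗ e +ᴹ 0ᴹ)) ≈ᴹ (b *ₗ e′ +ᴹ 0ᴹ)
        drop-first = ≈ᴹ-trans (+ᴹ-cong (≈ᴹ-trans (*ₗ-cong (Γ𝒪.refl V {a}) z≈0) (*ₗ-zeroʳ a))
          (+ᴹ-cong (*ₗ-cong (Γ𝒪.refl V {b}) e≈e′) ≈ᴹ-refl)) (+ᴹ-identityˡ _)

    ⊕-rank-2 : ∀ {M N} → IsLineBundle M → IsLineBundle N → IsRank2Bundle (M ⊕ N)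
    ⊕-rank-2 {M} {N} M-line N-line P =
      let (U , PU , e , p) = M-line P
          (V , PV , f , q) = N-line P
          eᵁ = e zero M.∣ ∩-⊆ˡ {U} {V}
          fⱽ = f zero N.∣ ∩-⊆ʳ {U} {V}
      in U ∩ V , (PU , PV) , basis eᵁ fⱽ , λ {W} i (s , t) →
         let iᵁ = ⊆-trans i (∩-⊆ˡ {U} {V})
             iⱽ = ⊆-trans i (∩-⊆ʳ {U} {V})
             (a , a-eq , a-unique) = p iᵁ s
             (b , b-eq , b-unique) = q iⱽ t
             dropᴹ = λ x y → drop-second M {W} (M.∣-∘ (∩-⊆ˡ {U} {V}) i iᵁ (e zero)) (restrict-0 M i) x y
             dropᴺ = λ x y → drop-first N {W} (N.∣-∘ (∩-⊆ʳ {U} {V}) i iⱽ (f zero)) (restrict-0 N i) x y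
         in coefficients (a zero) (b zero)
          , (M.Γ.≈ᴹ-trans W a-eq (M.Γ.≈ᴹ-sym W (dropᴹ (a zero) (b zero))) ,
             N.Γ.≈ᴹ-trans W b-eq (N.Γ.≈ᴹ-sym W (dropᴺ (a zero) (b zero))))
          , λ { d (r , _) zero → a-unique (λ _ → d zero) (M.Γ.≈ᴹ-trans W r (dropᴹ (d zero) (d (suc zero)))) zero
              ; d (_ , r) (suc zero) → b-unique (λ _ → d (suc zero))
                   (N.Γ.≈ᴹ-trans W r (dropᴺ (d zero) (d (suc zero)))) zero }
      where
      module M = 𝒪-Module M
      module N = 𝒪-Module N

      basis : ∀ {W} → M.Γ.Carrierᴹ W → N.Γ.Carrierᴹ W → Fin 2 → M.Γ.Carrierᴹ W × N.Γ.Carrierᴹ W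
      basis {W} e f zero    = e , N.Γ.0ᴹ W
      basis {W} e f (suc _) = M.Γ.0ᴹ W , f

      coefficients : ∀ {W} → Γ𝒪.Carrier W → Γ𝒪.Carrier W → Fin 2 → Γ𝒪.Carrier W
      coefficients a b zero    = a
      coefficients a b (suc _) = b

    -- A section s is identified with the rational function s / e, for e a
    -- generator near the generic point.
    module RationalSection (L : 𝒪-Module) (L-line : IsLineBundle L) where

      -- The divisor of a line bundle.

      private module L = 𝒪-Module L

      U : Point → Open
      U P = proj₁ (L-line P)

      P∈U : ∀ P → P ∈ U P
      P∈U P = proj₁ (proj₂ (L-line P))

      open Pieces U P∈U

      gen : ∀ P → L.Γ.Carrierᴹ (U P)
      gen P = proj₁ (proj₂ (proj₂ (L-line P))) zero

      coordinate : ∀ P {V} (i : V ⊆ U P) → L.Γ.Carrierᴹ V → Γ𝒪.Carrier V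
      coordinate P i s = proj₁ (proj₂ (proj₂ (proj₂ (L-line P))) i s) zero

      coordinate-eq : ∀ P {V} (i : V ⊆ U P) s → L.Γ._≈ᴹ_ V s (L.Γ._*ₗ_ V (coordinate P i s) (gen P L.∣ i))
      coordinate-eq P {V} i s = L.Γ.≈ᴹ-trans V (proj₁ (proj₂ (proj₂ (proj₂ (proj₂ (L-line P))) i s)))
        (L.Γ.+ᴹ-identityʳ V _)

      coordinate-unique : ∀ P {V} (i : V ⊆ U P) s b → L.Γ._≈ᴹ_ V s (L.Γ._*ₗ_ V b (gen P L.∣ i)) →
                          Γ𝒪._≈_ V (coordinate P i s) b
      coordinate-unique P {V} i s b p = proj₂ (proj₂ (proj₂ (proj₂ (proj₂ (L-line P))) i s)) (λ _ → b)
        (L.Γ.≈ᴹ-trans V p (L.Γ.≈ᴹ-sym V (L.Γ.+ᴹ-identityʳ V _))) zero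

      restrict-multiple : ∀ {V W Z} (a : Γ𝒪.Carrier V) (i : V ⊆ Z) (j : W ⊆ V) (k : W ⊆ Z) t {s} →
                          L.Γ._≈ᴹ_ V s (L.Γ._*ₗ_ V a (t L.∣ i)) →
                          L.Γ._≈ᴹ_ W (s L.∣ j) (L.Γ._*ₗ_ W (a |ˢ j) (t L.∣ k))
      restrict-multiple {V} {W} a i j k t p = L.Γ.≈ᴹ-trans W (L.∣-cong j p) (L.Γ.≈ᴹ-trans W (L.∣-* j a _)
        (L.Γ.*ₗ-cong W (Γ𝒪.refl W {a |ˢ j}) (L.∣-∘ i j k t)))

      private
        generic : Open → Open
        generic V = V ∩ U η

        generic⊆ : ∀ V → generic V ⊆ V
        generic⊆ V = ∩-⊆ˡ {V} {U η}

        generic⊆U : ∀ V → generic V ⊆ U η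
        generic⊆U V = ∩-⊆ʳ {V} {U η}

        η∈generic : ∀ V P → P ∈ V → η ∈ generic V
        η∈generic V P PV = η∈ V P PV , P∈U η

        generic-coordinate : ∀ {V} → L.Γ.Carrierᴹ V → Γ𝒪.Carrier (generic V)
        generic-coordinate {V} s = coordinate η (generic⊆U V) (s L.∣ generic⊆ V)

      opaque
        rational : ∀ {V} → L.Γ.Carrierᴹ V → ∀ P → P ∈ V → K.Carrier
        rational {V} s P PV = value {Curve.𝒪ˢ X} {generic V} (generic-coordinate {V} s) η (η∈generic V P PV)

        -- Coordinates are constant and compatible with restriction, so any nonempty W on which s is
        -- a multiple of `gen η` computes the rational function. The compatibilities with the module
        -- structure rest on this.
        rational-unique : ∀ {V W} s P (PV : P ∈ V) (i : W ⊆ V) (j : W ⊆ U η) b Q (QW : Q ∈ W) →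
                          L.Γ._≈ᴹ_ W (s L.∣ i) (L.Γ._*ₗ_ W b (gen η L.∣ j)) → rational s P PV ≈ value b Q QW
        rational-unique {V} {W} s P PV i j b Q QW p =
          trans (value-constant {Curve.𝒪ˢ X} {generic V} c′ η (η∈generic V P PV) Q (⊆-elim i QW , ⊆-elim j QW))
            (trans (sym (≈-in {value (coordinate η j (s L.∣ i)) Q QW} {value (c′ |ˢ h) Q QW}
              (coordinate-unique η j (s L.∣ i) (c′ |ˢ h)
                     (L.Γ.≈ᴹ-trans W (L.Γ.≈ᴹ-sym W (L.∣-∘ (generic⊆ V) h i s))
                       (restrict-multiple c′ (generic⊆U V) h j (gen η) (coordinate-eq η (generic⊆U V) _))) Q
                         QW)))
                   (≈-in {value (coordinate η j (s L.∣ i)) Q QW} {value b Q QW}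
                     (coordinate-unique η j (s L.∣ i) b p Q QW)))
          where
          c′ : Γ𝒪.Carrier (generic V)
          c′ = generic-coordinate {V} s
          h : W ⊆ generic V
          h = inclusion (λ QW → ⊆-elim i QW , ⊆-elim j QW)

        rational-cong : ∀ {V s t} → L.Γ._≈ᴹ_ V s t → ∀ P PV → rational s P PV ≈ rational t P PV
        rational-cong {V} {s} {t} p P PV =
          rational-unique s P PV (generic⊆ V) (generic⊆U V) (generic-coordinate {V} t) η _
          (L.Γ.≈ᴹ-trans (generic V) (L.∣-cong (generic⊆ V) p) (coordinate-eq η (generic⊆U V) _))

        rational-constant : ∀ {V} (s : L.Γ.Carrierᴹ V) P (PV : P ∈ V) Q QV → rational s P PV ≈ rational s Q QV
        rational-constant {V} s P PV Q QV =
          value-constant {Curve.𝒪ˢ X} {generic V} (generic-coordinate {V} s) η (η∈generic V P PV) η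
            (η∈generic V Q QV)

        rational-+ : ∀ {V} s t P (PV : P ∈ V) →
          rational (L.Γ._+ᴹ_ V s t) P PV ≈ rational s P PV + rational t P PV
        rational-+ {V} s t P PV = trans
          (rational-unique _ P PV (generic⊆ V) (generic⊆U V) (Γ𝒪._+_ W a b) η (η∈generic V P PV)
            (L.Γ.≈ᴹ-trans W (L.∣-+ (generic⊆ V) s t) (L.Γ.≈ᴹ-trans W
              (L.Γ.+ᴹ-cong W (coordinate-eq η (generic⊆U V) _) (coordinate-eq η (generic⊆U V) _))
              (L.Γ.≈ᴹ-sym W (L.Γ.*ₗ-distribʳ W _ a b)))))
          (K-+ (value a η (η∈generic V P PV)) (value b η (η∈generic V P PV)))
          where
          W : Open
          W = generic V
          a b : Γ𝒪.Carrier W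
          a = generic-coordinate {V} s
          b = generic-coordinate {V} t

        rational-* : ∀ {V} a s P (PV : P ∈ V) → rational (L.Γ._*ₗ_ V a s) P PV ≈ value a P PV * rational s P PV
        rational-* {V} a s P PV = trans
          (rational-unique _ P PV (generic⊆ V) (generic⊆U V) (Γ𝒪._*_ W a′ b) η (η∈generic V P PV)
            (L.Γ.≈ᴹ-trans W (L.∣-* (generic⊆ V) a s) (L.Γ.≈ᴹ-trans W
              (L.Γ.*ₗ-cong W (Γ𝒪.refl W {a′}) (coordinate-eq η (generic⊆U V) _))
              (L.Γ.≈ᴹ-sym W (L.Γ.*ₗ-assoc W a′ b _)))))
          (trans (K-* (value a′ η (η∈generic V P PV)) (value b η (η∈generic V P PV)))
            (*-congʳ (value-constant {Curve.𝒪ˢ X} {V} a η (η∈ V P PV) P PV)))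
          where
          W : Open
          W = generic V
          a′ b : Γ𝒪.Carrier W
          a′ = a |ˢ generic⊆ V
          b = generic-coordinate {V} s

        rational-∣ : ∀ {V W} (i : W ⊆ V) s P (PW : P ∈ W) PV → rational (s L.∣ i) P PW ≈ rational s P PV
        rational-∣ {V} {W} i s P PW PV = sym (rational-unique s P PV (⊆-trans (generic⊆ W) i) (generic⊆U W)
          (generic-coordinate {W} (s L.∣ i)) η (η∈generic W P PW)
          (L.Γ.≈ᴹ-trans (generic W) (L.Γ.≈ᴹ-sym (generic W) (L.∣-∘ i (generic⊆ W) _ s))
            (coordinate-eq η (generic⊆U W) _)))

        -- The quotient of `gen P` by `gen η`: the transition function between the trivialisations
        -- at P and at the generic point.
        ε : Point → K.Carrier
        ε P = rational (gen P) P (P∈U P)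

        rational-gen : ∀ P Q QU → rational (gen P) Q QU ≈ ε P
        rational-gen P Q QU = rational-constant (gen P) Q QU P (P∈U P)

        ε-η : ε η ≈ 1#
        ε-η = trans (rational-unique (gen η) η (P∈U η) ⊆-refl ⊆-refl (Γ𝒪.1# (U η)) η (P∈U η)
                      (L.Γ.≈ᴹ-sym (U η) (L.Γ.*ₗ-identityˡ (U η) _)))
                1-value

      rational-multiple : ∀ P {V} (i : V ⊆ U P) s a Q (QV : Q ∈ V) →
                          L.Γ._≈ᴹ_ V s (L.Γ._*ₗ_ V a (gen P L.∣ i)) → rational s Q QV ≈ value a Q QV * ε P
      rational-multiple P {V} i s a Q QV p = trans (rational-cong p Q QV) (trans (rational-* a _ Q QV)
        (*-congˡ (trans (rational-∣ i (gen P) Q QV (⊆-elim i QV)) (rational-gen P Q _))))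

      ε-ratio : ∀ P P′ Q → Q ∈ U P → Q ∈ U P′ → ∃[ u ] O Q u × ε P ≈ u * ε P′
      ε-ratio P P′ Q QU QU′ =
        let V = U P ∩ U P′
            i = ∩-⊆ˡ {U P} {U P′}
            j = ∩-⊆ʳ {U P} {U P′}
            a = coordinate P′ j (gen P L.∣ i)
        in value a Q (QU , QU′) , 𝒪ˢ⇒O Q (inStalk a Q (QU , QU′)) ,
           trans (sym (trans (rational-∣ i (gen P) Q (QU , QU′) QU) (rational-gen P Q QU)))
             (rational-multiple P′ j (gen P L.∣ i) a Q (QU , QU′) (coordinate-eq P′ j _))

      ε≉0 : ∀ P → ε P ≉0
      ε≉0 P = let (u , _ , e) = ε-ratio η P η (P∈U η) (η∈ (U P) P (P∈U P))
              in ≉0-factorʳ {u} (≉0-resp e (≉0-resp (sym ε-η) (IsField.1≉0 𝕂-isField)))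

      -- On the overlap of two trivialisations each generator is a regular multiple of the other.
      ε-unit : ∀ P P′ Q → Q ∈ U P → Q ∈ U P′ → Local.Unit Q (ε P * inv (ε P′))
      ε-unit P P′ Q QU QU′ =
        let (u , u∈ , e) = ε-ratio P P′ Q QU QU′
            (v , v∈ , f) = ε-ratio P′ P Q QU′ QU
        in *-≉0 (ε≉0 P) (inv-≉0 (ε≉0 P′))
         , Local.O-resp Q (sym (trans (*-congʳ e) (*/-cancel (ε≉0 P′)))) u∈
         , Local.O-resp Q (sym (trans (inv-* (ε≉0 P) (inv-≉0 (ε≉0 P′))) (trans (*-congˡ (inv-inv (ε≉0 P′)))
             (trans (*-congˡ f) (trans (*-comm _ _) (*/-cancel (ε≉0 P))))))) v∈

      -- On each piece the coordinate with respect to `gen P` is the rational function divided by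
      -- `ε P`, which is not 0.
      rational-injective : ∀ {V} s t → (∀ P PV → rational s P PV ≈ rational t P PV) → L.Γ._≈ᴹ_ V s t
      rational-injective {V} s t p = locally L s t λ j →
        let P = proj₁ j
            W = piece V j
            i = piece⊆ V j
            h = piece⊆U V j
            a = coordinate P h (s L.∣ i)
            b = coordinate P h (t L.∣ i)
            a≈b : ∀ Q QW → value a Q QW ≈ value b Q QW
            a≈b Q QW = *-cancelʳ (ε≉0 P) (begin
              value a Q QW * ε P
                ≈⟨ sym (rational-multiple P h (s L.∣ i) a Q QW (coordinate-eq P h _)) ⟩
              rational (s L.∣ i) Q QW           ≈⟨ rational-∣ i s Q QW (proj₁ QW) ⟩
              rational s Q (proj₁ QW)           ≈⟨ p Q (proj₁ QW) ⟩
              rational t Q (proj₁ QW)           ≈⟨ sym (rational-∣ i t Q QW (proj₁ QW)) ⟩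
              rational (t L.∣ i) Q QW
                ≈⟨ rational-multiple P h (t L.∣ i) b Q QW (coordinate-eq P h _) ⟩
              value b Q QW * ε P                ∎)
        in L.Γ.≈ᴹ-trans W (coordinate-eq P h _) (L.Γ.≈ᴹ-trans W
             (L.Γ.*ₗ-cong W (λ Q QW → ≈-out {value a Q QW} {value b Q QW} (a≈b Q QW)) (L.Γ.≈ᴹ-refl W))
             (L.Γ.≈ᴹ-sym W (coordinate-eq P h _)))
        where open import Relation.Binary.Reasoning.Setoid setoid

      order : ∀ P → IsClosedPoint P → ℤ
      order P p = proj₁ (exists-ord P p (ε≉0 P))

      ε-ord : ∀ P Q q → Q ∈ U P → HasOrd Q (order Q q) (ε P)
      ε-ord P Q q QU = ≈-ord Q q {order Q q} (/-cancel (ε≉0 Q))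
        (ord-subst Q (ℤₚ.+-identityˡ (order Q q))
          (*-ord Q q {0ℤ} {order Q q} (unit-ord′ Q q (ε-unit P Q Q QU (P∈U Q)))
            (proj₂ (exists-ord Q q (ε≉0 Q)))))

      exceptions : ∃[ L ] ∀ Q → IsClosedPoint Q → ¬ Q ∈ U η → Any (Q ≋_) L
      exceptions =
        let (d , f , f∈ , f≉0 , D⊆U) = Open.basic (U η) (P∈U η)
            (L , p) = zeros f∈ f≉0
        in L , λ Q closed Q∉ → p Q closed (decidable-stable em (λ f∉Q → Q∉ (D⊆U {Q} f∉Q)))

      -- The stalk at P is generated by `ε P`, and sections of `𝓛 D` have order at least minus the
      -- coefficient; hence the sign. On `U η` the orders are those of ε η = 1, so the support is
      -- confined to the complement of `U η`, which has finitely many closed points.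
      divisor : Divisor
      divisor = record
        { coeff     = λ P p → ℤ.- order P p
        ; coeff-≋   = λ {P} {Q} p q P≋Q → ≡.cong ℤ.-_ (unique-ord Q q {order P p} {order Q q}
            (ord-≋ P Q P≋Q {order P p} (ε-ord P P p (P∈U P))) (ε-ord P Q q (∈-≋ (U P) P Q P≋Q (P∈U P))))
        ; support   = proj₁ exceptions
        ; supported = λ P p n≢0 → proj₂ exceptions P p (λ PU → n≢0 (≡.cong ℤ.-_ (unique-ord P p {order P p} {0ℤ}
            (≈-ord P p {order P p} ε-η (ε-ord η P p PU)) (unit-ord′ P p {1#} (Local.unit-1 P)))))
        }

      generator-ε : ∀ P → Generator (𝓛ˢ divisor) (U P) (ε P)
      generator-ε P = local-generator divisor {U P} {ε P}
        (ε≉0 P , λ Q QU q → ord-subst Q (≡.sym (ℤₚ.neg-involutive (order Q q))) (ε-ord P Q q QU))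

      rational∈ : ∀ {V} (s : L.Γ.Carrierᴹ V) P (PV : P ∈ V) → InStalk (𝓛ˢ divisor) P (rational s P PV)
      rational∈ {V} s P PV =
        let j = (P , PV)
            a = coordinate P (piece⊆U V j) (s L.∣ piece⊆ V j)
            P∈j = PV , P∈U P
        in multiple (generator-ε P) P (P∈U P) {rational s P PV} (Local.O-resp P
             (sym (trans (*-congʳ (trans (sym (rational-∣ (piece⊆ V j) s P P∈j PV))
               (rational-multiple P (piece⊆U V j) _ a P P∈j (coordinate-eq P (piece⊆U V j) _))))
                 (*/-cancel (ε≉0 P))))
             (𝒪ˢ⇒O P {value a P P∈j} (inStalk a P P∈j)))

      rational-section : ∀ {V} → L.Γ.Carrierᴹ V → Section (𝓛ˢ divisor) V
      rational-section s = section (rational s) (rational-constant s) (rational∈ s)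

      module _ {V : Open} (σ : Section (𝓛ˢ divisor) V) where
        private
          scalar : (j : Piece V) → Γ𝒪.Carrier (piece V j)
          scalar j@(P , _) = quotient-section (generator-ε P) (piece⊆U V j) (σ |ˢ piece⊆ V j)

          local-section : (j : Piece V) → L.Γ.Carrierᴹ (piece V j)
          local-section j = L.Γ._*ₗ_ (piece V j) (scalar j) (gen (proj₁ j) L.∣ piece⊆U V j)

          rational-local : ∀ j Q Q∈j → rational (local-section j) Q Q∈j ≈ value σ Q (proj₁ Q∈j)
          rational-local j@(P , _) Q Q∈j = trans
            (rational-multiple P (piece⊆U V j) (local-section j) (scalar j) Q Q∈j (L.Γ.≈ᴹ-refl (piece V j)))
            (/-cancel (ε≉0 P))

          agree : ∀ (j j′ : Piece V) W (a : W ⊆ piece V j) (b : W ⊆ piece V j′) →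
                  L.Γ._≈ᴹ_ W (local-section j L.∣ a) (local-section j′ L.∣ b)
          agree j j′ W a b = rational-injective _ _ λ Q QW → trans
            (trans (rational-∣ a (local-section j) Q QW (⊆-elim a QW)) (rational-local j Q (⊆-elim a QW)))
            (trans (value-constant σ Q (proj₁ (⊆-elim a QW)) Q (proj₁ (⊆-elim b QW)))
              (sym (trans (rational-∣ b (local-section j′) Q QW (⊆-elim b QW))
                (rational-local j′ Q (⊆-elim b QW)))))

          glued : ∃[ t ] ∀ j → L.Γ._≈ᴹ_ (piece V j) (t L.∣ piece⊆ V j) (local-section j)
          glued = L.glue (piece V) (piece⊆ V) (covers V) local-section agree

        opaque
          -- Inverse to passing to rational functions: the multiples of `gen P` by σ / ε P agree on
          -- overlaps because they have the same rational function, and are glued.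
          abstract-section : L.Γ.Carrierᴹ V
          abstract-section = proj₁ glued

          rational-abstract : ∀ P PV → rational abstract-section P PV ≈ value σ P PV
          rational-abstract P PV =
            let j = (P , PV) ; P∈j = PV , P∈U P
            in trans (sym (rational-∣ (piece⊆ V j) abstract-section P P∈j PV))
                 (trans (rational-cong (proj₂ glued j) P P∈j) (rational-local j P P∈j))

      private
        𝓛ᴸ : 𝒪-Module
        𝓛ᴸ = sheaf (𝓛ˢ divisor)

        module 𝓛ᴸ = 𝒪-Module 𝓛ᴸ

      to-divisor : Hom L 𝓛ᴸ
      to-divisor = record
        { map     = λ V → rational-section {V}
        ; linear  = λ V → linear-from (L.Γ V) (𝓛ᴸ.Γ V) (rational-section {V})
            (λ {s} {t} p P PV → ≈-out {rational s P PV} {rational t P PV} (rational-cong p P PV))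
            (λ s t P PV → ≈-out {rational (L.Γ._+ᴹ_ V s t) P PV} {rational s P PV K.+ rational t P PV}
              (trans (rational-+ s t P PV) (sym (K-+ (rational s P PV) (rational t P PV)))))
            (λ a s P PV → ≈-out {rational (L.Γ._*ₗ_ V a s) P PV} {value a P PV K.* rational s P PV}
              (trans (rational-* a s P PV) (sym (K-* (value a P PV) (rational s P PV)))))
        ; natural = λ {V} {W} i s P PW → ≈-out {rational s P (⊆-elim i PW)} {rational (s L.∣ i) P PW}
            (sym (rational-∣ i s P PW (⊆-elim i PW)))
        }

      from-divisor : Hom 𝓛ᴸ L
      from-divisor = record
        { map     = λ V → abstract-section {V}
        ; linear  = λ V → linear-from (𝓛ᴸ.Γ V) (L.Γ V) (abstract-section {V}) (cong′ V) (+′ V) (*′ V)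
        ; natural = restriction
        }
        where
        cong′ : ∀ V {σ υ : Section (𝓛ˢ divisor) V} → 𝓛ᴸ.Γ._≈ᴹ_ V σ υ →
          L.Γ._≈ᴹ_ V (abstract-section σ) (abstract-section υ)
        cong′ V {σ} {υ} p = rational-injective _ _ λ P PV → trans (rational-abstract σ P PV)
          (trans (≈-in {value σ P PV} {value υ P PV} (p P PV)) (sym (rational-abstract υ P PV)))

        restriction : ∀ {V W} (i : W ⊆ V) (σ : Section (𝓛ˢ divisor) V) →
                      L.Γ._≈ᴹ_ W (abstract-section σ L.∣ i) (abstract-section (σ |ˢ i))
        restriction i σ = rational-injective _ _ λ P PW →
          trans (rational-∣ i (abstract-section σ) P PW (⊆-elim i PW))
          (trans (rational-abstract σ P (⊆-elim i PW)) (sym (rational-abstract (σ |ˢ i) P PW)))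

        _⊞_ : ∀ {V} (σ υ : Section (𝓛ˢ divisor) V) → Section (𝓛ˢ divisor) V
        _⊞_ {V} σ υ = 𝓛ᴸ.Γ._+ᴹ_ V σ υ

        value-⊞ : ∀ {V} (σ υ : Section (𝓛ˢ divisor) V) P PV → value (σ ⊞ υ) P PV ≈ value σ P PV + value υ P PV
        value-⊞ σ υ P PV = K-+ (value σ P PV) (value υ P PV)

        _⊡_ : ∀ {V} → Γ𝒪.Carrier V → Section (𝓛ˢ divisor) V → Section (𝓛ˢ divisor) V
        _⊡_ {V} a σ = 𝓛ᴸ.Γ._*ₗ_ V a σ

        value-⊡ : ∀ {V} (a : Γ𝒪.Carrier V) (σ : Section (𝓛ˢ divisor) V) P PV →
          value (a ⊡ σ) P PV ≈ value a P PV * value σ P PV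
        value-⊡ a σ P PV = K-* (value a P PV) (value σ P PV)

        +′ : ∀ V (σ υ : Section (𝓛ˢ divisor) V) →
             L.Γ._≈ᴹ_ V (abstract-section (σ ⊞ υ)) (L.Γ._+ᴹ_ V (abstract-section σ) (abstract-section υ))
        +′ V σ υ = rational-injective _ _ λ P PV → trans (rational-abstract (σ ⊞ υ) P PV)
          (trans (value-⊞ σ υ P PV) (trans (+-cong (sym (rational-abstract σ P PV))
            (sym (rational-abstract υ P PV)))
            (sym (rational-+ (abstract-section σ) (abstract-section υ) P PV))))

        *′ : ∀ V (a : Γ𝒪.Carrier V) (σ : Section (𝓛ˢ divisor) V) →
             L.Γ._≈ᴹ_ V (abstract-section (a ⊡ σ)) (L.Γ._*ₗ_ V a (abstract-section σ))
        *′ V a σ = rational-injective _ _ λ P PV → trans (rational-abstract (a ⊡ σ) P PV)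
          (trans (value-⊡ a σ P PV) (trans (*-congˡ (sym (rational-abstract σ P PV)))
            (sym (rational-* a (abstract-section σ) P PV))))

      ≅-divisor : L ≅ sheaf (𝓛ˢ divisor)
      ≅-divisor = record
        { to      = to-divisor
        ; from    = from-divisor
        ; from-to = λ V s → rational-injective _ s λ P PV → rational-abstract (rational-section s) P PV
        ; to-from = λ V σ P PV → ≈-out {rational (abstract-section σ) P PV} {value σ P PV}
             (rational-abstract σ P PV)
        }

    -- Homomorphisms between sheaves of divisors are scalars.

    module Multiplier {I J : Stalks} (h : Hom (sheaf I) (sheaf J)) {W e} (gen : Generator I W e) (ηW : η ∈ W)
      where
      private
        map′ : ∀ V → Section I V → Section J V
        map′ V s = Hom.map h V s

        scaled : ∀ V → Section (Curve.𝒪ˢ X) V → Section I V → Section I V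
        scaled V a s = Module._*ₗ_ (𝒪-Module.Γ (sheaf I) V) a s

        map-cong : ∀ V (s t : Section I V) → (∀ P PV → value s P PV ≈ value t P PV) →
                   ∀ P PV → value (map′ V s) P PV ≈ value (map′ V t) P PV
        map-cong V s t p P PV = ≈-in {value (map′ V s) P PV} {value (map′ V t) P PV}
          (HomProperties.⟦⟧-cong h V {s} {t} (λ Q QV → ≈-out {value s Q QV} {value t Q QV} (p Q QV)) P PV)

        map-scaled : ∀ V a s P PV → value (map′ V (scaled V a s)) P PV ≈ value a P PV * value (map′ V s) P PV
        map-scaled V a s P PV = trans
          (≈-in {value (map′ V (scaled V a s)) P PV} {value a P PV K.* value (map′ V s) P PV}
            (HomProperties.*ₗ-homo h V a s P PV))
          (K-* (value a P PV) (value (map′ V s) P PV))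

        map-restrict : ∀ {V Z} (i : Z ⊆ V) s P PZ →
          value (map′ V s) P (⊆-elim i PZ) ≈ value (map′ Z (s |ˢ i)) P PZ
        map-restrict {V} {Z} i s P PZ = ≈-in {value (map′ V s) P (⊆-elim i PZ)} {value (map′ Z (s |ˢ i)) P PZ}
          (Hom.natural h i s P PZ)

      multiplier : K.Carrier
      multiplier = value (map′ W (generator-section gen)) η ηW * inv e

      -- Both sides are constant, so they may be compared at η on V ∩ W, where s is a multiple of
      -- the generator and 𝒪-linearity applies.
      acts : ∀ V s P PV → value (map′ V s) P PV ≈ multiplier * value s P PV
      acts V s P PV = trans (value-constant (map′ V s) P PV η ηV) (trans (map-restrict i s η ηZ)
        (trans (map-cong Z (s |ˢ i) (scaled Z q (E |ˢ j)) s-multiple η ηZ) (trans (map-scaled Z q (E |ˢ j) η ηZ)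
          (trans (*-congˡ (sym (map-restrict j E η ηZ)))
            (trans (solve 3 (λ s i m → (s :* i) :* m := (m :* i) :* s)
              refl (value s η ηV) (inv e) (value (map′ W E) η ηW))
              (*-congˡ (value-constant s η ηV P PV)))))))
        where
        Z : Open
        Z = V ∩ W
        i : Z ⊆ V
        i = ∩-⊆ˡ {V} {W}
        j : Z ⊆ W
        j = ∩-⊆ʳ {V} {W}
        ηV : η ∈ V
        ηV = η∈ V P PV
        ηZ : η ∈ Z
        ηZ = ηV , ηW
        E : Section I W
        E = generator-section gen
        q : Section (Curve.𝒪ˢ X) Z
        q = quotient-section gen j (s |ˢ i)
        s-multiple : ∀ Q QZ → value (s |ˢ i) Q QZ ≈ value (scaled Z q (E |ˢ j)) Q QZ
        s-multiple Q QZ = trans (sym (/-cancel (nonzero gen))) (sym (K-* (value s Q (proj₁ QZ) * inv e) e))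

    -- a 𝓛 A ⊆ 𝓛 B, tested on generators at the closed points.
    Carries : Divisor → Divisor → K.Carrier → Set₁
    Carries A B a = ∀ P p {u v} → HasOrd P (coeff A P p) u → HasOrd P (coeff B P p) v → O P ((a * v) * inv u)

    module _ (A B : Divisor) (h : Hom (sheaf (𝓛ˢ A)) (sheaf (𝓛ˢ B))) where
      private
        ηU : η ∈ proj₁ (local-equation A η)
        ηU = proj₁ (proj₂ (local-equation A η))

        genη : Generator (𝓛ˢ A) (proj₁ (local-equation A η)) (proj₁ (proj₂ (proj₂ (local-equation A η))))
        genη = local-generator A {proj₁ (local-equation A η)} {proj₁ (proj₂ (proj₂ (local-equation A η)))}
          (proj₂ (proj₂ (proj₂ (local-equation A η))))

        module μ = Multiplier {𝓛ˢ A} {𝓛ˢ B} h genη ηU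

      opaque
        scalar : K.Carrier
        scalar = μ.multiplier

        scalar-acts : ∀ V (s : Section (𝓛ˢ A) V) P PV →
          value {𝓛ˢ B} {V} (Hom.map h V s) P PV ≈ scalar * value s P PV
        scalar-acts = μ.acts

      scalar-carries : Carries A B scalar
      scalar-carries P p {u} {v} u-ord v-ord =
        let (U , PU , e , eq) = local-equation A P
            E = generator-section (local-generator A {U} {e} eq)
            hE : Section (𝓛ˢ B) U
            hE = Hom.map h U E
            (w≉0 , _ , i∈) = ord-unit′ P p (ord-subst P (ℤₚ.+-inverseʳ (coeff A P p))
              (*-ord P p {coeff A P p} {ℤ.- coeff A P p} u-ord (proj₂ eq P PU p)))
        in Local.O-resp P
             (trans (*-cong (*-congʳ (scalar-acts U E P PU)) (inv-* (≉0-factorˡ w≉0) (proj₁ eq)))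
               (trans (solve 5 (λ a e v u i → ((a :* e) :* v) :* (u :* i) := (((a :* v) :* u) :* e) :* i)
                 refl scalar e v (inv u) (inv e))
                 (*/-cancel (proj₁ eq))))
             (Local.O-* P (𝓛-out B P {value hE P PU} {v} (inStalk hE P PU) p v-ord) i∈)

    -- At a closed point the local generators cancel: (a v / u)(b u / v) = a b. At the generic point
    -- every rational function is regular.
    carries-product : ∀ {A B a b} → Carries A B a → Carries B A b → ∀ P → O P (a * b)
    carries-product {A} {B} {a} {b} a-carries b-carries P with em {P = IsClosedPoint P}
    ... | no ¬closed = O-nonclosed P ¬closed (a * b)
    ... | yes p =
      let (u , u-ord) = ord-with P p (coeff A P p)
          (v , v-ord) = ord-with P p (coeff B P p)
          u≉0 = ≉0-ord P p {coeff A P p} u-ord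
          v≉0 = ≉0-ord P p {coeff B P p} v-ord
      in Local.O-resp P (trans
           (solve 6 (λ a b u v i j → ((a :* v) :* i) :* ((b :* u) :* j) := ((((a :* b) :* u) :* i) :* v) :*
             j) refl a b u v (inv u) (inv v))
           (trans (*/-cancel v≉0) (*/-cancel u≉0)))
           (Local.O-* P (a-carries P p u-ord v-ord) (b-carries P p v-ord u-ord))

    -- a v / u is regular and its inverse is (b u / v) / (a b), which is regular too; so it is a
    -- unit, and the order of a is that of u / v.
    carries-ord : ∀ {A B a b} → Carries A B a → Carries B A b → a * b ≉0 → (∀ P → O P (inv (a * b))) →
                  ∀ P p → HasOrd P (coeff A P p ℤ.- coeff B P p) a
    carries-ord {A} {B} {a} {b} a-carries b-carries ab≉0 inv∈ P p =
      let n = coeff A P p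
          m = coeff B P p
          (u , u-ord) = ord-with P p n
          (v , v-ord) = ord-with P p m
          u≉0 = ≉0-ord P p {n} u-ord
          v≉0 = ≉0-ord P p {m} v-ord
          a≉0 = ≉0-factorˡ ab≉0
          b≉0 = ≉0-factorʳ ab≉0
          c≉0 = *-≉0 (*-≉0 a≉0 v≉0) (inv-≉0 u≉0)
          inverse∈ = Local.O-resp P (inv-unique (begin
            ((a * v) * inv u) * (((b * u) * inv v) * inv (a * b))
              ≈⟨ solve 7 (λ a b u v i j k → ((a :* v) :* i) :* (((b :* u) :* j) :* k) := ((a :* b) :* k) :*
                ((u :* i) :* (v :* j))) refl a b u v (inv u) (inv v) (inv (a * b)) ⟩
            ((a * b) * inv (a * b)) * ((u * inv u) * (v * inv v))
              ≈⟨ *-cong (inv-inverse ab≉0) (*-cong (inv-inverse u≉0) (inv-inverse v≉0)) ⟩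
            1# * (1# * 1#)
              ≈⟨ trans (*-identityˡ _) (*-identityˡ _) ⟩
            1# ∎)) (Local.O-* P (b-carries P p v-ord u-ord) (inv∈ P))
      in ord-subst P (arith n m) (≈-ord P p {(0ℤ ℤ.+ ℤ.- m) ℤ.+ n}
           (trans (solve 5 (λ a v i j u → (((a :* v) :* i) :* j) :* u := (((a :* u) :* i) :* v) :* j)
             refl a v (inv u) (inv v) u)
             (trans (*/-cancel v≉0) (*/-cancel u≉0)))
           (*-ord P p {0ℤ ℤ.+ ℤ.- m} {n}
             (*-ord P p {0ℤ} {ℤ.- m} (unit-ord′ P p (c≉0 , a-carries P p u-ord v-ord , inverse∈))
             (inv-ord P p {m} v-ord)) u-ord))
      where
      open import Relation.Binary.Reasoning.Setoid setoid
      arith : ∀ n m → (0ℤ ℤ.+ ℤ.- m) ℤ.+ n ≡ n ℤ.- m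
      arith n m = ≡.trans (≡.cong (ℤ._+ n) (ℤₚ.+-identityˡ (ℤ.- m))) (ℤₚ.+-comm (ℤ.- m) n)

    -- The identity is evaluated on a generator of `𝓛 A` near η, which then cancels.
    scalar-product-sum : ∀ A B C (f : Hom (sheaf (𝓛ˢ A)) (sheaf (𝓛ˢ B))) (g : Hom (sheaf (𝓛ˢ B)) (sheaf (𝓛ˢ A)))
      (f′ : Hom (sheaf (𝓛ˢ A)) (sheaf (𝓛ˢ C))) (g′ : Hom (sheaf (𝓛ˢ C)) (sheaf (𝓛ˢ A))) →
      SumsToIdentity {sheaf (𝓛ˢ A)} {sheaf (𝓛ˢ B)} {sheaf (𝓛ˢ C)} g f g′ f′ →
      scalar B A g * scalar A B f + scalar C A g′ * scalar A C f′ ≈ 1#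
    scalar-product-sum A B C f g f′ g′ p =
      let (U , ηU , e , eq) = local-equation A η
          E : Section (𝓛ˢ A) U
          E = generator-section (local-generator A {U} {e} eq)
          fE : Section (𝓛ˢ B) U
          fE = Hom.map f U E
          gfE : Section (𝓛ˢ A) U
          gfE = Hom.map g U fE
          f′E : Section (𝓛ˢ C) U
          f′E = Hom.map f′ U E
          g′f′E : Section (𝓛ˢ A) U
          g′f′E = Hom.map g′ U f′E
          q : e ≈ value gfE η ηU + value g′f′E η ηU
          q = trans (≈-in {e} {value gfE η ηU K.+ value g′f′E η ηU} (SumsToIdentity.identity p U E η ηU))
            (K-+ (value gfE η ηU) (value g′f′E η ηU))
          r : value gfE η ηU ≈ e * (scalar B A g * scalar A B f)
          r = trans (scalar-acts B A g U fE η ηU) (trans (*-congˡ (scalar-acts A B f U E η ηU))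
                (solve 3 (λ x y e → x :* (y :* e) := e :* (x :* y)) refl (scalar B A g) (scalar A B f) e))
          r′ : value g′f′E η ηU ≈ e * (scalar C A g′ * scalar A C f′)
          r′ = trans (scalar-acts C A g′ U f′E η ηU) (trans (*-congˡ (scalar-acts A C f′ U E η ηU))
                (solve 3 (λ x y e → x :* (y :* e) := e :* (x :* y)) refl (scalar C A g′) (scalar A C f′) e))
      in *-cancelˡ (proj₁ eq) (trans (distribˡ e _ _)
           (trans (+-cong (sym r) (sym r′)) (trans (sym q) (sym (*-identityʳ e)))))

    -- The classes of the bundles 𝓛 D ⊕ 𝒪.

    𝓛′-line-bundle : ∀ D → IsLineBundle (𝓛′ D)
    𝓛′-line-bundle D = ≡.subst IsLineBundle (≡.sym (𝓛′-def D)) (𝓛-line-bundle D)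

    𝒪′-line-bundle : IsLineBundle 𝒪′
    𝒪′-line-bundle = ≡.subst IsLineBundle (≡.sym 𝒪′-def) 𝒪-line-bundle

    𝓛′0≅𝒪′ : 𝓛′ 0ᵈ ≅ 𝒪′
    𝓛′0≅𝒪′ = ≡.subst₂ _≅_ (≡.sym (𝓛′-def 0ᵈ)) (≡.sym 𝒪′-def) 𝓛0≅𝒪

    line-bundle-divisor : ∀ L → IsLineBundle L → ∃[ D ] L ≅ 𝓛′ D
    line-bundle-divisor L L-line = divisor , ≡.subst (L ≅_) (≡.sym (𝓛′-def divisor)) ≅-divisor
      where open RationalSection L L-line

    private
      -- The defining equations of the sheaves are matched here, where the sheaves are variables, so
      -- that `𝓛′` stays abstract in what follows.
      scalarᴹ : ∀ A B {M N} → M ≡ sheaf (𝓛ˢ A) → N ≡ sheaf (𝓛ˢ B) → Hom M N → K.Carrier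
      scalarᴹ A B ≡.refl ≡.refl h = scalar A B h

      scalarᴹ-carries : ∀ A B {M N} (m : M ≡ sheaf (𝓛ˢ A)) (n : N ≡ sheaf (𝓛ˢ B)) h →
                        Carries A B (scalarᴹ A B m n h)
      scalarᴹ-carries A B ≡.refl ≡.refl h = scalar-carries A B h

      scalarᴹ-sum : ∀ A B C {M N P}
                    (m : M ≡ sheaf (𝓛ˢ A)) (n : N ≡ sheaf (𝓛ˢ B)) (p : P ≡ sheaf (𝓛ˢ C)) {g f g′ f′} →
                    SumsToIdentity {M} {N} {P} g f g′ f′ →
                    scalarᴹ B A n m g * scalarᴹ A B m n f + scalarᴹ C A p m g′ * scalarᴹ A C m p f′ ≈ 1#
      scalarᴹ-sum A B C ≡.refl ≡.refl ≡.refl {g} {f} {g′} {f′} = scalar-product-sum A B C f g f′ g′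

      tensorᴹ : ∀ D G F {f L M N O′} → L ≡ sheaf (𝓛ˢ D) → M ≡ sheaf (𝓛ˢ G) → N ≡ sheaf (𝓛ˢ F) →
                O′ ≡ sheaf (Curve.𝒪ˢ X) → f ≉0 →
                (∀ P p → HasOrd P ((coeff D P p ℤ.+ coeff G P p) ℤ.- coeff F P p) f) →
                IsTensorProduct (L ⊕ O′) M (N ⊕ M)
      tensorᴹ D G F ≡.refl ≡.refl ≡.refl ≡.refl = divisor-tensor D G F

    scalar′ : ∀ A B → Hom (𝓛′ A) (𝓛′ B) → K.Carrier
    scalar′ A B = scalarᴹ A B (𝓛′-def A) (𝓛′-def B)

    scalar′-carries : ∀ A B (h : Hom (𝓛′ A) (𝓛′ B)) → Carries A B (scalar′ A B h)
    scalar′-carries A B = scalarᴹ-carries A B (𝓛′-def A) (𝓛′-def B)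

    scalar′-sum : ∀ A B C {g f g′ f′} → SumsToIdentity {𝓛′ A} {𝓛′ B} {𝓛′ C} g f g′ f′ →
                  scalar′ B A g * scalar′ A B f + scalar′ C A g′ * scalar′ A C f′ ≈ 1#
    scalar′-sum A B C = scalarᴹ-sum A B C (𝓛′-def A) (𝓛′-def B) (𝓛′-def C)

    HasDivisor : K.Carrier → (∀ P → IsClosedPoint P → ℤ) → Set₁
    HasDivisor f n = f ≉0 × (∀ P p → HasOrd P (n P p) f)

    1-divisor : ∀ {n} → (∀ P p → n P p ≡ 0ℤ) → HasDivisor 1# n
    1-divisor n≡0 = IsField.1≉0 𝕂-isField ,
      λ P p → ord-subst P (≡.sym (n≡0 P p)) (unit-ord′ P p {1#} (Local.unit-1 P))

    divisor-/ : ∀ {f g m n l} → HasDivisor f m → HasDivisor g n → (∀ P p → m P p ℤ.- n P p ≡ l P p) →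
                HasDivisor (f * inv g) l
    divisor-/ {m = m} {n} (f≉0 , f-ord) (g≉0 , g-ord) e = *-≉0 f≉0 (inv-≉0 g≉0) , λ P p →
      ord-subst P (e P p) (*-ord P p {m P p} {ℤ.- n P p} (f-ord P p) (inv-ord P p {n P p} (g-ord P p)))

    divisor-inv : ∀ {f m n} → HasDivisor f m → (∀ P p → ℤ.- m P p ≡ n P p) → HasDivisor (inv f) n
    divisor-inv {m = m} (f≉0 , f-ord) e = inv-≉0 f≉0 , λ P p →
      ord-subst P (e P p) (inv-ord P p {m P p} (f-ord P p))

    divisor-resp : ∀ {f m n} → HasDivisor f m → (∀ P p → m P p ≡ n P p) → HasDivisor f n
    divisor-resp (f≉0 , f-ord) e = f≉0 , λ P p → ord-subst P (e P p) (f-ord P p)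

    ∼-in : ∀ D E {f} → HasDivisor f (λ P p → coeff D P p ℤ.- coeff E P p) → D ∼ E
    ∼-in D E {f} (f≉0 , f-ord) = f , (λ f≈0 → f≉0 (trans (≈-in {f} {K.0#} f≈0) K-0)) ,
      λ P p → Ord-in P {coeff D P p ℤ.- coeff E P p} (f-ord P p)

    ∼-out : ∀ D E → D ∼ E → ∃[ f ] HasDivisor f (λ P p → coeff D P p ℤ.- coeff E P p)
    ∼-out D E (f , f≉0 , f-ord) = f , (λ f≈0 → f≉0 (≈-out {f} {K.0#} (trans f≈0 (sym K-0)))) ,
      λ P p → Ord-out P {coeff D P p ℤ.- coeff E P p} (f-ord P p)

    c′ : Divisor → 𝒪-Module
    c′ D = 𝓛′ D ⊕ 𝒪′

    c′-rank-2 : ∀ D → IsRank2Bundle (c′ D)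
    c′-rank-2 D = ⊕-rank-2 {𝓛′ D} {𝒪′} (𝓛′-line-bundle D) 𝒪′-line-bundle

    c′-decomposable : ∀ D → IsDecomposable (c′ D)
    c′-decomposable D = 𝓛′ D , 𝒪′ , 𝓛′-line-bundle D , 𝒪′-line-bundle , ≅-refl {c′ D}

    c′-tensor : ∀ D G F {f} → HasDivisor f (λ P p → (coeff D P p ℤ.+ coeff G P p) ℤ.- coeff F P p) →
                IsTensorProduct (c′ D) (𝓛′ G) (𝓛′ F ⊕ 𝓛′ G)
    c′-tensor D G F (f≉0 , f-ord) = tensorᴹ D G F (𝓛′-def D) (𝓛′-def G) (𝓛′-def F) 𝒪′-def f≉0 f-ord

    c′-surjective : ∀ M → IsDecomposable M → ∃[ D ] c′ D ≈ℙ M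
    c′-surjective M (L , L′ , L-line , L′-line , φ) =
      A +ᵈ (-ᵈ B) , 𝓛′ B , 𝓛′-line-bundle B ,
      tensor-resp {c′ (A +ᵈ (-ᵈ B))} {𝓛′ B} {𝓛′ B} {𝓛′ A ⊕ 𝓛′ B} {M} (≅-refl {𝓛′ B}) ψ
        (c′-tensor (A +ᵈ (-ᵈ B)) B A (1-divisor (λ P p → arith (coeff A P p) (coeff B P p))))
      where
      A B : Divisor
      A = proj₁ (line-bundle-divisor L L-line)
      B = proj₁ (line-bundle-divisor L′ L′-line)

      ψ : 𝓛′ A ⊕ 𝓛′ B ≅ M
      ψ = ≅-trans {𝓛′ A ⊕ 𝓛′ B} {L ⊕ L′} {M}
            (≅-⊕ {𝓛′ A} {𝓛′ B} {L} {L′} (≅-sym {L} {𝓛′ A} (proj₂ (line-bundle-divisor L L-line)))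
                                        (≅-sym {L′} {𝓛′ B} (proj₂ (line-bundle-divisor L′ L′-line))))
            (≅-sym {M} {L ⊕ L′} φ)

      arith : ∀ a b → ((a ℤ.+ ℤ.- b) ℤ.+ b) ℤ.- a ≡ 0ℤ
      arith = ℤS.solve 2 (λ a b → ((a ℤS.:+ ℤS.:- b) ℤS.:+ b) ℤS.:- a ℤS.:= ℤS.con 0ℤ) ≡.refl

    -- The twist is by the trivial bundle `𝓛′ 0ᵈ`; a function with divisor D - E turns 𝓛 D into 𝓛 E.
    ∼⇒≈ℙ : ∀ D E → E ∼ D → c′ D ≈ℙ c′ E
    ∼⇒≈ℙ D E E∼D =
      let (f , f-div) = ∼-out E D E∼D
      in 𝓛′ 0ᵈ , 𝓛′-line-bundle 0ᵈ ,
         tensor-resp {c′ D} {𝓛′ 0ᵈ} {𝓛′ 0ᵈ} {𝓛′ E ⊕ 𝓛′ 0ᵈ} {c′ E} (≅-refl {𝓛′ 0ᵈ})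
           (≅-⊕ {𝓛′ E} {𝓛′ 0ᵈ} {𝓛′ E} {𝒪′} (≅-refl {𝓛′ E}) 𝓛′0≅𝒪′)
           (c′-tensor D 0ᵈ E (divisor-inv f-div (λ P p → arith (coeff D P p) (coeff E P p))))
      where
      arith : ∀ d e → ℤ.- (e ℤ.- d) ≡ (d ℤ.+ 0ℤ) ℤ.- e
      arith = ℤS.solve 2 (λ d e → ℤS.:- (e ℤS.:- d) ℤS.:= (d ℤS.:+ ℤS.con 0ℤ) ℤS.:- e) ≡.refl

    -- Twisting by 𝓛 E makes the first summand trivial, as D + E is principal, and turns 𝒪 into 𝓛 E;
    -- the summands then only have to be exchanged.
    ∼-⇒≈ℙ : ∀ D E → E ∼ (-ᵈ D) → c′ D ≈ℙ c′ E
    ∼-⇒≈ℙ D E E∼-D =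
      let (f , f-div) = ∼-out E (-ᵈ D) E∼-D
      in 𝓛′ E , 𝓛′-line-bundle E ,
         tensor-resp {c′ D} {𝓛′ E} {𝓛′ E} {𝓛′ 0ᵈ ⊕ 𝓛′ E} {c′ E} (≅-refl {𝓛′ E})
           (≅-trans {𝓛′ 0ᵈ ⊕ 𝓛′ E} {𝓛′ E ⊕ 𝓛′ 0ᵈ} {c′ E} (⊕-swap (𝓛′ 0ᵈ) (𝓛′ E))
             (≅-⊕ {𝓛′ E} {𝓛′ 0ᵈ} {𝓛′ E} {𝒪′} (≅-refl {𝓛′ E}) 𝓛′0≅𝒪′))
           (c′-tensor D E 0ᵈ (divisor-resp f-div (λ P p → arith (coeff D P p) (coeff E P p))))
      where
      arith : ∀ d e → e ℤ.- (ℤ.- d) ≡ (d ℤ.+ e) ℤ.- 0ℤ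
      arith = ℤS.solve 2 (λ d e → e ℤS.:- (ℤS.:- d) ℤS.:= (d ℤS.:+ e) ℤS.:- ℤS.con 0ℤ) ≡.refl

    -- Uniqueness of the decomposition and the fibres of the map.

    HaveDivisors : Divisor → Divisor → Divisor → Divisor → Set₁
    HaveDivisors A B C E = (∃[ f ] HasDivisor f (λ P p → coeff A P p ℤ.- coeff B P p)) ×
                           (∃[ f ] HasDivisor f (λ P p → coeff C P p ℤ.- coeff E P p))

    module _ {q : ℕ} (enumerate : Fin q → CommutativeRing.Carrier k)
             (enumerated : ∀ a → ∃[ i ] CommutativeRing._≈_ k (enumerate i) a) where

      -- With φ and its inverse given by matrices (a b; c d) and
      -- (a⁻ b⁻; c⁻ d⁻) over K, the products a a⁻ = d d⁻ and b c⁻ = c b⁻ are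
      -- global functions with sum 1, so one of them is nonzero everywhere.
      module KrullSchmidt (A B C E : Divisor) (φ : 𝓛′ A ⊕ 𝓛′ B ≅ 𝓛′ C ⊕ 𝓛′ E) where
        private
          f : Hom (𝓛′ A ⊕ 𝓛′ B) (𝓛′ C ⊕ 𝓛′ E)
          f = _≅_.to φ

          g : Hom (𝓛′ C ⊕ 𝓛′ E) (𝓛′ A ⊕ 𝓛′ B)
          g = _≅_.from φ

          f₁₁ : Hom (𝓛′ A) (𝓛′ C)
          f₁₁ = entry₁₁ {𝓛′ A} {𝓛′ B} {𝓛′ C} {𝓛′ E} f

          f₁₂ : Hom (𝓛′ B) (𝓛′ C)
          f₁₂ = entry₁₂ {𝓛′ A} {𝓛′ B} {𝓛′ C} {𝓛′ E} f

          f₂₁ : Hom (𝓛′ A) (𝓛′ E)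
          f₂₁ = entry₂₁ {𝓛′ A} {𝓛′ B} {𝓛′ C} {𝓛′ E} f

          f₂₂ : Hom (𝓛′ B) (𝓛′ E)
          f₂₂ = entry₂₂ {𝓛′ A} {𝓛′ B} {𝓛′ C} {𝓛′ E} f

          g₁₁ : Hom (𝓛′ C) (𝓛′ A)
          g₁₁ = entry₁₁ {𝓛′ C} {𝓛′ E} {𝓛′ A} {𝓛′ B} g

          g₁₂ : Hom (𝓛′ E) (𝓛′ A)
          g₁₂ = entry₁₂ {𝓛′ C} {𝓛′ E} {𝓛′ A} {𝓛′ B} g

          g₂₁ : Hom (𝓛′ C) (𝓛′ B)
          g₂₁ = entry₂₁ {𝓛′ C} {𝓛′ E} {𝓛′ A} {𝓛′ B} g

          g₂₂ : Hom (𝓛′ E) (𝓛′ B)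
          g₂₂ = entry₂₂ {𝓛′ C} {𝓛′ E} {𝓛′ A} {𝓛′ B} g

          a b c⁺ d a⁻ b⁻ c⁻ d⁻ : K.Carrier
          a  = scalar′ A C f₁₁
          b  = scalar′ B C f₁₂
          c⁺ = scalar′ A E f₂₁
          d  = scalar′ B E f₂₂
          a⁻ = scalar′ C A g₁₁
          b⁻ = scalar′ E A g₁₂
          c⁻ = scalar′ C B g₂₁
          d⁻ = scalar′ E B g₂₂

          a⁻a+b⁻c : a⁻ * a + b⁻ * c⁺ ≈ 1#
          a⁻a+b⁻c = scalar′-sum A C E (product₁₁ {𝓛′ A} {𝓛′ B} {𝓛′ C} {𝓛′ E} φ)

          aa⁻+bc⁻ : a * a⁻ + b * c⁻ ≈ 1#
          aa⁻+bc⁻ = scalar′-sum C A B (product₁₁ {𝓛′ C} {𝓛′ E} {𝓛′ A} {𝓛′ B} (≅-sym φ))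

          cb⁻+dd⁻ : c⁺ * b⁻ + d * d⁻ ≈ 1#
          cb⁻+dd⁻ = scalar′-sum E A B (product₂₂ {𝓛′ C} {𝓛′ E} {𝓛′ A} {𝓛′ B} (≅-sym φ))

          cancelˡ : ∀ {x y z} → x + y ≈ x + z → y ≈ z
          cancelˡ {x} {y} {z} = +-cancelˡ x y z
            where open RingProperties ring using (+-cancelˡ)

          -- The upper left entries of both composites are 1 and, products in K being commutative,
          -- share the summand a a⁻.
          bc⁻≈cb⁻ : b * c⁻ ≈ c⁺ * b⁻
          bc⁻≈cb⁻ = cancelˡ (trans aa⁻+bc⁻ (trans (sym a⁻a+b⁻c) (+-cong (*-comm a⁻ a) (*-comm b⁻ c⁺))))

          aa⁻≈dd⁻ : a * a⁻ ≈ d * d⁻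
          aa⁻≈dd⁻ = cancelˡ (trans (+-comm _ _) (trans (+-congˡ (sym bc⁻≈cb⁻)) (trans aa⁻+bc⁻ (sym cb⁻+dd⁻))))

          diagonal : a * a⁻ ≉0 → HaveDivisors A C B E
          diagonal aa⁻≉0 =
            (a , ≉0-factorˡ aa⁻≉0 ,
             carries-ord {A} {C} {a} {a⁻} (scalar′-carries A C f₁₁) (scalar′-carries C A g₁₁) aa⁻≉0 inv∈) ,
            (d , ≉0-factorˡ dd⁻≉0 ,
             carries-ord {B} {E} {d} {d⁻} (scalar′-carries B E f₂₂) (scalar′-carries E B g₂₂) dd⁻≉0
               (λ P → Local.O-resp P (inv-cong aa⁻≈dd⁻) (inv∈ P)))
            where
            dd⁻≉0 : d * d⁻ ≉0
            dd⁻≉0 = ≉0-resp aa⁻≈dd⁻ aa⁻≉0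

            inv∈ : ∀ P → O P (inv (a * a⁻))
            inv∈ = global-unit enumerate enumerated
              (carries-product {A} {C} {a} {a⁻} (scalar′-carries A C f₁₁) (scalar′-carries C A g₁₁)) aa⁻≉0

          -- The other two products are then equal to 1, so their inverses are regular at every
          -- point.
          antidiagonal : a * a⁻ ≈ 0# → HaveDivisors B C A E
          antidiagonal aa⁻≈0 =
            (b , ≉0-factorˡ (≉0-1 bc⁻≈1) ,
             carries-ord {B} {C} {b} {c⁻} (scalar′-carries B C f₁₂) (scalar′-carries C B g₂₁)
               (≉0-1 bc⁻≈1) (inv∈ bc⁻≈1)) ,
            (c⁺ , ≉0-factorˡ (≉0-1 cb⁻≈1) ,
             carries-ord {A} {E} {c⁺} {b⁻} (scalar′-carries A E f₂₁) (scalar′-carries E A g₁₂)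
               (≉0-1 cb⁻≈1) (inv∈ cb⁻≈1))
            where
            bc⁻≈1 : b * c⁻ ≈ 1#
            bc⁻≈1 = trans (sym (+-identityˡ _)) (trans (+-congʳ (sym aa⁻≈0)) aa⁻+bc⁻)

            cb⁻≈1 : c⁺ * b⁻ ≈ 1#
            cb⁻≈1 = trans (sym bc⁻≈cb⁻) bc⁻≈1

            ≉0-1 : ∀ {y} → y ≈ 1# → y ≉0
            ≉0-1 e = ≉0-resp (sym e) (IsField.1≉0 𝕂-isField)

            inv∈ : ∀ {y} → y ≈ 1# → ∀ P → O P (inv y)
            inv∈ e P = Local.O-resp P (sym (trans (inv-cong e) inv-1)) (Local.O-1 P)

        krull-schmidt : HaveDivisors A C B E ⊎ HaveDivisors B C A E
        krull-schmidt with em {P = a * a⁻ ≈ 0#}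
        ... | yes aa⁻≈0 = inj₂ (antidiagonal aa⁻≈0)
        ... | no aa⁻≉0  = inj₁ (diagonal aa⁻≉0)

      ≈ℙ⇒∼ : ∀ D E → c′ D ≈ℙ c′ E → E ∼ D ⊎ E ∼ (-ᵈ D)
      ≈ℙ⇒∼ D E (N , N-line , T) =
        [ (λ x → inj₁ (diagonal x)) , (λ x → inj₂ (antidiagonal x)) ]′
          (KrullSchmidt.krull-schmidt (D +ᵈ G) G E 0ᵈ φ)
        where
        G : Divisor
        G = proj₁ (line-bundle-divisor N N-line)

        T′ : IsTensorProduct (c′ D) (𝓛′ G) (𝓛′ E ⊕ 𝓛′ 0ᵈ)
        T′ = tensor-resp {c′ D} {N} {𝓛′ G} {c′ E} {𝓛′ E ⊕ 𝓛′ 0ᵈ} (proj₂ (line-bundle-divisor N N-line))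
               (≅-⊕ {𝓛′ E} {𝒪′} {𝓛′ E} {𝓛′ 0ᵈ} (≅-refl {𝓛′ E}) (≅-sym {𝓛′ 0ᵈ} {𝒪′} 𝓛′0≅𝒪′)) T

        φ : 𝓛′ (D +ᵈ G) ⊕ 𝓛′ G ≅ 𝓛′ E ⊕ 𝓛′ 0ᵈ
        φ = tensor-unique {c′ D} {𝓛′ G} {𝓛′ (D +ᵈ G) ⊕ 𝓛′ G} {𝓛′ E ⊕ 𝓛′ 0ᵈ}
              (c′-tensor D G (D +ᵈ G) (1-divisor (λ P p → ℤₚ.+-inverseʳ (coeff D P p ℤ.+ coeff G P p)))) T′

        -- G is eliminated by dividing the two functions, as G - (D + G - E) = E - D.
        diagonal : HaveDivisors (D +ᵈ G) E G 0ᵈ → E ∼ D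
        diagonal ((f , f-div) , (g , g-div)) =
          ∼-in E D (divisor-/ g-div f-div (λ P p → arith (coeff D P p) (coeff E P p) (coeff G P p)))
          where
          arith : ∀ d e g → (g ℤ.- 0ℤ) ℤ.- ((d ℤ.+ g) ℤ.- e) ≡ e ℤ.- d
          arith = ℤS.solve 3 (λ d e g →
            (g ℤS.:- ℤS.con 0ℤ) ℤS.:- ((d ℤS.:+ g) ℤS.:- e) ℤS.:= e ℤS.:- d) ≡.refl

        antidiagonal : HaveDivisors G E (D +ᵈ G) 0ᵈ → E ∼ (-ᵈ D)
        antidiagonal ((f , f-div) , (g , g-div)) =
          ∼-in E (-ᵈ D) (divisor-/ g-div f-div (λ P p → arith (coeff D P p) (coeff E P p) (coeff G P p)))
          where
          arith : ∀ d e g → ((d ℤ.+ g) ℤ.- 0ℤ) ℤ.- (g ℤ.- e) ≡ e ℤ.- (ℤ.- d)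
          arith = ℤS.solve 3 (λ d e g →
            ((d ℤS.:+ g) ℤS.:- ℤS.con 0ℤ) ℤS.:- (g ℤS.:- e) ℤS.:= e ℤS.:- (ℤS.:- d)) ≡.refl

proposition6p3 : (∀ {ℓ} → ExcludedMiddle ℓ) →
    ∀ {q : ℕ} (k : FiniteField q) (X : SmoothProjectiveCurve (FiniteField.ring k)) →
    let open Curve X in
    (∀ D → IsLineBundle (𝓛 D) × IsRank2Bundle (c D) × IsDecomposable (c D)) ×
    (∀ M → IsRank2Bundle M → IsDecomposable M → ∃[ D ] c D ≈ℙ M) ×
    (∀ D E → (c D ≈ℙ c E) ⇔ (E ∼ D ⊎ E ∼ (-ᵈ D)))
proposition6p3 em {q} k X =
  (λ D → 𝓛′-line-bundle D , c′-rank-2 D , c′-decomposable D) ,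
  (λ M _ → c′-surjective M) ,
  λ D E → mk⇔ (≈ℙ⇒∼ (Inverse.from finite) enumerated D E) [ ∼⇒≈ℙ D E , ∼-⇒≈ℙ D E ]′
  where
  open FiniteField k using (isField; finite)
  open CurveTheory em isField X
  open DivisorTheory (λ D → proj₁ (𝓛-stalks D)) 𝓛-stalks-out 𝓛-stalks-in
    (Curve.𝓛 X) (λ D → ≡.sym (proj₂ (𝓛-stalks D))) (Curve.𝒪 X) ≡.refl

  enumerated : ∀ a → ∃[ i ] CommutativeRing._≈_ (FiniteField.ring k) (Inverse.from finite i) a
  enumerated a = Inverse.to finite a , Inverse.strictlyInverseʳ finite a
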